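{- Let $\mathcal G$ be a family of graphs and let $M$ be a function of the input size with $O(M)\supseteq O(n+m)$. The following are equivalent: (1) there is an algorithm with running time in $O(M)$ that computes, for any graph $G\in\mathcal G$ and any starting vertex $s$ of $G$, a LexDFS order of $G$ starting at $s$; (2) there is an algorithm with running time in $O(M)$ that computes, for any graph $G\in\mathcal G$ and any vertex $s$ of $G$, an $\mathcal L$-tree of LexDFS on $G$ rooted in $s$.
   Context: Graphs are finite, simple, undirected and connected, with $n$ vertices and $m$ edges. LexDFS started at $s$: label $s$ with $(0)$, all others with the empty label; for $i=1,\dots,n$ pick an unnumbered vertex $v$ with lexicographically largest label, set $\sigma(i)=v$ and prepend $i$ to the label of each unnumbered neighbor of $v$; a LexDFS order is any possible output. The $\mathcal L$-tree of a vertex order $(v_1,\dots,v_n)$ is the spanning tree rooted at $v_1$ with an edge from each $v_i$ ($i>1$) to its rightmost neighbor $v_j$ with $j<i$. A spanning tree $T$ rooted at $s$ is an $\mathcal L$-tree of LexDFS on $G$ if some LexDFS order of $G$ starting at $s$ has $\mathcal L$-tree $T$. -}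

module Defs where

open import Data.Bool.Base using (Bool; true; false; not; _∧_; _∨_; if_then_else_; T)
open import Data.Bool.Properties using (T?)
open import Data.Fin.Base using (Fin; toℕ) renaming (_≤_ to _≤ᶠ_; _<_ to _<ᶠ_)
open import Data.Fin.Properties using () renaming (_≟_ to _≟ᶠ_; _<?_ to _<?ᶠ_)
open import Data.List.Base using (List; []; _∷_; length; map; filter; allFin; cartesianProduct)
open import Data.List.Membership.Propositional using (_∈_)
open import Data.List.Relation.Binary.Lex.Strict using (Lex-≤)
open import Data.List.Relation.Unary.Unique.Propositional using (Unique)
open import Data.Maybe.Base using (Maybe; just; nothing)
open import Data.Nat.Base using (ℕ; zero; suc; _+_; _*_; _∸_; _≤_; _<_)
open import Data.Nat.Properties using (_≟_)
open import Data.Product.Base using (Σ; ∃; ∃-syntax; _×_; _,_)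
open import Data.Vec.Base using (Vec; []; _∷_; lookup)
open import Function.Bundles using (_⇔_)
open import Relation.Binary.Construct.Closure.ReflexiveTransitive using (Star)
open import Relation.Binary.PropositionalEquality using (_≡_; _≢_)
open import Relation.Nullary using (¬_)
open import Relation.Nullary.Decidable.Core using (does; _×-dec_)
open import Relation.Unary using (Pred)

------------------------------------------------------------------------
-- Graphs

record Graph : Set where
  field
    order : ℕ
    adj   : Fin order → Fin order → Bool

  V : Set
  V = Fin order

  Adj : V → V → Set
  Adj u v = T (adj u v)

  field
    symmetric   : ∀ {u v} → Adj u v → Adj v u
    irreflexive : ∀ {v} → ¬ Adj v v
    connected   : ∀ u v → Star Adj u v

  -- Each edge is counted once, at its increasing orientation.
  size : ℕ
  size = length (filter (λ (u , v) → (u <?ᶠ v) ×-dec T? (adj u v))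
                        (cartesianProduct (allFin order) (allFin order)))

open Graph using (order; size; V; Adj)

------------------------------------------------------------------------
-- LexDFS

_≤ˡᵉˣ_ : List ℕ → List ℕ → Set
_≤ˡᵉˣ_ = Lex-≤ _≡_ _<_

module _ (G : Graph) where
  open Graph G using (adj)

  record Labelling : Set where
    field
      label    : V G → List ℕ
      numbered : V G → Bool

  open Labelling

  initial : V G → Labelling
  initial s .label    v = if does (v ≟ᶠ s) then 0 ∷ [] else []
  initial s .numbered v = false

  number : ℕ → V G → Labelling → Labelling
  number i v ℓ .label    u =
    if not (ℓ .numbered u) ∧ adj v u then i ∷ ℓ .label u else ℓ .label u
  number i v ℓ .numbered u = does (u ≟ᶠ v) ∨ ℓ .numbered u

  Unnumbered : Labelling → V G → Set
  Unnumbered ℓ v = ℓ .numbered v ≡ false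

  -- LexDFSRun i ℓ (vᵢ ∷ vᵢ₊₁ ∷ …): the iterations i, i + 1, … of the
  -- search, entered with labelling ℓ, may select vᵢ, vᵢ₊₁, ….
  data LexDFSRun (i : ℕ) (ℓ : Labelling) : ∀ {k} → Vec (V G) k → Set where
    stop : LexDFSRun i ℓ []
    pick : ∀ {k v} {vs : Vec (V G) k} →
           Unnumbered ℓ v →
           (∀ u → Unnumbered ℓ u → ℓ .label u ≤ˡᵉˣ ℓ .label v) →
           LexDFSRun (suc i) (number i v ℓ) vs →
           LexDFSRun i ℓ (v ∷ vs)

  IsLexDFSOrder : V G → Vec (V G) (order G) → Set
  IsLexDFSOrder s σ = LexDFSRun 1 (initial s) σ

------------------------------------------------------------------------
-- Rooted spanning trees and 𝓛-trees

-- Since the root has no parent and is reached from everywhere, every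
-- other vertex has exactly one parent and the parent edges form a
-- spanning tree.
record RootedSpanningTree (G : Graph) (s : V G) : Set where
  field
    parent        : V G → Maybe (V G)
    root-parent   : parent s ≡ nothing
    parent-adj    : ∀ {v p} → parent v ≡ just p → Adj G v p
    reaches-root  : ∀ v → Star (λ u p → parent u ≡ just p) v s

open RootedSpanningTree using (parent)

module _ (G : Graph) where

  record RightmostEarlierNeighbour (σ : Vec (V G) (order G))
                                   (i j : Fin (order G)) : Set where
    field
      earlier   : j <ᶠ i
      neighbour : Adj G (lookup σ i) (lookup σ j)
      rightmost : ∀ k → k <ᶠ i → Adj G (lookup σ i) (lookup σ k) → k ≤ᶠ j

  record IsLTree (σ : Vec (V G) (order G)) {s : V G}
                 (t : RootedSpanningTree G s) : Set where
    field
      root-first : ∀ i → toℕ i ≡ 0 → lookup σ i ≡ s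
      edges      : ∀ i j → parent t (lookup σ i) ≡ just (lookup σ j) ⇔
                           RightmostEarlierNeighbour σ i j

  IsLTreeOfLexDFS : (s : V G) → RootedSpanningTree G s → Set
  IsLTreeOfLexDFS s t = ∃[ σ ] IsLexDFSOrder G s σ × IsLTree σ t

------------------------------------------------------------------------
-- Input: adjacency lists, each in arbitrary order

record AdjacencyLists (G : Graph) : Set where
  field
    neighbours : V G → List (V G)
    unique     : ∀ v → Unique (neighbours v)
    complete   : ∀ u v → v ∈ neighbours u ⇔ Adj G u v

record Input : Set where
  field
    adjacency : List (List ℕ)
    start     : ℕ

open Input

encode : (G : Graph) → AdjacencyLists G → V G → Input
encode G L s .adjacency = map (λ v → map toℕ (neighbours v)) (allFin (order G))
  where open AdjacencyLists L
encode G L s .start     = toℕ s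

------------------------------------------------------------------------
-- Random access machine with uniform cost

-- A program uses finitely many arrays, named by numbers; a store gives
-- the content of every cell of every array.  A scalar variable is a
-- fixed cell of an array.
Store : Set
Store = ℕ → ℕ → ℕ

infix  9 _[_]
infixl 7 _⊕_ _⊖_
infix  6 _[_]≔_
infixr 5 _⨾_

-- The input is read-only: the number of vertices, the start vertex, the
-- length of the adjacency list of a vertex, and an entry of that list.
data Expr : Set where
  lit       : ℕ → Expr
  _[_]      : ℕ → Expr → Expr
  #vertices : Expr
  source    : Expr
  degree    : Expr → Expr
  nbr       : Expr → Expr → Expr
  _⊕_ _⊖_   : Expr → Expr → Expr

data Program : Set where
  skip          : Program
  _[_]≔_        : ℕ → Expr → Expr → Program
  _⨾_           : Program → Program → Program
  if_then_else′_ : Expr → Program → Program → Program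
  while_loop_   : Expr → Program → Program

nth : ∀ {A : Set} → A → List A → ℕ → A
nth d []       _       = d
nth d (x ∷ xs) zero    = x
nth d (x ∷ xs) (suc k) = nth d xs k

module _ (I : Input) where

  -- Reads outside the input return 0, and ⊖ is truncated subtraction.
  ⟦_⟧ : Expr → Store → ℕ
  ⟦ lit k ⟧     μ = k
  ⟦ a [ e ] ⟧   μ = μ a (⟦ e ⟧ μ)
  ⟦ #vertices ⟧ μ = length (adjacency I)
  ⟦ source ⟧    μ = start I
  ⟦ degree e ⟧  μ = length (nth [] (adjacency I) (⟦ e ⟧ μ))
  ⟦ nbr e f ⟧   μ = nth 0 (nth [] (adjacency I) (⟦ e ⟧ μ)) (⟦ f ⟧ μ)
  ⟦ e ⊕ f ⟧     μ = ⟦ e ⟧ μ + ⟦ f ⟧ μ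
  ⟦ e ⊖ f ⟧     μ = ⟦ e ⟧ μ ∸ ⟦ f ⟧ μ

  _[_,_↦_] : Store → ℕ → ℕ → ℕ → Store
  (μ [ a , i ↦ x ]) b j = if does (a ≟ b) ∧ does (i ≟ j) then x else μ b j

  -- Exec P μ t μ′: from store μ, P halts after t steps in store μ′.
  -- One step is one assignment, test or skip; as the expressions in a
  -- fixed program have bounded size, charging for each of their
  -- operations would change t by at most a constant factor.  A test
  -- succeeds when its value is nonzero.
  data Exec : Program → Store → ℕ → Store → Set where
    exec-skip  : ∀ {μ} → Exec skip μ 1 μ
    exec-≔     : ∀ {a e f μ} →
                 Exec (a [ e ]≔ f) μ 1 (μ [ a , ⟦ e ⟧ μ ↦ ⟦ f ⟧ μ ])
    exec-⨾     : ∀ {P Q μ μ′ μ″ t u} →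
                 Exec P μ t μ′ → Exec Q μ′ u μ″ → Exec (P ⨾ Q) μ (t + u) μ″
    exec-then  : ∀ {e P Q μ μ′ t} → ⟦ e ⟧ μ ≢ 0 →
                 Exec P μ t μ′ → Exec (if e then P else′ Q) μ (1 + t) μ′
    exec-else  : ∀ {e P Q μ μ′ t} → ⟦ e ⟧ μ ≡ 0 →
                 Exec Q μ t μ′ → Exec (if e then P else′ Q) μ (1 + t) μ′
    exec-exit  : ∀ {e P μ} → ⟦ e ⟧ μ ≡ 0 →
                 Exec (while e loop P) μ 1 μ
    exec-iter  : ∀ {e P μ μ′ μ″ t u} → ⟦ e ⟧ μ ≢ 0 →
                 Exec P μ t μ′ → Exec (while e loop P) μ′ u μ″ →
                 Exec (while e loop P) μ (1 + t + u) μ″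

empty : Store
empty _ _ = 0

------------------------------------------------------------------------
-- Running times

-- f ∈ O 𝒢 g is f = O(g), for functions of the order n and the size m,
-- where (n , m) ranges over the pairs realised by the members of 𝒢: on
-- all of ℕ × ℕ a bound such as n² would not dominate n + m.
O : ∀ {ℓ} → Pred Graph ℓ → (ℕ → ℕ → ℕ) → Pred (ℕ → ℕ → ℕ) ℓ
O 𝒢 g f = ∃[ c ] ∃[ k ] ∀ G → 𝒢 G → k ≤ order G + size G →
          f (order G) (size G) ≤ c * g (order G) (size G)

-- What an algorithm has to achieve on a graph and a start vertex; the
-- last argument is the content of the output array.
Task : Set₁
Task = (G : Graph) → V G → (ℕ → ℕ) → Set

-- Some program solves the task on 𝒢, in worst-case time at most τ for
-- some τ in O(M).  The output is read from array 0.
SolvableIn : ∀ {ℓ} → Pred Graph ℓ → (ℕ → ℕ → ℕ) → Task → Set ℓ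
SolvableIn 𝒢 M task =
  ∃[ P ] ∃[ τ ] O 𝒢 M τ ×
    (∀ G → 𝒢 G → (L : AdjacencyLists G) (s : V G) →
      ∃[ t ] ∃[ μ ] Exec (encode G L s) P empty t μ ×
                    t ≤ τ (order G) (size G) ×
                    task G s (μ 0))

-- The (0-based) i-th output cell holds the i-th vertex of the order.
ComputeLexDFSOrder : Task
ComputeLexDFSOrder G s out =
  ∃[ σ ] IsLexDFSOrder G s σ × (∀ i → out (toℕ i) ≡ toℕ (lookup σ i))

-- The tree is output as its parent array; the cell of the root, which
-- has no parent, may hold anything.
ComputeLTreeOfLexDFS : Task
ComputeLTreeOfLexDFS G s out =
  Σ (RootedSpanningTree G s) λ t → IsLTreeOfLexDFS G s t ×
    (∀ v p → parent t v ≡ just p → out (toℕ v) ≡ toℕ p)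

{-# OPTIONS --safe #-}
module Submission where

-- An order is a LexDFS order iff it satisfies the four-point condition:
-- if a < b < c, ac is an edge and ab is not, then db is an edge and dc is
-- not for some d between a and b.
--
-- From an order to a tree: scanning the order from its end, the first
-- processed earlier neighbour of a vertex is its rightmost one.
--
-- From a tree to an order: in an 𝓛-tree of LexDFS every edge joins a
-- vertex to an ancestor, so while the children of a vertex compete, the
-- label of a child is determined by its set of neighbours among the
-- ancestors, compared from the deepest one on.  Hence a preorder of the
-- tree in which siblings come by decreasing sets is a LexDFS order.  All
-- vertices are sorted by these sets at once by partition refinement, with
-- the vertices as pivots in reverse breadth-first order of the tree.
-- Inserting the vertices by increasing sets, each right after its parent,
-- then yields the preorder.

-- Labels change along a search, whereas the four-point condition speaks of the order alone, so it
-- can certify an order that no search has produced. The set of a vertex is read as a binary number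
-- in which the later vertices of one fixed breadth-first order carry the higher digits. One order
-- serves all vertices at once: the ancestors of siblings form a chain, and on a chain all
-- topological orders of the tree agree. How the numbers of other pairs compare is irrelevant,
-- except that a parent has a smaller number than its child, because the child counts the parent
-- itself as its highest digit; hence the single increasing pass. The delicate case of the
-- four-point condition has its third vertex deep below a sibling rather than being the sibling;
-- there the unknown original order, known to exist, is used once more. The numbers can be
-- exponentially large and exist in the proof only: refinement stores just the order of the classes.
-- Both programs start in whatever store the given algorithm leaves behind, so they may assume
-- nothing but the contents of array 0.

open import Defs
open import Data.Bool.Base using (Bool; true; false; if_then_else_; T; _∧_)
open import Data.Bool.Properties using (T?)
open import Data.Empty using (⊥; ⊥-elim)
open import Data.Fin.Base using (Fin; toℕ; fromℕ<)
import Data.Fin.Properties as Fin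
open import Data.List.Base using (List; []; _∷_; _++_; _ʳ++_; length; map; filter; allFin; tabulate; cartesianProduct; lookup)
import Data.List.Membership.DecPropositional as DecMembership
import Data.List.Membership.Propositional as Membership
open import Data.List.Membership.Propositional using (_∈_; _∉_)
open import Data.List.Membership.Propositional.Properties using (∈-++⁺ˡ; ∈-++⁺ʳ; ∈-allFin; ∈-filter⁺; ∈-filter⁻; ∈-lookup)
open import Data.List.Membership.Propositional.Properties.WithK using (unique∧set⇒bag)
open import Data.List.Properties using (length-map; length-tabulate; map-∘; reverse-involutive; ++-ʳ++)
open import Data.List.Relation.Binary.BagAndSetEquality using (∼bag⇒↭)
open import Data.List.Relation.Binary.Lex.Core using (base; halt; this; next)
open import Data.List.Relation.Binary.Permutation.Propositional using (_↭_)
open import Data.List.Relation.Binary.Permutation.Propositional.Properties using (↭-length; map⁺)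
import Data.List.Relation.Unary.All as All
open import Data.List.Relation.Unary.AllPairs using ([]; _∷_)
import Data.List.Relation.Unary.Any as Any
open import Data.List.Relation.Unary.Any using (here; there)
open import Data.List.Relation.Unary.Unique.Propositional using (Unique)
import Data.List.Relation.Unary.Unique.Propositional.Properties as UniqueP
open UniqueP using (allFin⁺)
open import Data.Maybe.Base using (Maybe; just; nothing)
open import Data.Maybe.Properties using (just-injective)
open import Data.Nat.Base using (ℕ; zero; suc; _+_; _*_; _∸_; _≤_; _<_; z≤n; s≤s)
open import Data.Nat.ListAction using (sum)
open import Data.Nat.ListAction.Properties using (sum-↭)
import Data.Nat.Properties as ℕ
open import Data.Nat.Solver using (module +-*-Solver)
open +-*-Solver using (solve; _:+_; _:*_; _:=_; con)
open import Data.Product.Base using (∃-syntax; _×_; _,_; proj₁; proj₂)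
import Data.Sum.Base as Sum
open import Data.Sum.Base using (_⊎_; inj₁; inj₂; [_,_]′)
open import Data.Unit.Base using (⊤; tt)
import Data.Vec.Base as Vec
open import Data.Vec.Base using (Vec; []; _∷_; toList)
open import Data.Vec.Properties using (length-toList; toList∘fromList)
open import Function.Base using (_∘_; id; case_of_; _|>_)
open import Function.Bundles using (_⇔_; mk⇔; Equivalence)
open import Level using (Level)
open import Relation.Binary.Construct.Closure.ReflexiveTransitive using (Star; ε; _◅_)
open import Relation.Binary.Definitions using (DecidableEquality; tri<; tri≈; tri>)
open import Relation.Binary.PropositionalEquality using (_≡_; _≢_; refl; sym; trans; cong; cong₂; subst; subst₂)
open import Relation.Nullary using (¬_; Dec; yes; no; does; contradiction)
open import Relation.Nullary.Decidable using (dec-true; dec-false; ¬?)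
open import Relation.Unary using (Decidable; Pred; _⊆_)

-- Lists by order of occurrence, and linked lists

private variable
  A : Set

data Before {A : Set} : List A → A → A → Set where
  here  : ∀ {x xs b} → b ∈ xs → Before (x ∷ xs) x b
  there : ∀ {x xs a b} → Before xs a b → Before (x ∷ xs) a b

-- An element precedes itself exactly if it occurs twice, so this is freedom from repetitions, in
-- the form that transitivity and asymmetry of `Before` require.
Irrefl : List A → Set
Irrefl xs = ∀ {a} → ¬ Before xs a a

irrefl-tail : ∀ {x} {xs : List A} → Irrefl (x ∷ xs) → Irrefl xs
irrefl-tail irr p = irr (there p)

before-∈ˡ : ∀ {xs} {a b : A} → Before xs a b → a ∈ xs
before-∈ˡ (here _)  = here refl
before-∈ˡ (there p) = there (before-∈ˡ p)

before-∈ʳ : ∀ {xs} {a b : A} → Before xs a b → b ∈ xs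
before-∈ʳ (here b∈) = there b∈
before-∈ʳ (there p) = there (before-∈ʳ p)

before-trans : ∀ {xs} {a b c : A} → Irrefl xs →
               Before xs a b → Before xs b c → Before xs a c
before-trans irr (here b∈) (here _)  = ⊥-elim (irr (here b∈))
before-trans irr (here _)  (there q) = here (before-∈ʳ q)
before-trans irr (there p) (here _)  = ⊥-elim (irr (here (before-∈ʳ p)))
before-trans irr (there p) (there q) = there (before-trans (irrefl-tail irr) p q)

before-asym : ∀ {xs} {a b : A} → Irrefl xs → Before xs a b → ¬ Before xs b a
before-asym irr p q = irr (before-trans irr p q)

before-≢ : ∀ {xs} {a b : A} → Irrefl xs → Before xs a b → a ≢ b
before-≢ irr p refl = irr p

before-total : ∀ {xs} {a b : A} → a ∈ xs → b ∈ xs → a ≢ b →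
               Before xs a b ⊎ Before xs b a
before-total (here refl) (here refl) a≢b = contradiction refl a≢b
before-total (here refl) (there b∈)  _   = inj₁ (here b∈)
before-total (there a∈)  (here refl) _   = inj₂ (here a∈)
before-total (there a∈)  (there b∈)  a≢b with before-total a∈ b∈ a≢b
... | inj₁ p = inj₁ (there p)
... | inj₂ p = inj₂ (there p)

-- In `D ʳ++ vs` the list `D` is a prefix read backwards. Moving the cut, from `D ʳ++ v ∷ vs` to
-- `(v ∷ D) ʳ++ vs`, is a definitional equality; the scans below keep their position in this way.
∈-ʳ++ʳ : ∀ xs {ys} {b : A} → b ∈ ys → b ∈ xs ʳ++ ys
∈-ʳ++ʳ []       b∈ = b∈
∈-ʳ++ʳ (x ∷ xs) b∈ = ∈-ʳ++ʳ xs (there b∈)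

∈-ʳ++ˡ : ∀ xs {ys} {b : A} → b ∈ xs → b ∈ xs ʳ++ ys
∈-ʳ++ˡ (x ∷ xs) (here refl) = ∈-ʳ++ʳ xs (here refl)
∈-ʳ++ˡ (x ∷ xs) (there b∈)  = ∈-ʳ++ˡ xs b∈

∈-ʳ++⁻ : ∀ xs {ys} {b : A} → b ∈ xs ʳ++ ys → b ∈ xs ⊎ b ∈ ys
∈-ʳ++⁻ []       b∈ = inj₂ b∈
∈-ʳ++⁻ (x ∷ xs) b∈ with ∈-ʳ++⁻ xs b∈
... | inj₁ b∈xs         = inj₁ (there b∈xs)
... | inj₂ (here refl)  = inj₁ (here refl)
... | inj₂ (there b∈ys) = inj₂ b∈ys

before-ʳ++ʳ : ∀ xs {ys} {a b : A} → Before ys a b → Before (xs ʳ++ ys) a b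
before-ʳ++ʳ []       p = p
before-ʳ++ʳ (x ∷ xs) p = before-ʳ++ʳ xs (there p)

before-ʳ++ : ∀ xs {ys} {a b : A} → a ∈ xs → b ∈ ys → Before (xs ʳ++ ys) a b
before-ʳ++ (x ∷ xs) (here refl) b∈ = before-ʳ++ʳ xs (here b∈)
before-ʳ++ (x ∷ xs) (there a∈)  b∈ = before-ʳ++ xs a∈ (there b∈)

before-ʳ++ˡ : ∀ xs {ys} {a b : A} → Before xs a b → Before (xs ʳ++ ys) b a
before-ʳ++ˡ (x ∷ xs) (here b∈) = before-ʳ++ xs b∈ (here refl)
before-ʳ++ˡ (x ∷ xs) (there p) = before-ʳ++ˡ xs p

before-ʳ++⁻ : ∀ xs {ys} {a b : A} → Before (xs ʳ++ ys) a b →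
              Before xs b a ⊎ (a ∈ xs × b ∈ ys) ⊎ Before ys a b
before-ʳ++⁻ []       p = inj₂ (inj₂ p)
before-ʳ++⁻ (x ∷ xs) p with before-ʳ++⁻ xs p
... | inj₁ q                        = inj₁ (there q)
... | inj₂ (inj₁ (a∈ , here refl))  = inj₁ (here a∈)
... | inj₂ (inj₁ (a∈ , there b∈))   = inj₂ (inj₁ (there a∈ , b∈))
... | inj₂ (inj₂ (here b∈))         = inj₂ (inj₁ (here refl , b∈))
... | inj₂ (inj₂ (there q))         = inj₂ (inj₂ q)

before-cut : ∀ xs {ys} {a v : A} → Irrefl (xs ʳ++ v ∷ ys) →
             Before (xs ʳ++ v ∷ ys) a v → a ∈ xs
before-cut xs irr p with before-ʳ++⁻ xs p
... | inj₁ q                       = ⊥-elim (irr (before-ʳ++ xs (before-∈ˡ q) (here refl)))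
... | inj₂ (inj₁ (a∈ , _))         = a∈
... | inj₂ (inj₂ (here v∈))        = ⊥-elim (irr (before-ʳ++ʳ xs (here v∈)))
... | inj₂ (inj₂ (there q))        = ⊥-elim (irr (before-ʳ++ʳ xs (here (before-∈ʳ q))))

unique⇒irrefl : {xs : List A} → Unique xs → Irrefl xs
unique⇒irrefl (x∉ ∷ u) (here x∈) = All.lookup x∉ x∈ refl
unique⇒irrefl (x∉ ∷ u) (there p) = unique⇒irrefl u p

irrefl⇒unique : {xs : List A} → Irrefl xs → Unique xs
irrefl⇒unique {xs = []}     irr = []
irrefl⇒unique {xs = x ∷ xs} irr =
  All.tabulate (λ { x∈ refl → irr (here x∈) }) ∷ irrefl⇒unique (irrefl-tail irr)

-- The effect of an assignment on the array concerned: for a fixed array name the store update of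
-- the machine reduces to this.
upd : (ℕ → ℕ) → ℕ → ℕ → ℕ → ℕ
upd f i x j = if does (i ℕ.≟ j) then x else f j

upd-same : ∀ f i x → upd f i x i ≡ x
upd-same f i x = cong (λ b → if b then x else f i) (dec-true (i ℕ.≟ i) refl)

upd-other : ∀ f {i} x {j} → i ≢ j → upd f i x j ≡ f j
upd-other f {i} x {j} i≢j =
  cong (λ b → if b then x else f j) (dec-false (i ℕ.≟ j) i≢j)

-- Pointers are shifted by one, so that 0 is the null pointer.
Linked : (A → ℕ) → (ℕ → ℕ) → ℕ → List A → Set
Linked enc f h []       = h ≡ 0
Linked enc f h (x ∷ xs) = h ≡ suc (enc x) × Linked enc f (f (enc x)) xs

linked-cong : ∀ {enc : A → ℕ} {f g h} xs → (∀ {y} → y ∈ xs → g (enc y) ≡ f (enc y)) →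
              Linked enc f h xs → Linked enc g h xs
linked-cong []       eq l       = l
linked-cong {enc = enc} {g = g} (x ∷ xs) eq (p , l) =
  p , subst (λ k → Linked enc g k xs) (sym (eq (here refl)))
        (linked-cong xs (eq ∘ there) l)

module Insertion {A : Set} (_≟_ : DecidableEquality A) where

  insertAfter : A → A → List A → List A
  insertAfter v x []       = []
  insertAfter v x (y ∷ ys) =
    if does (y ≟ v) then y ∷ x ∷ ys else y ∷ insertAfter v x ys

  ∈-insert⁻ : ∀ {v x b} ys → b ∈ insertAfter v x ys → b ≡ x ⊎ b ∈ ys
  ∈-insert⁻ {v} (y ∷ ys) p with y ≟ v
  ∈-insert⁻ (y ∷ ys) (here b≡y)          | yes _ = inj₂ (here b≡y)
  ∈-insert⁻ (y ∷ ys) (there (here b≡x))  | yes _ = inj₁ b≡x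
  ∈-insert⁻ (y ∷ ys) (there (there b∈))  | yes _ = inj₂ (there b∈)
  ∈-insert⁻ (y ∷ ys) (here b≡y)          | no _  = inj₂ (here b≡y)
  ∈-insert⁻ (y ∷ ys) (there b∈)          | no _ with ∈-insert⁻ ys b∈
  ... | inj₁ b≡x = inj₁ b≡x
  ... | inj₂ b∈′ = inj₂ (there b∈′)

  ∈-insert : ∀ {v x b} ys → b ∈ ys → b ∈ insertAfter v x ys
  ∈-insert {v} (y ∷ ys) p with y ≟ v
  ∈-insert (y ∷ ys) (here b≡y) | yes _ = here b≡y
  ∈-insert (y ∷ ys) (there b∈) | yes _ = there (there b∈)
  ∈-insert (y ∷ ys) (here b≡y) | no _  = here b≡y
  ∈-insert (y ∷ ys) (there b∈) | no _  = there (∈-insert ys b∈)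

  inserted-∈ : ∀ {v x} ys → v ∈ ys → x ∈ insertAfter v x ys
  inserted-∈ {v} (y ∷ ys) p with y ≟ v
  inserted-∈ (y ∷ ys) p           | yes _  = there (here refl)
  inserted-∈ (y ∷ ys) (here refl) | no y≢y = contradiction refl y≢y
  inserted-∈ (y ∷ ys) (there v∈)  | no _   = there (inserted-∈ ys v∈)

  length-insert : ∀ {v x} ys → v ∈ ys → length (insertAfter v x ys) ≡ suc (length ys)
  length-insert {v} (y ∷ ys) p with y ≟ v
  length-insert (y ∷ ys) p           | yes _  = refl
  length-insert (y ∷ ys) (here refl) | no y≢y = contradiction refl y≢y
  length-insert (y ∷ ys) (there v∈)  | no _   = cong suc (length-insert ys v∈)

  -- The cases are that neither element, the first or the second is the inserted one; the invariants
  -- of all insertions are checked by this split.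
  before-insert⁻ : ∀ {v x a b} ys → v ∈ ys → Before (insertAfter v x ys) a b →
                   Before ys a b ⊎ (a ≡ x × Before ys v b) ⊎
                   (b ≡ x × (a ≡ v ⊎ Before ys a v))
  before-insert⁻ {v} (y ∷ ys) v∈ p with y ≟ v
  before-insert⁻ (y ∷ ys) v∈ (here (here refl))  | yes refl = inj₂ (inj₂ (refl , inj₁ refl))
  before-insert⁻ (y ∷ ys) v∈ (here (there b∈))   | yes refl = inj₁ (here b∈)
  before-insert⁻ (y ∷ ys) v∈ (there (here b∈))   | yes refl = inj₂ (inj₁ (refl , here b∈))
  before-insert⁻ (y ∷ ys) v∈ (there (there p))   | yes refl = inj₁ (there p)
  before-insert⁻ (y ∷ ys) (here refl) p          | no y≢y   = contradiction refl y≢y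
  before-insert⁻ (y ∷ ys) (there v∈) (here b∈)   | no _ with ∈-insert⁻ ys b∈
  ... | inj₁ b≡x = inj₂ (inj₂ (b≡x , inj₂ (here v∈)))
  ... | inj₂ b∈′ = inj₁ (here b∈′)
  before-insert⁻ (y ∷ ys) (there v∈) (there p)   | no _ with before-insert⁻ ys v∈ p
  ... | inj₁ q                          = inj₁ (there q)
  ... | inj₂ (inj₁ (a≡x , q))           = inj₂ (inj₁ (a≡x , there q))
  ... | inj₂ (inj₂ (b≡x , inj₁ a≡v))    = inj₂ (inj₂ (b≡x , inj₁ a≡v))
  ... | inj₂ (inj₂ (b≡x , inj₂ q))      = inj₂ (inj₂ (b≡x , inj₂ (there q)))

  irrefl-insert : ∀ {v x ys} → v ∈ ys → x ∉ ys → Irrefl ys → Irrefl (insertAfter v x ys)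
  irrefl-insert {ys = ys} v∈ x∉ irr p with before-insert⁻ ys v∈ p
  ... | inj₁ q                           = irr q
  ... | inj₂ (inj₁ (refl , q))           = x∉ (before-∈ʳ q)
  ... | inj₂ (inj₂ (refl , inj₁ refl))   = x∉ v∈
  ... | inj₂ (inj₂ (refl , inj₂ q))      = x∉ (before-∈ˡ q)

  linked-insert : ∀ {enc : A → ℕ} {f h v x} ys →
                  (∀ {a b} → enc a ≡ enc b → a ≡ b) →
                  v ∈ ys → x ∉ ys → Irrefl ys → Linked enc f h ys →
                  Linked enc (upd (upd f (enc x) (f (enc v))) (enc v) (suc (enc x))) h
                         (insertAfter v x ys)
  linked-insert {enc} {f} {h} {v} {x} ys inj = go ys
    where
    g g′ : ℕ → ℕ
    g  = upd f (enc x) (f (enc v))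
    g′ = upd g (enc v) (suc (enc x))
    other : ∀ {z} → z ≢ v → z ≢ x → g′ (enc z) ≡ f (enc z)
    other z≢v z≢x = trans (upd-other g _ (z≢v ∘ sym ∘ inj)) (upd-other f _ (z≢x ∘ sym ∘ inj))
    go : ∀ {h} ys → v ∈ ys → x ∉ ys → Irrefl ys → Linked enc f h ys →
         Linked enc g′ h (insertAfter v x ys)
    go (y ∷ ys) v∈ x∉ irr (p , l) with y ≟ v
    ... | yes refl =
      p , upd-same g (enc v) _ ,
      subst (λ k → Linked enc g′ k ys)
        (sym (trans (upd-other g _ (λ e → x∉ (here (sym (inj e))))) (upd-same f (enc x) _)))
        (linked-cong ys
          (λ z∈ → other (λ { refl → irr (here z∈) }) (λ { refl → x∉ (there z∈) })) l)
    go (y ∷ ys) (here refl) x∉ irr (p , l) | no y≢y = contradiction refl y≢y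
    go (y ∷ ys) (there v∈) x∉ irr (p , l)  | no y≢v =
      p , subst (λ k → Linked enc g′ k (insertAfter v x ys))
            (sym (other y≢v (λ { refl → x∉ (here refl) })))
            (go ys v∈ (x∉ ∘ there) (irrefl-tail irr) l)

-- LexDFS orders and the four-point condition

before-lookup : ∀ (xs : List A) {i j} → toℕ i < toℕ j → Before xs (lookup xs i) (lookup xs j)
before-lookup (x ∷ xs) {Fin.zero}  {Fin.suc j} _         = here (∈-lookup j)
before-lookup (x ∷ xs) {Fin.suc i} {Fin.suc j} (s≤s i<j) = there (before-lookup xs i<j)

-- If `x` were missing, `x ∷ xs` would have n + 1 entries without repetition, against the pigeonhole
-- principle.
irrefl⇒complete : ∀ {n} {xs : List (Fin n)} → Irrefl xs → length xs ≡ n → ∀ x → x ∈ xs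
irrefl⇒complete {n} {xs} irr len x with Any.any? (x Fin.≟_) xs
... | yes x∈ = x∈
... | no  x∉ with Fin.pigeonhole (subst (λ k → n < suc k) (sym len) ℕ.≤-refl) (lookup (x ∷ xs))
... | i , j , i<j , eq = ⊥-elim (repeat (subst (Before (x ∷ xs) _) (sym eq) (before-lookup (x ∷ xs) i<j)))
  where
  repeat : ∀ {a} → ¬ Before (x ∷ xs) a a
  repeat (here x∈) = x∉ x∈
  repeat (there p) = irr p

module LexDFS (G : Graph) (s : Graph.V G) where
  open Graph G using (V; adj; order; Adj; symmetric; connected)
  open DecMembership (Fin._≟_ {order}) using (_∈?_)
  open Labelling

  FourPoint : List V → Set
  FourPoint W = ∀ {a b c} → Before W a b → Before W b c → Adj a c → ¬ Adj a b →
                ∃[ d ] Before W a d × Before W d b × Adj d b × ¬ Adj d c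

  record Rightmost (W : List V) (p x : V) : Set where
    field
      precedes  : Before W p x
      adjacent  : Adj p x
      rightmost : ∀ {k} → Before W k x → Adj k x → k ≡ p ⊎ Before W k p

  -- The label of u once the vertices of D have been numbered, the last one being the head.
  lab : List V → V → List ℕ
  lab []      u = if does (u Fin.≟ s) then 0 ∷ [] else []
  lab (p ∷ D) u = if adj p u then suc (length D) ∷ lab D u else lab D u

  private
    true⇒adj : ∀ {u v} → adj u v ≡ true → Adj u v
    true⇒adj eq = subst T (sym eq) tt

    false⇒¬adj : ∀ {u v} → adj u v ≡ false → ¬ Adj u v
    false⇒¬adj eq = subst T eq

  lab-base : ∀ {u} → u ≢ s → lab [] u ≡ []
  lab-base {u} u≢s = cong (λ b → if b then 0 ∷ [] else []) (dec-false (u Fin.≟ s) u≢s)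

  -- All entries of `lab D u` are at most `length D`, so a label headed by a larger number is
  -- strictly above it.
  lab-head : ∀ D {u m ns} → u ≢ s → length D < m → ¬ (m ∷ ns) ≤ˡᵉˣ lab D u
  lab-head [] {u} u≢s D<m le with lab [] u | lab-base u≢s
  lab-head [] u≢s D<m () | .[] | refl
  lab-head (p ∷ D) {u} u≢s D<m le with adj p u
  lab-head (p ∷ D) u≢s D<m (this m<) | true  = ℕ.<-asym D<m m<
  lab-head (p ∷ D) u≢s D<m (next refl _) | true = ℕ.<-irrefl refl D<m
  lab-head (p ∷ D) u≢s D<m le | false = lab-head D u≢s (ℕ.<-trans ℕ.≤-refl D<m) le

  lab-below : ∀ D {u m ns} → u ≢ s → length D < m → lab D u ≤ˡᵉˣ (m ∷ ns)
  lab-below [] {u} u≢s D<m with lab [] u | lab-base u≢s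
  ... | .[] | refl = halt
  lab-below (p ∷ D) {u} u≢s D<m with adj p u
  ... | true  = this D<m
  ... | false = lab-below D u≢s (ℕ.<-trans ℕ.≤-refl D<m)

  -- Labels are compared from the latest numbered vertex on, which is the head of `D`; the first
  -- difference decides, and it must favour `b`. As `a` is a difference that favours `c`, the
  -- deciding one lies before `a` in `D`.
  lab-≤⇒ : ∀ D {a b c} → b ≢ s → lab D c ≤ˡᵉˣ lab D b → a ∈ D → Adj a c → ¬ Adj a b →
           ∃[ d ] Before D d a × Adj d b × ¬ Adj d c
  lab-≤⇒ (p ∷ D) {a} {b} {c} b≢s le a∈ ac ¬ab with adj p c in pc | adj p b in pb
  lab-≤⇒ (p ∷ D) b≢s le (here refl) ac ¬ab | true | true =
    contradiction (true⇒adj pb) ¬ab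
  lab-≤⇒ (p ∷ D) b≢s (this l<l) (there a∈) ac ¬ab | true | true =
    contradiction l<l (ℕ.<-irrefl refl)
  lab-≤⇒ (p ∷ D) b≢s (next _ le) (there a∈) ac ¬ab | true | true
    with lab-≤⇒ D b≢s le a∈ ac ¬ab
  ... | d , da , db , dc = d , there da , db , dc
  lab-≤⇒ (p ∷ D) b≢s le a∈ ac ¬ab | true | false = contradiction le (lab-head D b≢s ℕ.≤-refl)
  lab-≤⇒ (p ∷ D) b≢s le (here refl) ac ¬ab | false | true = contradiction ac (false⇒¬adj pc)
  lab-≤⇒ (p ∷ D) b≢s le (there a∈) ac ¬ab | false | true =
    p , here a∈ , true⇒adj pb , false⇒¬adj pc
  lab-≤⇒ (p ∷ D) b≢s le (here refl) ac ¬ab | false | false = contradiction ac (false⇒¬adj pc)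
  lab-≤⇒ (p ∷ D) b≢s le (there a∈) ac ¬ab | false | false
    with lab-≤⇒ D b≢s le a∈ ac ¬ab
  ... | d , da , db , dc = d , there da , db , dc

  -- At the first difference the hypothesis forbids that `c` wins: it would demand a still earlier
  -- difference.
  lab-≤⇐ : ∀ D {b c} → Irrefl D → b ≢ s → c ≢ s →
           (∀ {a} → a ∈ D → Adj a c → ¬ Adj a b → ∃[ d ] Before D d a × Adj d b × ¬ Adj d c) →
           lab D c ≤ˡᵉˣ lab D b
  lab-≤⇐ [] {b} {c} irr b≢s c≢s hyp
    with lab [] b | lab-base b≢s | lab [] c | lab-base c≢s
  ... | .[] | refl | .[] | refl = base tt
  lab-≤⇐ (p ∷ D) {b} {c} irr b≢s c≢s hyp with adj p c in pc | adj p b in pb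
  ... | true | true = next refl (lab-≤⇐ D (irrefl-tail irr) b≢s c≢s hyp′)
    where
    hyp′ : ∀ {a} → a ∈ D → Adj a c → ¬ Adj a b → ∃[ d ] Before D d a × Adj d b × ¬ Adj d c
    hyp′ a∈ ac ¬ab with hyp (there a∈) ac ¬ab
    ... | d , here _   , db , ¬dc = contradiction (true⇒adj pc) ¬dc
    ... | d , there da , db , ¬dc = d , da , db , ¬dc
  ... | true | false with hyp (here refl) (true⇒adj pc) (false⇒¬adj pb)
  ...   | d , here p∈  , _ = ⊥-elim (irr (here p∈))
  ...   | d , there da , _ = ⊥-elim (irr (here (before-∈ʳ da)))
  lab-≤⇐ (p ∷ D) {b} {c} irr b≢s c≢s hyp | false | true = lab-below D c≢s ℕ.≤-refl
  lab-≤⇐ (p ∷ D) {b} {c} irr b≢s c≢s hyp | false | false =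
    lab-≤⇐ D (irrefl-tail irr) b≢s c≢s hyp′
    where
    hyp′ : ∀ {a} → a ∈ D → Adj a c → ¬ Adj a b → ∃[ d ] Before D d a × Adj d b × ¬ Adj d c
    hyp′ a∈ ac ¬ab with hyp (there a∈) ac ¬ab
    ... | d , here _   , db , ¬dc = contradiction db (false⇒¬adj pb)
    ... | d , there da , db , ¬dc = d , da , db , ¬dc

  -- A run of the search in which the labelling is replaced by the list `D` of numbered vertices,
  -- latest first, from which the labels can be recomputed.
  Greedy : List V → List V → Set
  Greedy D []       = ⊤
  Greedy D (v ∷ vs) =
    v ∉ D × (∀ u → u ∉ D → lab D u ≤ˡᵉˣ lab D v) × Greedy (v ∷ D) vs

  record Represents (D : List V) (ℓ : Labelling G) : Set where
    field
      unnumbered   : ∀ {u} → u ∉ D → numbered ℓ u ≡ false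
      unnumbered⁻  : ∀ {u} → numbered ℓ u ≡ false → u ∉ D
      label≡       : ∀ {u} → u ∉ D → label ℓ u ≡ lab D u

  open Represents

  represents-initial : Represents [] (initial G s)
  represents-initial .unnumbered _  = refl
  represents-initial .unnumbered⁻ _ ()
  represents-initial .label≡ _      = refl

  represents-number : ∀ {D ℓ v} → Represents D ℓ →
                      Represents (v ∷ D) (number G (suc (length D)) v ℓ)
  represents-number {v = v} r .unnumbered {u} u∉
    rewrite dec-false (u Fin.≟ v) (u∉ ∘ here) = unnumbered r (u∉ ∘ there)
  represents-number {v = v} r .unnumbered⁻ {u} eq (here refl)
    rewrite dec-true (u Fin.≟ u) refl = case eq of λ ()
  represents-number {v = v} r .unnumbered⁻ {u} eq (there u∈)
    with does (u Fin.≟ v)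
  ... | false = unnumbered⁻ r eq u∈
  represents-number {v = v} r .label≡ {u} u∉
    rewrite unnumbered r (u∉ ∘ there) | label≡ r (u∉ ∘ there) = refl

  run⇒greedy : ∀ {D ℓ k} {vs : Vec V k} → Represents D ℓ →
               LexDFSRun G (suc (length D)) ℓ vs → Greedy D (toList vs)
  run⇒greedy r stop = tt
  run⇒greedy r (pick un max run) =
    unnumbered⁻ r un ,
    (λ u u∉ → subst (_≤ˡᵉˣ _) (label≡ r u∉)
                (subst (_ ≤ˡᵉˣ_) (label≡ r (unnumbered⁻ r un)) (max u (unnumbered r u∉)))) ,
    run⇒greedy (represents-number r) run

  greedy⇒run : ∀ {D ℓ k} (vs : Vec V k) → Represents D ℓ →
               Greedy D (toList vs) → LexDFSRun G (suc (length D)) ℓ vs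
  greedy⇒run []       r _ = stop
  greedy⇒run (v ∷ vs) r (v∉ , max , g) =
    pick (unnumbered r v∉)
      (λ u un → subst (_≤ˡᵉˣ _) (sym (label≡ r (unnumbered⁻ r un)))
                  (subst (_ ≤ˡᵉˣ_) (sym (label≡ r v∉)) (max u (unnumbered⁻ r un))))
      (greedy⇒run vs (represents-number r) g)

  greedy⇒irrefl : ∀ D vs → Irrefl D → Greedy D vs → Irrefl (D ʳ++ vs)
  greedy⇒irrefl D [] irr _ p with before-ʳ++⁻ D p
  ... | inj₁ q = irr q
  ... | inj₂ (inj₁ (_ , ()))
  ... | inj₂ (inj₂ ())
  greedy⇒irrefl D (v ∷ vs) irr (v∉ , _ , g) =
    greedy⇒irrefl (v ∷ D) vs (λ { (here v∈) → v∉ v∈ ; (there p) → irr p }) g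

  -- The induction moves the cut to just before `b`. There `c` is still unnumbered, so its label is
  -- at most that of `b`, and the deciding vertex from `lab-≤⇒` comes after `a` because `D` is
  -- reversed. With `s ∈ D` the exceptional initial label of `s` stays out of the comparison.
  greedy⇒fourPoint : ∀ D {vs} → s ∈ D → Irrefl (D ʳ++ vs) → Greedy D vs →
    ∀ {a b c} → Before (D ʳ++ vs) a b → Before vs b c → Adj a c → ¬ Adj a b →
    ∃[ d ] Before (D ʳ++ vs) a d × Before (D ʳ++ vs) d b × Adj d b × ¬ Adj d c
  greedy⇒fourPoint D {b ∷ vs} s∈ irr (b∉ , max , g) {a} {_} {c} ab (here c∈) ac ¬ab
    with lab-≤⇒ D (λ { refl → b∉ s∈ })
           (max c (λ c∈D → irr (before-ʳ++ D c∈D (there c∈))))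
           (before-cut D irr ab) ac ¬ab
  ... | d , da , db , ¬dc =
    d , before-ʳ++ˡ D da , before-ʳ++ D (before-∈ˡ da) (here refl) , db , ¬dc
  greedy⇒fourPoint D {v ∷ vs} s∈ irr (v∉ , max , g) ab (there bc) ac ¬ab =
    greedy⇒fourPoint (v ∷ D) (there s∈) irr g ab bc ac ¬ab

  fourPoint⇒greedy : ∀ D vs → s ∈ D → Irrefl (D ʳ++ vs) → (∀ u → u ∈ D ʳ++ vs) →
                     FourPoint (D ʳ++ vs) → Greedy D vs
  fourPoint⇒greedy D []       _  _   _  _  = tt
  fourPoint⇒greedy D (v ∷ vs) s∈ irr co fp =
    v∉ , max , fourPoint⇒greedy (v ∷ D) vs (there s∈) irr co fp
    where
    v∉ : v ∉ D
    v∉ v∈ = irr (before-ʳ++ D v∈ (here refl))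
    ≢s : ∀ {u} → u ∉ D → u ≢ s
    ≢s u∉ refl = u∉ s∈
    irrD : Irrefl D
    irrD p = irr (before-ʳ++ˡ D p)
    max : ∀ u → u ∉ D → lab D u ≤ˡᵉˣ lab D v
    max u u∉ with ∈-ʳ++⁻ D (co u)
    ... | inj₁ u∈            = contradiction u∈ u∉
    ... | inj₂ (here refl)   = lab-≤⇐ D irrD (≢s v∉) (≢s u∉) (λ _ ac ¬ac → contradiction ac ¬ac)
    ... | inj₂ (there u∈)    = lab-≤⇐ D irrD (≢s v∉) (≢s u∉) hyp
      where
      hyp : ∀ {a} → a ∈ D → Adj a u → ¬ Adj a v → ∃[ d ] Before D d a × Adj d v × ¬ Adj d u
      hyp a∈ au ¬av with fp (before-ʳ++ D a∈ (here refl)) (before-ʳ++ʳ D (here u∈)) au ¬av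
      ... | d , ad , dv , adj-dv , ¬du with before-ʳ++⁻ D ad
      ...   | inj₁ da             = d , da , adj-dv , ¬du
      ...   | inj₂ (inj₁ (_ , q)) = ⊥-elim (irr (before-ʳ++ D (before-cut D irr dv) q))
      ...   | inj₂ (inj₂ q)       = ⊥-elim (irr (before-ʳ++ D (before-cut D irr dv) (before-∈ʳ q)))

  fourPoint⇒order : (σ : Vec V order) → ∀ {vs} → toList σ ≡ s ∷ vs →
                    Irrefl (s ∷ vs) → FourPoint (s ∷ vs) → (∀ u → u ∈ s ∷ vs) →
                    IsLexDFSOrder G s σ
  fourPoint⇒order σ {vs} eq irr fp co =
    greedy⇒run σ represents-initial
      (subst (Greedy []) (sym eq)
        ((λ ()) , max , fourPoint⇒greedy (s ∷ []) vs (here refl) irr co fp))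
    where
    max : ∀ u → u ∉ [] → lab [] u ≤ˡᵉˣ lab [] s
    max u _ rewrite dec-true (s Fin.≟ s) refl with does (u Fin.≟ s)
    ... | true  = next refl (base tt)
    ... | false = halt

  lab-≤[] : ∀ D {u} → lab D u ≤ˡᵉˣ [] → ∀ {p} → p ∈ D → ¬ Adj p u
  lab-≤[] (q ∷ D) {u} le p∈ pu with adj q u in qu
  lab-≤[] (q ∷ D) () p∈ pu | true
  lab-≤[] (q ∷ D) le (here refl) pu | false = false⇒¬adj qu pu
  lab-≤[] (q ∷ D) le (there p∈) pu  | false = lab-≤[] D le p∈ pu

  lab-isolated : ∀ D {u} → u ≢ s → (∀ {p} → p ∈ D → ¬ Adj p u) → lab D u ≡ []
  lab-isolated []      u≢s none = lab-base u≢s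
  lab-isolated (q ∷ D) {u} u≢s none with adj q u in qu
  ... | true  = contradiction (true⇒adj qu) (none (here refl))
  ... | false = lab-isolated D u≢s (none ∘ there)

  leaving-edge : ∀ D {a b} → a ∈ D → b ∉ D → Star Adj a b → ∃[ p ] ∃[ u ] p ∈ D × u ∉ D × Adj p u
  leaving-edge D a∈ b∉ ε = contradiction a∈ b∉
  leaving-edge D {a} a∈ b∉ (_◅_ {j = c} ac path) with c ∈? D
  ... | yes c∈ = leaving-edge D c∈ b∉ path
  ... | no c∉  = a , c , a∈ , c∉ , ac

  -- If the chosen `b` had no numbered neighbour, its label, and by maximality every unnumbered
  -- label, would be empty. But connectedness provides an edge from a numbered vertex to an
  -- unnumbered one.
  greedy⇒earlier : ∀ D {vs} → s ∈ D → Greedy D vs → ∀ {b} → b ∈ vs →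
                   ∃[ a ] Before (D ʳ++ vs) a b × Adj a b
  greedy⇒earlier D {b ∷ vs} s∈ (b∉ , max , _) (here refl)
    with Any.any? (λ a → T? (adj a b)) D
  ... | yes found with Membership.find found
  ...   | a , a∈ , ab = a , before-ʳ++ D a∈ (here refl) , ab
  greedy⇒earlier D {b ∷ vs} s∈ (b∉ , max , _) (here refl) | no none
    with leaving-edge D s∈ b∉ (connected s b)
  ... | p , u , p∈ , u∉ , pu =
    contradiction pu (lab-≤[] D
      (subst (lab D u ≤ˡᵉˣ_)
        (lab-isolated D (λ { refl → b∉ s∈ }) (λ a∈ ab → none (Membership.lose a∈ ab)))
        (max u u∉)) p∈)
  greedy⇒earlier D {v ∷ vs} s∈ (_ , _ , g) (there b∈) = greedy⇒earlier (v ∷ D) (there s∈) g b∈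

  -- What is kept of a LexDFS order once labels are out of sight; `earlier` is where connectedness
  -- of the graph enters.
  record SearchOrder (W : List V) : Set where
    field
      rest      : List V
      s-first   : W ≡ s ∷ rest
      irrefl    : Irrefl W
      complete  : ∀ u → u ∈ W
      fourPoint : FourPoint W
      earlier   : ∀ {b} → b ≢ s → ∃[ a ] Before W a b × Adj a b

  order⇒search : (σ : Vec V order) → IsLexDFSOrder G s σ → SearchOrder (toList σ)
  order⇒search σ run = go (toList σ) (length-toList σ) (run⇒greedy represents-initial run)
    where
    go : ∀ W → length W ≡ order → Greedy [] W → SearchOrder W
    go [] len g = case subst Fin (sym len) s of λ ()
    go (v ∷ W) len (_ , max , g) with v Fin.≟ s | max s (λ ())
    -- At the start `s` carries the label (0) and all other vertices the empty one, so a first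
    -- vertex other than `s` would not be maximal.
    ... | no v≢s  | le rewrite dec-true (s Fin.≟ s) refl = case le of λ ()
    ... | yes refl | _ = record
      { rest      = W
      ; s-first   = refl
      ; irrefl    = irr
      ; complete  = co
      ; fourPoint = λ ab bc → fp ab bc
      ; earlier   = early
      }
      where
      irr : Irrefl (s ∷ W)
      irr = greedy⇒irrefl (s ∷ []) W (λ { (here ()) ; (there ()) }) g
      co : ∀ u → u ∈ s ∷ W
      co = irrefl⇒complete irr len
      fp : FourPoint (s ∷ W)
      fp ab (here _)   = ⊥-elim (case before-cut [] irr ab of λ ())
      fp ab (there bc) = greedy⇒fourPoint (s ∷ []) (here refl) irr g ab bc
      early : ∀ {b} → b ≢ s → ∃[ a ] Before (s ∷ W) a b × Adj a b
      early {b} b≢s with co b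
      ... | here b≡s = contradiction b≡s b≢s
      ... | there b∈ = greedy⇒earlier (s ∷ []) (here refl) g b∈

-- Search trees

before? : DecidableEquality A → ∀ xs (a b : A) → Dec (Before xs a b)
before? _≟_ []       a b = no λ ()
before? _≟_ (x ∷ xs) a b with before? _≟_ xs a b
... | yes p = yes (there p)
... | no ¬p with x ≟ a | Any.any? (b ≟_) xs
...   | yes refl | yes b∈ = yes (here b∈)
...   | yes refl | no b∉  = no λ { (here b∈) → b∉ b∈ ; (there p) → ¬p p }
...   | no x≢a   | _      = no λ { (here _) → x≢a refl ; (there p) → ¬p p }

-- Sets as binary numbers

half-≤ : ∀ {a c} → a + a ≤ suc (c + c) → a ≤ c
half-≤ {a} {c} le with a ℕ.≤? c
... | yes a≤c = a≤c
... | no  a≰c = contradiction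
  (ℕ.≤-trans (subst (_≤ a + a) (cong suc (ℕ.+-suc c c)) (ℕ.+-mono-≤ (ℕ.≰⇒> a≰c) (ℕ.≰⇒> a≰c))) le)
  (ℕ.<-irrefl refl)

half-< : ∀ {a c} → a + a < c + c → a < c
half-< {a} {c} lt with c ℕ.≤? a
... | yes c≤a = contradiction (ℕ.<-≤-trans lt (ℕ.+-mono-≤ c≤a c≤a)) (ℕ.<-irrefl refl)
... | no  c≰a = ℕ.≰⇒> c≰a

double-< : ∀ {a c} → a < c → suc (a + a) < c + c
double-< {a} {c} lt = subst (_≤ c + c) (cong suc (ℕ.+-suc a a)) (ℕ.+-mono-≤ lt lt)

digit-< : ∀ b c {m n} → m < n → (if b then suc else id) (m + m) < (if c then suc else id) (n + n)
digit-< true  true  m<n = s≤s (ℕ.+-mono-< m<n m<n)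
digit-< true  false m<n = double-< m<n
digit-< false true  m<n = ℕ.m≤n⇒m≤1+n (ℕ.+-mono-< m<n m<n)
digit-< false false m<n = ℕ.+-mono-< m<n m<n

-- The head of the list carries the least significant binary digit.
val : (A → Bool) → List A → ℕ
val P []       = 0
val P (p ∷ xs) = (if P p then suc else id) (val P xs + val P xs)

val-<⇒ : ∀ {P Q : A → Bool} xs → val P xs < val Q xs → ∃[ d ] d ∈ xs × Q d ≡ true × P d ≡ false
val-<⇒ {P = P} {Q} (p ∷ xs) lt with P p in Pp | Q p in Qp
... | false | true = p , here refl , Qp , Pp
... | true | true with val-<⇒ xs (half-< (ℕ.≤-pred lt))
...   | d , d∈ , Qd , Pd = d , there d∈ , Qd , Pd
val-<⇒ (p ∷ xs) lt | true | false with val-<⇒ xs (half-< (ℕ.<-trans ℕ.≤-refl lt))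
...   | d , d∈ , Qd , Pd = d , there d∈ , Qd , Pd
val-<⇒ (p ∷ xs) lt | false | false with val-<⇒ xs (half-< lt)
...   | d , d∈ , Qd , Pd = d , there d∈ , Qd , Pd

-- The highest digit in which the two numbers differ belongs to `Q`; as `r` is a difference the
-- other way, that digit lies above `r`, that is, later in the list.
val-≤⇒ : ∀ {P Q : A → Bool} xs → val P xs ≤ val Q xs → ∀ {r} → r ∈ xs → P r ≡ true → Q r ≡ false →
         ∃[ d ] Before xs r d × Q d ≡ true × P d ≡ false
val-≤⇒ {A} {P} {Q} (p ∷ xs) le {r} r∈ Pr Qr = go r∈
  where
  tail-≤ : val P xs ≤ val Q xs
  tail-≤ with P p | Q p
  ... | true  | true  = half-≤ (ℕ.m≤n⇒m≤1+n (ℕ.≤-pred le))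
  ... | true  | false = half-≤ (ℕ.≤-trans (ℕ.n≤1+n _) (ℕ.m≤n⇒m≤1+n le))
  ... | false | true  = half-≤ le
  ... | false | false = half-≤ (ℕ.m≤n⇒m≤1+n le)
  go : r ∈ p ∷ xs → ∃[ d ] Before (p ∷ xs) r d × Q d ≡ true × P d ≡ false
  go (here refl) with P p | Q p
  go (here refl) | true | false with val-<⇒ xs (half-< le)
  ... | d , d∈ , Qd , Pd = d , here d∈ , Qd , Pd
  go (there r∈′) with val-≤⇒ xs tail-≤ r∈′ Pr Qr
  ... | d , rd , Qd , Pd = d , there rd , Qd , Pd

-- The four-point condition in terms of sets. On lists without repetitions it is equivalent to
-- `val P xs ≤ val Q xs`, by `val-≤⇒` and `val-≤⇐`.
Dominates : (A → Bool) → (A → Bool) → List A → Set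
Dominates Q P xs = ∀ {r} → r ∈ xs → P r ≡ true → Q r ≡ false →
                   ∃[ d ] Before xs r d × Q d ≡ true × P d ≡ false

dominates-tail : ∀ {P Q : A → Bool} {p xs} → Irrefl (p ∷ xs) → Dominates Q P (p ∷ xs) → Dominates Q P xs
dominates-tail irr dom r∈ Pr Qr with dom (there r∈) Pr Qr
... | d , here _   , _  = ⊥-elim (irr (here r∈))
... | d , there rd , PQ = d , rd , PQ

-- Mutual with `val-≤⇐`: a lowest digit 1 against 0 is made up for only by a strict inequality of
-- the remaining digits, and dominance supplies the digit `d` that makes it strict.
val-<⇐ : ∀ {P Q : A → Bool} xs → Irrefl xs → Dominates Q P xs →
         ∀ {d} → d ∈ xs → Q d ≡ true → P d ≡ false → val P xs < val Q xs
val-≤⇐ : ∀ {P Q : A → Bool} xs → Irrefl xs → Dominates Q P xs → val P xs ≤ val Q xs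

val-<⇐ {P = P} {Q} (p ∷ xs) irr dom (here refl) Qd Pd with P p | Q p
... | false | true = s≤s (ℕ.+-mono-≤ ih ih)
  where ih = val-≤⇐ {P = P} {Q} xs (irrefl-tail irr) (dominates-tail irr dom)
val-<⇐ {P = P} {Q} (p ∷ xs) irr dom (there d∈) Qd Pd =
  digit-< (P p) (Q p) (val-<⇐ xs (irrefl-tail irr) (dominates-tail irr dom) d∈ Qd Pd)

val-≤⇐ []       irr dom = z≤n
val-≤⇐ {P = P} {Q} (p ∷ xs) irr dom with P p in Pp | Q p in Qp
... | true  | true  = s≤s (ℕ.+-mono-≤ ih ih)
  where ih = val-≤⇐ {P = P} {Q} xs (irrefl-tail irr) (dominates-tail irr dom)
... | false | true  = ℕ.m≤n⇒m≤1+n (ℕ.+-mono-≤ ih ih)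
  where ih = val-≤⇐ {P = P} {Q} xs (irrefl-tail irr) (dominates-tail irr dom)
... | false | false = ℕ.+-mono-≤ ih ih
  where ih = val-≤⇐ {P = P} {Q} xs (irrefl-tail irr) (dominates-tail irr dom)
... | true  | false with dom (here refl) Pp Qp
...   | d , here d∈ , Qd , Pd =
  ℕ.<⇒≤ (digit-< true false (val-<⇐ {P = P} {Q} xs (irrefl-tail irr) (dominates-tail irr dom) d∈ Qd Pd))
...   | d , there pd , _      = ⊥-elim (irr (here (before-∈ˡ pd)))

-- Ancestors, keys and preorders of a search tree

module Tree (G : Graph) (s : Graph.V G) (t : RootedSpanningTree G s) where
  open Graph G using (V; adj; order; Adj; symmetric)
  open RootedSpanningTree t
  open LexDFS G s

  Par : V → V → Set
  Par p x = parent x ≡ just p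

  -- Reflexive: a vertex is its own ancestor.
  Anc : V → V → Set
  Anc a x = Star (λ u p → Par p u) x a

  par-functional : ∀ {p q x} → Par p x → Par q x → p ≡ q
  par-functional px qx = just-injective (trans (sym px) qx)

  has-parent : ∀ {x} → x ≢ s → ∃[ p ] Par p x
  has-parent {x} x≢s with reaches-root x
  ... | ε      = contradiction refl x≢s
  ... | px ◅ _ = _ , px

  s-orphan : ∀ {p} → ¬ Par p s
  s-orphan ps with trans (sym ps) root-parent
  ... | ()

  anc-linear : ∀ {p q x} → Anc p x → Anc q x → Anc p q ⊎ Anc q p
  anc-linear ε        qx       = inj₂ qx
  anc-linear (py ◅ p) ε        = inj₁ (py ◅ p)
  anc-linear (py ◅ p) (qy ◅ q) rewrite par-functional py qy = anc-linear p q

  anc-child : ∀ {d c} → Anc d c → d ≢ c → ∃[ e ] Par d e × Anc e c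
  anc-child ε d≢d = contradiction refl d≢d
  anc-child {d} {c} (_◅_ {j = p} pc path) d≢c with d Fin.≟ p
  ... | yes refl = c , pc , ε
  ... | no d≢p with anc-child path d≢p
  ...   | e , de , ep = e , de , pc ◅ ep

  -- Weights a vertex by the set of its neighbours that precede it in Q,
  -- the later ones being more significant.
  module Keys (Q : List V) where

    -- The neighbours of `c`, cut off at `e`. With `e` an ancestor of `c` this lets a vertex deep
    -- below `e` be compared with a sibling of `e`.
    restricted : V → V → V → Bool
    restricted e c p = adj p c ∧ does (before? Fin._≟_ Q p e)

    bit : V → V → Bool
    bit x = restricted x x

    key : V → ℕ
    key x = val (bit x) Q

    restricted⁺ : ∀ {e c p} → Adj p c → Before Q p e → restricted e c p ≡ true
    restricted⁺ {e} {c} {p} pc pe with adj p c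
    ... | true = dec-true (before? Fin._≟_ Q p e) pe

    restricted⁻ : ∀ {e c p} → restricted e c p ≡ true → Adj p c × Before Q p e
    restricted⁻ {e} {c} {p} eq with adj p c | before? Fin._≟_ Q p e
    ... | true | yes pe = tt , pe

    restricted⁺-false : ∀ {e c p} → ¬ (Adj p c × Before Q p e) → restricted e c p ≡ false
    restricted⁺-false {e} {c} {p} fails with restricted e c p in eq
    ... | false = refl
    ... | true  = contradiction (restricted⁻ {e} {c} {p} eq) fails

    restricted⁻-false : ∀ {e c p} → restricted e c p ≡ false → Before Q p e → ¬ Adj p c
    restricted⁻-false {e} {c} {p} eq pe pc with trans (sym eq) (restricted⁺ {e} {c} {p} pc pe)
    ... | ()

  record Topological (X : List V) : Set where
    field
      irreflexive : Irrefl X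
      covers      : ∀ x → x ∈ X
      par-before  : ∀ {p x} → Par p x → Before X p x

    anc-before : ∀ {a x} → Anc a x → a ≢ x → Before X a x
    anc-before ε a≢a = contradiction refl a≢a
    anc-before {a} (_◅_ {j = p} px path) a≢x with a Fin.≟ p
    ... | yes refl = par-before px
    ... | no a≢p   = before-trans irreflexive (anc-before path a≢p) (par-before px)

    ¬anc : ∀ {a x} → Before X a x → ¬ Anc x a
    ¬anc ax xa = before-asym irreflexive ax
      (anc-before xa (λ { refl → irreflexive ax }))

  -- A preorder of the tree, phrased so that it also makes sense for a list under construction that
  -- holds only some of the vertices. At the empty path `ordered` says that there are no
  -- repetitions.
  record Contiguous (X : List V) : Set where
    field
      ordered    : ∀ {a b} → Before X a b → ¬ Anc b a
      contiguous : ∀ {a b c} → Before X a b → Before X b c → Anc a c → Anc a b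

    topological : (∀ x → x ∈ X) → Topological X
    topological co = record
      { irreflexive = λ p → ordered p ε
      ; covers      = co
      ; par-before  = pb
      }
      where
      p≢x : ∀ {p x} → Par p x → p ≢ x
      p≢x px refl = Graph.irreflexive G (parent-adj px)
      pb : ∀ {p x} → Par p x → Before X p x
      pb {p} {x} px with before-total (co p) (co x) (p≢x px)
      ... | inj₁ b = b
      ... | inj₂ b = contradiction (px ◅ ε) (ordered b)

  open Insertion (Fin._≟_ {order})

  ParentClosed : List V → Set
  ParentClosed X = ∀ {p x} → x ∈ X → Par p x → p ∈ X

  anc-closed : ∀ {X a x} → ParentClosed X → Anc a x → x ∈ X → a ∈ X
  anc-closed closed ε         x∈ = x∈
  anc-closed closed (px ◅ ap) x∈ = anc-closed closed ap (closed x∈ px)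

  SiblingsSorted : (V → ℕ) → List V → Set
  SiblingsSorted rank X = ∀ {b e d} → Before X b e → Par d b → Par d e → rank e ≤ rank b

  module _ {X : List V} {v x : V} (v∈ : v ∈ X) (x∉ : x ∉ X) (vx : Par v x) where

    -- Placed right after its parent, `x` precedes all its siblings, which is where the largest rank
    -- belongs.
    siblingsSorted-insert : ∀ {rank} → Contiguous X → (∀ {y} → y ∈ X → rank y ≤ rank x) →
                            SiblingsSorted rank X → SiblingsSorted rank (insertAfter v x X)
    siblingsSorted-insert contig top sorted be db de with before-insert⁻ X v∈ be
    ... | inj₁ q                       = sorted q db de
    ... | inj₂ (inj₁ (refl , ve))      = top (before-∈ʳ ve)
    ... | inj₂ (inj₂ (refl , inj₁ refl)) rewrite par-functional de vx =
      contradiction (parent-adj db) (Graph.irreflexive G)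
    ... | inj₂ (inj₂ (refl , inj₂ bv)) rewrite par-functional de vx =
      contradiction (db ◅ ε) (Contiguous.ordered contig bv)

    -- By `ParentClosed` no descendant of `x` is listed yet, so `x` enters as a leaf; and every
    -- ancestor of `x` other than `x` is one of `v`, so each case reduces to contiguity around `v`.
    contiguous-insert : ParentClosed X → Contiguous X → Contiguous (insertAfter v x X)
    contiguous-insert closed contig = record { ordered = ord ; contiguous = cont }
      where
      open Contiguous contig
      via-parent : ∀ {a} → Anc a x → a ≢ x → Anc a v
      via-parent ε         x≢x = contradiction refl x≢x
      via-parent (px ◅ ap) _   rewrite par-functional px vx = ap
      no-descendant : ∀ {y} → y ∈ X → ¬ Anc x y
      no-descendant y∈ xy = x∉ (anc-closed closed xy y∈)
      ∈⇒≢ : ∀ {y} → y ∈ X → y ≢ x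
      ∈⇒≢ y∈ refl = x∉ y∈
      ≤v-∈ : ∀ {b} → b ≡ v ⊎ Before X b v → b ∈ X
      ≤v-∈ (inj₁ refl) = v∈
      ≤v-∈ (inj₂ bv)   = before-∈ˡ bv
      ord : ∀ {a b} → Before (insertAfter v x X) a b → ¬ Anc b a
      ord ab ba with before-insert⁻ X v∈ ab
      ... | inj₁ q                  = ordered q ba
      ... | inj₂ (inj₁ (refl , vb)) = ordered vb (via-parent ba (∈⇒≢ (before-∈ʳ vb)))
      ... | inj₂ (inj₂ (refl , av)) = no-descendant (≤v-∈ av) ba
      cont : ∀ {a b c} → Before (insertAfter v x X) a b → Before (insertAfter v x X) b c →
             Anc a c → Anc a b
      cont ab bc ac with before-insert⁻ X v∈ bc | before-insert⁻ X v∈ ab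
      ... | inj₁ q | inj₁ p                        = contiguous p q ac
      ... | inj₁ q | inj₂ (inj₁ (refl , _))        = contradiction ac (no-descendant (before-∈ʳ q))
      ... | inj₁ q | inj₂ (inj₂ (refl , _))        = contradiction (before-∈ˡ q) x∉
      ... | inj₂ (inj₁ (refl , vc)) | inj₁ p                     = contradiction (before-∈ʳ p) x∉
      ... | inj₂ (inj₁ (refl , vc)) | inj₂ (inj₁ (refl , vx′))   = contradiction (before-∈ʳ vx′) x∉
      ... | inj₂ (inj₁ (refl , vc)) | inj₂ (inj₂ (_ , inj₁ refl)) = vx ◅ ε
      ... | inj₂ (inj₁ (refl , vc)) | inj₂ (inj₂ (_ , inj₂ av))  = vx ◅ contiguous av vc ac
      ... | inj₂ (inj₂ (refl , bv)) | inj₂ (inj₂ (refl , _))     = contradiction (≤v-∈ bv) x∉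
      ... | inj₂ (inj₂ (refl , inj₁ refl)) | inj₁ p              = via-parent ac (∈⇒≢ (before-∈ˡ p))
      ... | inj₂ (inj₂ (refl , inj₂ bv))   | inj₁ p              =
        contiguous p bv (via-parent ac (∈⇒≢ (before-∈ˡ p)))
      ... | inj₂ (inj₂ (refl , inj₁ refl)) | inj₂ (inj₁ (refl , vv)) = contradiction ε (ordered vv)
      ... | inj₂ (inj₂ (refl , inj₂ bv))   | inj₂ (inj₁ (refl , vb)) =
        contradiction ε (ordered (before-trans (λ p → ordered p ε) vb bv))

  module _ {W : List V} (search : SearchOrder W) (par-rightmost : ∀ {p x} → Par p x → Rightmost W p x) where
    open SearchOrder search
    open Rightmost

    private
      ¬before-s : ∀ {a} → ¬ Before W a s
      ¬before-s p = go s-first irrefl p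
        where
        go : ∀ {W} → W ≡ s ∷ rest → Irrefl W → ¬ Before W _ s
        go refl irr (here s∈) = irr (here s∈)
        go refl irr (there p) = irr (here (before-∈ʳ p))

      topoW : Topological W
      topoW = record
        { irreflexive = irrefl ; covers = complete ; par-before = precedes ∘ par-rightmost }

    open Topological

    -- Climb from `b` to its parent `p`, which is not before `a`: if `ab` is an edge because `p` is
    -- the rightmost earlier neighbour of `b`, and otherwise because the four-point condition yields
    -- a neighbour of `b` after `a`. The climb stops at `a`.
    between⇒anc : ∀ {a b c} → Before W a b → Before W b c → Adj a c → Star (λ u p → Par p u) b s → Anc a b
    between⇒anc ab bc ac ε = contradiction ab ¬before-s
    between⇒anc {a} {b} ab bc ac (_◅_ {j = p} pb path) with a≤p
      where
      a≤p : a ≡ p ⊎ Before W a p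
      a≤p with T? (adj a b)
      ... | yes adj-ab = rightmost (par-rightmost pb) ab adj-ab
      ... | no ¬adj-ab with fourPoint ab bc ac ¬adj-ab
      ...   | d , ad , db , adj-db , _ with rightmost (par-rightmost pb) db adj-db
      ...     | inj₁ refl = inj₂ ad
      ...     | inj₂ dp   = inj₂ (before-trans irrefl ad dp)
    ... | inj₁ refl = pb ◅ ε
    ... | inj₂ ap   = pb ◅ between⇒anc ap (before-trans irrefl (precedes (par-rightmost pb)) bc) ac path

    adj⇒anc : ∀ {a c} → Before W a c → Adj a c → Anc a c
    adj⇒anc {a} {c} ac adj-ac with reaches-root c
    ... | ε = contradiction ac ¬before-s
    ... | _◅_ {j = p} pc path with rightmost (par-rightmost pc) ac adj-ac
    ...   | inj₁ refl = pc ◅ ε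
    ...   | inj₂ ap   = pc ◅ between⇒anc ap (precedes (par-rightmost pc)) adj-ac path

    edge⇒anc : ∀ {X} → Topological X → ∀ {a c} → Before X a c → Adj a c → Anc a c
    edge⇒anc topo {a} {c} ac adj-ac
      with before-total (complete a) (complete c) (before-≢ (irreflexive topo) ac)
    ... | inj₁ acW = adj⇒anc acW adj-ac
    ... | inj₂ caW = contradiction (adj⇒anc caW (symmetric adj-ac)) (¬anc topo ac)

    module _ {Q : List V} (topoQ : Topological Q) where

      open Keys Q

      -- All vertices counted for `p` precede `p` in `Q`, while `x` counts `p` itself, a digit above
      -- all of theirs.
      key-parent : ∀ {p x} → Par p x → key p < key x
      key-parent {p} {x} px =
        val-<⇐ Q (irreflexive topoQ)
          (λ {r} r∈ rp _ → p , proj₂ (restricted⁻ {p} {p} {r} rp) , bit-x , bit-p)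
          (before-∈ˡ p<x) bit-x bit-p
        where
        p<x = par-before topoQ px
        bit-x = restricted⁺ {x} {x} {p} (adjacent (par-rightmost px)) p<x
        bit-p = restricted⁺-false {p} {p} {p} (irreflexive topoQ ∘ proj₂)

      key-anc : ∀ {a x} → Anc a x → key a ≤ key x
      key-anc ε         = ℕ.≤-refl
      key-anc (px ◅ ap) = ℕ.≤-trans (key-anc ap) (ℕ.<⇒≤ (key-parent px))

      private
        -- If `c` below `e` has a neighbour `p` above `e` that `e` lacks, the four-point condition
        -- of `W` at `p`, `e`, `c` gives a neighbour `d` of `e`, not of `c`, between `p` and `e`.
        -- All of `p`, `d`, `e` lie on one chain of ancestors, so `Q` orders them as `W` does.
        branch-dominates : ∀ {e c} → Anc e c → Dominates (bit e) (restricted e c) Q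
        branch-dominates {e} {c} ec {p} p∈ Cp Ep with restricted⁻ {e} {c} {p} Cp
        ... | pc , pe with anc-linear (edge⇒anc topoQ p<c pc) ec
          where
          p<c : Before Q p c
          p<c with e Fin.≟ c
          ... | yes refl = pe
          ... | no e≢c   = before-trans (irreflexive topoQ) pe (anc-before topoQ ec e≢c)
        ...   | inj₂ anc-ep = contradiction anc-ep (¬anc topoQ pe)
        ...   | inj₁ anc-pe = result
          where
          ¬pe : ¬ Adj p e
          ¬pe = restricted⁻-false {e} {e} {p} Ep pe
          e≢c : e ≢ c
          e≢c refl = ¬pe pc
          result : ∃[ d ] Before Q p d × bit e d ≡ true × restricted e c d ≡ false
          result with fourPoint (anc-before topoW anc-pe (before-≢ (irreflexive topoQ) pe))
                                (anc-before topoW ec e≢c) pc ¬pe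
          ... | d , pd , de , adj-de , ¬dc =
            d , anc-before topoQ anc-pd (before-≢ irrefl pd) ,
            restricted⁺ {e} {e} {d} adj-de (anc-before topoQ anc-de (before-≢ irrefl de)) ,
            restricted⁺-false {e} {c} {d} (¬dc ∘ proj₁)
            where
            anc-de = adj⇒anc de adj-de
            anc-pd : Anc p d
            anc-pd with anc-linear anc-pe anc-de
            ... | inj₁ q = q
            ... | inj₂ q = contradiction q (¬anc topoW pd)

      module _ {O : List V} (contig : Contiguous O) (completeO : ∀ x → x ∈ O)
               (sorted : SiblingsSorted key O) where
        open Contiguous contig

        private
          topoO : Topological O
          topoO = topological completeO

          -- Ancestors of one vertex form a chain, on which all topological orders agree; witnesses
          -- are carried from `W` and `Q` to `O` through the tree in this way.
          anc-before-anc : ∀ {X a d b} → Topological X → Anc a b → Anc d b → Before X a d → Anc a d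
          anc-before-anc topo ab db ad with anc-linear ab db
          ... | inj₁ q = q
          ... | inj₂ q = contradiction q (¬anc topo ad)

        -- As an edge, `ac` makes `a` an ancestor of `c`, and contiguity makes it one of `b`. Let
        -- `d` be the parent of `b`. If `dc` is no edge, `d` is the witness. Otherwise let `e` be
        -- the child of `d` towards `c`. If `e` is `b`, the witness comes from `W`; if not, `e` is a
        -- sibling of `b` placed after it, and comparing their keys yields the witness.
        fourPoint-O : FourPoint O
        fourPoint-O {a} {b} {c} a<b b<c ac ¬ab = main (contiguous a<b b<c anc-ac)
          where
          irrO = irreflexive topoO
          anc-ac : Anc a c
          anc-ac = edge⇒anc topoO (before-trans irrO a<b b<c) ac
          main : Anc a b → ∃[ d ] Before O a d × Before O d b × Adj d b × ¬ Adj d c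
          main ε = ⊥-elim (irrO a<b)
          main (_◅_ {j = d} pb anc-ad) with T? (adj d c)
          ... | no ¬dc  = d , a<d , par-before topoO pb , adjacent (par-rightmost pb) , ¬dc
            where
            a<d : Before O a d
            a<d = anc-before topoO anc-ad (λ { refl → ¬ab (adjacent (par-rightmost pb)) })
          ... | yes dc with anc-child (edge⇒anc topoO (before-trans irrO (par-before topoO pb) b<c) dc)
                              (before-≢ irrO (before-trans irrO (par-before topoO pb) b<c))
          ...   | e , de , ec with e Fin.≟ b
          ...     | yes refl with fourPoint (anc-before topoW (pb ◅ anc-ad) (before-≢ irrO a<b))
                                            (anc-before topoW ec (before-≢ irrO b<c)) ac ¬ab
          ...       | d′ , ad′ , d′b , adj-d′b , ¬d′c =
            d′ , anc-before topoO (anc-before-anc topoW (pb ◅ anc-ad) anc-d′b ad′) (before-≢ irrefl ad′) ,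
            anc-before topoO anc-d′b (before-≢ irrefl d′b) , adj-d′b , ¬d′c
            where anc-d′b = adj⇒anc d′b adj-d′b
          main (_◅_ {j = d} pb anc-ad) | yes dc | e , de , ec | no e≢b
            with val-≤⇒ Q key-≤ (covers topoQ a)
                   (restricted⁺ {e} {c} {a} ac (anc-before topoQ (de ◅ anc-ad) a≢e))
                   (restricted⁺-false {b} {b} {a} (¬ab ∘ proj₁))
            where
            a≢e : a ≢ e
            a≢e refl = ¬anc topoW (precedes (par-rightmost de)) anc-ad
            b<e : Before O b e
            b<e with before-total (completeO b) (completeO e) (e≢b ∘ sym)
            ... | inj₁ q = q
            ... | inj₂ e<b with contiguous e<b b<c ec
            ...   | ε = contradiction refl e≢b
            ...   | pb′ ◅ anc-ed rewrite par-functional pb′ pb =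
              contradiction anc-ed (¬anc topoW (precedes (par-rightmost de)))
            -- The set of `c` cut off at `e` is dominated by that of `e`, whose key is at most the
            -- key of its earlier sibling `b`.
            key-≤ : val (restricted e c) Q ≤ key b
            key-≤ = ℕ.≤-trans (val-≤⇐ Q (irreflexive topoQ) (branch-dominates ec)) (sorted b<e pb de)
          ... | d′ , ad′ , bit-b , out with restricted⁻ {b} {b} {d′} bit-b
          ...   | d′b , d′<b =
            d′ , anc-before topoO (anc-before-anc topoQ (pb ◅ anc-ad) anc-d′b ad′)
                   (before-≢ (irreflexive topoQ) ad′) ,
            anc-before topoO anc-d′b (before-≢ (irreflexive topoQ) d′<b) , d′b ,
            restricted⁻-false {e} {c} {d′} out d′<e
            where
            anc-d′b : Anc d′ b
            anc-d′b = edge⇒anc topoQ d′<b d′b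
            anc-d′d : Anc d′ b → Anc d′ d
            anc-d′d ε = ⊥-elim (irreflexive topoQ d′<b)
            anc-d′d (pb′ ◅ q) rewrite par-functional pb′ pb = q
            d′≢e : d′ ≢ e
            d′≢e refl = ¬anc topoW (precedes (par-rightmost de)) (anc-d′d anc-d′b)
            d′<e : Before Q d′ e
            d′<e = anc-before topoQ (de ◅ anc-d′d anc-d′b) d′≢e

-- Running programs

module Machine (I : Input) where

  -- A total-correctness Hoare triple with a time bound.
  record Runs (P : Program) (bound : ℕ) (μ : Store) (R : Store → Set) : Set where
    constructor runs
    field
      {time}    : ℕ
      {final}   : Store
      execution : Exec I P μ time final
      time≤     : time ≤ bound
      post      : R final

  runs-≤ : ∀ {P b c μ R} → b ≤ c → Runs P b μ R → Runs P c μ R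
  runs-≤ b≤c (runs e t≤ r) = runs e (ℕ.≤-trans t≤ b≤c) r

  runs-map : ∀ {P b μ} {R S : Store → Set} → (∀ {μ} → R μ → S μ) → Runs P b μ R → Runs P b μ S
  runs-map f (runs e t≤ r) = runs e t≤ (f r)

  runs-⨾ : ∀ {P Q b c μ R} → Runs P b μ (λ μ′ → Runs Q c μ′ R) → Runs (P ⨾ Q) (b + c) μ R
  runs-⨾ (runs e t≤ (runs f u≤ r)) = runs (exec-⨾ e f) (ℕ.+-mono-≤ t≤ u≤) r

  runs-exit : ∀ {e P μ} {R : Store → Set} → ⟦_⟧ I e μ ≡ 0 → R μ → Runs (while e loop P) 1 μ R
  runs-exit e≡0 r = runs (exec-exit e≡0) ℕ.≤-refl r

  runs-iter : ∀ {e P b c μ R} → ⟦_⟧ I e μ ≢ 0 → Runs P b μ (λ μ′ → Runs (while e loop P) c μ′ R) →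
              Runs (while e loop P) (suc (b + c)) μ R
  runs-iter e≢0 (runs x t≤ (runs y u≤ r)) = runs (exec-iter e≢0 x y) (s≤s (ℕ.+-mono-≤ t≤ u≤)) r

  -- Weakest preconditions and costs are meant for loop-free programs only.
  wp : Program → (Store → Set) → Store → Set
  wp skip                    R μ = R μ
  wp (a [ e ]≔ f)            R μ = R (_[_,_↦_] I μ a (⟦_⟧ I e μ) (⟦_⟧ I f μ))
  wp (P ⨾ Q)                 R μ = wp P (wp Q R) μ
  wp (if e then P else′ Q)   R μ = (⟦_⟧ I e μ ≢ 0 → wp P R μ) × (⟦_⟧ I e μ ≡ 0 → wp Q R μ)
  wp (while e loop P)        R μ = ⊥

  cost : Program → ℕ
  cost skip                  = 1
  cost (a [ e ]≔ f)          = 1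
  cost (P ⨾ Q)               = cost P + cost Q
  cost (if e then P else′ Q) = suc (cost P + cost Q)
  cost (while e loop P)      = 0

  runs-wp : ∀ P {μ R} → wp P R μ → Runs P (cost P) μ R
  runs-wp skip         r = runs exec-skip ℕ.≤-refl r
  runs-wp (a [ e ]≔ f) r = runs exec-≔ ℕ.≤-refl r
  runs-wp (P ⨾ Q)      w = runs-⨾ (runs-map (runs-wp Q) (runs-wp P w))
  runs-wp (if e then P else′ Q) {μ} (th , el) with ⟦_⟧ I e μ ℕ.≟ 0
  ... | yes e≡0 with runs-wp Q (el e≡0)
  ...   | runs x t≤ r = runs (exec-else e≡0 x) (s≤s (ℕ.≤-trans t≤ (ℕ.m≤n+m _ _))) r
  runs-wp (if e then P else′ Q) {μ} (th , el) | no e≢0 with runs-wp P (th e≢0)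
  ...   | runs x t≤ r = runs (exec-then e≢0 x) (s≤s (ℕ.≤-trans t≤ (ℕ.m≤m+n _ _))) r

nth-ʳ++ : ∀ (xs : List A) {d y ys} → nth d (xs ʳ++ y ∷ ys) (length xs) ≡ y
nth-ʳ++ xs {d} {y} {ys} =
  subst (λ k → nth d (xs ʳ++ y ∷ ys) k ≡ y) (ℕ.+-identityʳ (length xs)) (go xs 0 refl)
  where
  go : ∀ {ys} xs k → nth d ys k ≡ y → nth d (xs ʳ++ ys) (length xs + k) ≡ y
  go []       k eq = eq
  go (x ∷ xs) k eq rewrite sym (ℕ.+-suc (length xs) k) = go xs (suc k) eq

nth-map-tabulate : ∀ {B : Set} {n d} (f : A → B) (g : Fin n → A) i →
                   nth d (map f (tabulate g)) (toℕ i) ≡ f (g i)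
nth-map-tabulate f g Fin.zero    = refl
nth-map-tabulate f g (Fin.suc i) = nth-map-tabulate f (g ∘ Fin.suc) i

nth-map : ∀ {B : Set} {d e} (f : A → B) xs {k} → k < length xs →
          nth e (map f xs) k ≡ f (nth d xs k)
nth-map f (x ∷ xs) {zero}  _         = refl
nth-map f (x ∷ xs) {suc k} (s≤s k<) = nth-map f xs k<

length-ʳ++ : ∀ (xs : List A) {ys} → length (xs ʳ++ ys) ≡ length xs + length ys
length-ʳ++ []            = refl
length-ʳ++ (x ∷ xs) {ys} = trans (length-ʳ++ xs) (ℕ.+-suc (length xs) (length ys))

∸-nonzero : ∀ {m n} → m < n → n ∸ m ≢ 0
∸-nonzero m<n eq = contradiction (ℕ.m∸n≡0⇒m≤n eq) (ℕ.<⇒≱ m<n)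

nonzero-∸ : ∀ {m n} → n ∸ m ≢ 0 → m < n
nonzero-∸ {m} {n} ne with m ℕ.<? n
... | yes m<n = m<n
... | no m≮n  = contradiction (ℕ.m≤n⇒m∸n≡0 (ℕ.≮⇒≥ m≮n)) ne

-- Array names are distinct numerals, on which the comparison in a store update computes. An
-- invariant about one array therefore passes unchanged through assignments to others, which is why
-- many preservation proofs are identities.
QUEUE TAIL HEAD VERTEX INDEX NEIGHBOUR CURSOR COUNTER : ℕ
QUEUE     = 1
TAIL      = 2
HEAD      = 3
VERTEX    = 4
INDEX     = 5
NEIGHBOUR = 6
CURSOR    = 7
COUNTER   = 8

forVertices : Program → Program
forVertices B =
  COUNTER [ lit 0 ]≔ lit 0 ⨾
  (while #vertices ⊖ COUNTER [ lit 0 ] loop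
    (B ⨾ COUNTER [ lit 0 ]≔ COUNTER [ lit 0 ] ⊕ lit 1))

forNeighbours : Program → Program
forNeighbours B =
  INDEX [ lit 0 ]≔ lit 0 ⨾
  (while degree (VERTEX [ lit 0 ]) ⊖ INDEX [ lit 0 ] loop
    (NEIGHBOUR [ lit 0 ]≔ nbr (VERTEX [ lit 0 ]) (INDEX [ lit 0 ]) ⨾
     (B ⨾ INDEX [ lit 0 ]≔ INDEX [ lit 0 ] ⊕ lit 1)))

-- Although the array is filled as a queue, it is emptied from its far end, so its entries are
-- visited in reverse order.
popAll : Program → Program
popAll B =
  while TAIL [ lit 0 ] loop
    (TAIL [ lit 0 ]≔ TAIL [ lit 0 ] ⊖ lit 1 ⨾
     VERTEX [ lit 0 ]≔ QUEUE [ TAIL [ lit 0 ] ] ⨾ B)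

-- The array holds the reverse of the list.
Cells : ∀ {n} → (ℕ → ℕ) → List (Fin n) → Set
Cells f []       = ⊤
Cells f (x ∷ xs) = f (length xs) ≡ toℕ x × Cells f xs

cells-upd : ∀ {n f k x} (xs : List (Fin n)) → length xs ≤ k → Cells f xs → Cells (upd f k x) xs
cells-upd []       _   _        = tt
cells-upd {f = f} {k} {x} (y ∷ ys) y<k (p , c) =
  trans (upd-other f {k} x (λ { refl → ℕ.<-irrefl refl y<k })) p , cells-upd ys (ℕ.<⇒≤ y<k) c

cells-at : ∀ {n f x} (xs : List (Fin n)) {ys} → Cells f (xs ʳ++ x ∷ ys) → f (length ys) ≡ toℕ x
cells-at xs c = proj₁ (suffix xs c)
  where
  suffix : ∀ {n f} (xs : List (Fin n)) {ys} → Cells f (xs ʳ++ ys) → Cells f ys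
  suffix []       c = c
  suffix (x ∷ xs) c = proj₂ (suffix xs c)

module Search (G : Graph) (L : AdjacencyLists G) (s : Graph.V G) where
  open Graph G using (V; adj; order; Adj; symmetric)
  open AdjacencyLists L
  I : Input
  I = encode G L s
  open Machine I public

  weight : List V → ℕ
  weight xs = sum (map (λ v → suc (length (neighbours v))) xs)

  #vertices≡ : length (Input.adjacency I) ≡ order
  #vertices≡ = trans (length-map _ (allFin order)) (length-tabulate id)

  nth-adjacency : ∀ v → nth [] (Input.adjacency I) (toℕ v) ≡ map toℕ (neighbours v)
  nth-adjacency v = nth-map-tabulate (λ v → map toℕ (neighbours v)) id v

  degree≡ : ∀ v → length (nth [] (Input.adjacency I) (toℕ v)) ≡ length (neighbours v)
  degree≡ v = trans (cong length (nth-adjacency v)) (length-map toℕ (neighbours v))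

  -- A round takes a test, the body and the increment, `2 + cost B` steps; the initialisation and
  -- the last test are absorbed by rounding up to a multiple of `suc order`.
  runs-for : ∀ B (Inv : ℕ → Store → Set) {μ} →
    (∀ {j μ} → j < order → μ COUNTER 0 ≡ j → Inv j μ →
      wp B (λ μ′ → μ′ COUNTER 0 ≡ j × Inv (suc j) (_[_,_↦_] I μ′ COUNTER 0 (μ′ COUNTER 0 + 1))) μ) →
    Inv 0 (_[_,_↦_] I μ COUNTER 0 0) →
    Runs (forVertices B) ((3 + cost B) * suc order) μ (Inv order)
  runs-for B Inv {μ} step init =
    runs-≤ bound (runs-⨾ (runs exec-≔ ℕ.≤-refl (go order (ℕ.+-identityʳ order) refl init)))
    where
    go : ∀ k {j μ} → k + j ≡ order → μ COUNTER 0 ≡ j → Inv j μ →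
           Runs (while #vertices ⊖ COUNTER [ lit 0 ] loop (B ⨾ COUNTER [ lit 0 ]≔ COUNTER [ lit 0 ] ⊕ lit 1))
                (1 + k * (2 + cost B)) μ (Inv order)
    go zero {μ = μ} k+j eq inv =
      runs-exit (ℕ.m≤n⇒m∸n≡0 (ℕ.≤-reflexive (trans #vertices≡ (trans (sym k+j) (sym eq)))))
        (subst (λ j → Inv j μ) k+j inv)
    go (suc k) {j} {μ} k+j eq inv =
      runs-≤ (s≤s (ℕ.≤-reflexive arith))
        (runs-iter (∸-nonzero (subst₂ _<_ (sym eq) (sym #vertices≡) j<))
          (runs-⨾ (runs-map (λ {μ′} (eq′ , inv′) →
              runs exec-≔ ℕ.≤-refl (go k (trans (ℕ.+-suc k j) k+j) (trans (cong (_+ 1) eq′) (ℕ.+-comm j 1)) inv′))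
            (runs-wp B (step j< eq inv)))))
      where
      j< : j < order
      j< = subst (j <_) k+j (s≤s (ℕ.m≤n+m j k))
      arith : cost B + 1 + (1 + k * (2 + cost B)) ≡ suc k * (2 + cost B)
      arith = solve 2 (λ c k → c :+ con 1 :+ (con 1 :+ k :* (con 2 :+ c)) :=
                        (con 1 :+ k) :* (con 2 :+ c)) refl (cost B) k
    bound : 1 + (1 + order * (2 + cost B)) ≤ (3 + cost B) * suc order
    bound = subst (2 + order * (2 + cost B) ≤_)
      (solve 2 (λ c n → con 2 :+ n :* (con 2 :+ c) :+ (con 1 :+ c :+ n) :=
                 (con 3 :+ c) :* (con 1 :+ n)) refl (cost B) order)
      (ℕ.m≤m+n _ _)

  -- Adjacency lists come in arbitrary order, so the postcondition describes the list `D` of visited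
  -- vertices only as a set, together with its length. That `w` is new in each round rests on the
  -- lists having no repetitions.
  runs-forNeighbours : ∀ B v (Inv : List V → Store → Set) {μ} →
    μ VERTEX 0 ≡ toℕ v →
    (∀ {D w μ} → w ∉ D → Adj v w → μ VERTEX 0 ≡ toℕ v → μ NEIGHBOUR 0 ≡ toℕ w → Inv D μ →
      wp B (λ μ′ → μ′ VERTEX 0 ≡ toℕ v × μ′ INDEX 0 ≡ μ INDEX 0 ×
                   Inv (w ∷ D) (_[_,_↦_] I μ′ INDEX 0 (μ′ INDEX 0 + 1))) μ) →
    (∀ {D x μ} → Inv D μ → Inv D (_[_,_↦_] I μ NEIGHBOUR 0 x)) →
    Inv [] (_[_,_↦_] I μ INDEX 0 0) →
    Runs (forNeighbours B) ((3 + cost B) * suc (length (neighbours v))) μ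
      (λ μ′ → μ′ VERTEX 0 ≡ toℕ v × ∃[ D ] (∀ u → u ∈ D ⇔ Adj v u) × length D ≡ length (neighbours v) × Inv D μ′)
  runs-forNeighbours B v Inv {μ} at-v step stable init =
    runs-≤ bound (runs-⨾ (runs exec-≔ ℕ.≤-refl (go [] (neighbours v) refl at-v refl init)))
    where
    post : Store → Set
    post μ′ = μ′ VERTEX 0 ≡ toℕ v × ∃[ D ] (∀ u → u ∈ D ⇔ Adj v u) × length D ≡ length (neighbours v) × Inv D μ′
    go : ∀ D ws {μ} → D ʳ++ ws ≡ neighbours v → μ VERTEX 0 ≡ toℕ v → μ INDEX 0 ≡ length D → Inv D μ →
           Runs (while degree (VERTEX [ lit 0 ]) ⊖ INDEX [ lit 0 ] loop
                  (NEIGHBOUR [ lit 0 ]≔ nbr (VERTEX [ lit 0 ]) (INDEX [ lit 0 ]) ⨾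
                  (B ⨾ INDEX [ lit 0 ]≔ INDEX [ lit 0 ] ⊕ lit 1)))
                (1 + length ws * (3 + cost B)) μ post
    degree-here : ∀ D ws {μ : Store} → D ʳ++ ws ≡ neighbours v → μ VERTEX 0 ≡ toℕ v →
                  length (nth [] (Input.adjacency I) (μ VERTEX 0)) ≡ length D + length ws
    degree-here D ws eq at-v rewrite at-v = trans (degree≡ v) (trans (cong length (sym eq)) (length-ʳ++ D))
    go D [] {μ} eq at-v ix inv =
      runs-exit (ℕ.m≤n⇒m∸n≡0 (ℕ.≤-reflexive
          (trans (degree-here D [] {μ} eq at-v) (trans (ℕ.+-identityʳ (length D)) (sym ix)))))
        (at-v , D , (λ u → mk⇔
          (λ u∈ → Equivalence.to (complete v u) (subst (u ∈_) eq (∈-ʳ++ˡ D u∈)))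
          (λ vu → case ∈-ʳ++⁻ D (subst (u ∈_) (sym eq) (Equivalence.from (complete v u) vu)) of
            λ { (inj₁ u∈) → u∈ ; (inj₂ ()) })) ,
          trans (sym (ℕ.+-identityʳ (length D))) (trans (sym (length-ʳ++ D)) (cong length eq)) , inv)
    go D (w ∷ ws) {μ} eq at-v ix inv =
      runs-≤ (s≤s (ℕ.≤-reflexive arith))
        (runs-iter (∸-nonzero (subst₂ _<_ (sym ix) (sym (degree-here D (w ∷ ws) {μ} eq at-v)) (ℕ.m<m+n _ (s≤s z≤n))))
          (runs-⨾ (runs exec-≔ ℕ.≤-refl
            (runs-⨾ (runs-map
              (λ {μ′} (at-v′ , ix′ , inv′) → runs exec-≔ ℕ.≤-refl
                (go (w ∷ D) ws eq at-v′
                  (trans (cong (_+ 1) (trans ix′ ix)) (ℕ.+-comm (length D) 1)) inv′))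
              (runs-wp B (step w∉ vw at-v w-read (stable inv))))))))
      where
      w∈ : w ∈ neighbours v
      w∈ = subst (w ∈_) eq (∈-ʳ++ʳ D (here refl))
      vw : Adj v w
      vw = Equivalence.to (complete v w) w∈
      w∉ : w ∉ D
      w∉ w∈D = unique⇒irrefl (unique v) (subst (λ ns → Before ns w w) eq (before-ʳ++ D w∈D (here refl)))
      w-read : nth 0 (nth [] (Input.adjacency I) (μ VERTEX 0)) (μ INDEX 0) ≡ toℕ w
      w-read rewrite at-v | ix | nth-adjacency v | sym eq =
        trans (nth-map {d = w} toℕ (D ʳ++ w ∷ ws)
                (subst (length D <_) (sym (length-ʳ++ D)) (ℕ.m<m+n _ (s≤s z≤n))))
              (cong toℕ (nth-ʳ++ D))
      arith : 1 + (cost B + 1) + (1 + length ws * (3 + cost B)) ≡ suc (length ws) * (3 + cost B)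
      arith = solve 2 (λ c k → con 1 :+ (c :+ con 1) :+ (con 1 :+ k :* (con 3 :+ c)) :=
                        (con 1 :+ k) :* (con 3 :+ c)) refl (cost B) (length ws)
    bound : 1 + (1 + length (neighbours v) * (3 + cost B)) ≤ (3 + cost B) * suc (length (neighbours v))
    bound = subst (2 + length (neighbours v) * (3 + cost B) ≤_)
      (solve 2 (λ c n → con 2 :+ n :* (con 3 :+ c) :+ (con 1 :+ c) :=
                 (con 3 :+ c) :* (con 1 :+ n)) refl (cost B) (length (neighbours v)))
      (ℕ.m≤m+n _ _)

  -- `R` is what remains in the array, its head on top, and `D` what has been popped, so `R ʳ++ D`
  -- stays the same list throughout. Charging each vertex in proportion to its degree plus one makes
  -- the total linear in `weight R`.
  runs-popAll : ∀ B b (Inv : List V → List V → Store → Set) →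
    (∀ {R v D μ} → μ VERTEX 0 ≡ toℕ v → Cells (μ QUEUE) R → μ TAIL 0 ≡ length R → Inv (v ∷ R) D μ →
      Runs B (b * suc (length (neighbours v))) μ
        (λ μ′ → Cells (μ′ QUEUE) R × μ′ TAIL 0 ≡ length R × Inv R (v ∷ D) μ′)) →
    (∀ {R D x y μ} → Inv R D μ → Inv R D (_[_,_↦_] I (_[_,_↦_] I μ TAIL 0 x) VERTEX 0 y)) →
    ∀ R {D μ} → Cells (μ QUEUE) R → μ TAIL 0 ≡ length R → Inv R D μ →
    Runs (popAll B) (1 + (3 + b) * weight R) μ (Inv [] (R ʳ++ D))
  runs-popAll B b Inv step stable [] cells tl inv =
    runs-≤ (s≤s z≤n) (runs-exit tl inv)
  runs-popAll B b Inv step stable (v ∷ R) {D} {μ} (cell , cells) tl inv =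
    runs-≤ (s≤s arith)
      (runs-iter (λ eq → case trans (sym tl) eq of λ ())
        (runs-⨾ (runs exec-≔ ℕ.≤-refl (runs-⨾ (runs exec-≔ ℕ.≤-refl
          (runs-map (λ (c , t , i) → runs-popAll B b Inv step stable R c t i)
            (step (trans (cong (μ QUEUE) (cong (_∸ 1) tl)) cell) cells (cong (_∸ 1) tl) (stable inv))))))))
    where
    deg = suc (length (neighbours v))
    arith : 1 + (1 + b * deg) + (1 + (3 + b) * weight R) ≤ (3 + b) * (deg + weight R)
    arith = subst (1 + (1 + b * deg) + (1 + (3 + b) * weight R) ≤_)
      (solve 3 (λ b d w → con 1 :+ (con 1 :+ b :* (con 1 :+ d)) :+ (con 1 :+ (con 3 :+ b) :* w) :+ con 3 :* d :=
                 (con 3 :+ b) :* (con 1 :+ d :+ w)) refl b (length (neighbours v)) (weight R))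
      (ℕ.m≤m+n _ _)

  runs-walk : ∀ {A : Set} {enc : A → ℕ} {nx} B (Inv : List A → List A → Store → Set) →
    (∀ {R x D μ} → μ CURSOR 0 ≡ suc (enc x) → Inv (x ∷ R) D μ →
      wp B (λ μ′ → μ′ CURSOR 0 ≡ nx (enc x) × Inv R (x ∷ D) μ′) μ) →
    ∀ R {D h μ} → Linked enc nx h R → μ CURSOR 0 ≡ h → Inv R D μ →
    Runs (while CURSOR [ lit 0 ] loop B) (1 + (1 + cost B) * length R) μ (Inv [] (R ʳ++ D))
  runs-walk B Inv step [] l cur inv = runs-≤ (s≤s z≤n) (runs-exit (trans cur l) inv)
  runs-walk B Inv step (x ∷ R) (h , l) cur inv =
    runs-≤ (s≤s (ℕ.≤-reflexive arith))
      (runs-iter (λ eq → case trans (sym (trans cur h)) eq of λ ())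
        (runs-map (λ (c , i) → runs-walk B Inv step R l c i)
          (runs-wp B (step (trans cur h) inv))))
    where
    arith : cost B + (1 + (1 + cost B) * length R) ≡ (1 + cost B) * suc (length R)
    arith = solve 2 (λ c k → c :+ (con 1 :+ (con 1 :+ c) :* k) := (con 1 :+ c) :* (con 1 :+ k))
              refl (cost B) (length R)

-- The total size of the adjacency lists

∑ : List A → (A → ℕ) → ℕ
∑ xs f = sum (map f xs)

∑-+ : ∀ xs {f g : A → ℕ} → ∑ xs (λ x → f x + g x) ≡ ∑ xs f + ∑ xs g
∑-+ []               = refl
∑-+ (x ∷ xs) {f} {g} rewrite ∑-+ xs {f} {g} =
  solve 4 (λ a b c d → a :+ b :+ (c :+ d) := a :+ c :+ (b :+ d)) refl (f x) (g x) (∑ xs f) (∑ xs g)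

∑-0 : ∀ (xs : List A) → ∑ xs (λ _ → 0) ≡ 0
∑-0 []       = refl
∑-0 (x ∷ xs) = ∑-0 xs

∑-swap : ∀ {B : Set} xs ys {f : A → B → ℕ} →
         ∑ xs (λ x → ∑ ys (f x)) ≡ ∑ ys (λ y → ∑ xs (λ x → f x y))
∑-swap []       ys     = sym (∑-0 ys)
∑-swap (x ∷ xs) ys {f} = trans (cong (∑ ys (f x) +_) (∑-swap xs ys)) (sym (∑-+ ys))

∑-mono : ∀ xs {f g : A → ℕ} → (∀ x → f x ≤ g x) → ∑ xs f ≤ ∑ xs g
∑-mono []       le = z≤n
∑-mono (x ∷ xs) le = ℕ.+-mono-≤ (le x) (∑-mono xs le)

∑-cong : ∀ xs {f g : A → ℕ} → (∀ x → f x ≡ g x) → ∑ xs f ≡ ∑ xs g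
∑-cong []       eq = refl
∑-cong (x ∷ xs) eq = cong₂ _+_ (eq x) (∑-cong xs eq)

∑-1 : ∀ (xs : List A) → ∑ xs (λ _ → 1) ≡ length xs
∑-1 []       = refl
∑-1 (x ∷ xs) = cong suc (∑-1 xs)

indicator : Bool → ℕ
indicator b = if b then 1 else 0

length-filter-∑ : ∀ {P : A → Set} (P? : Decidable P) xs →
                  length (filter P? xs) ≡ ∑ xs (λ x → indicator (does (P? x)))
length-filter-∑ P? []       = refl
length-filter-∑ P? (x ∷ xs) with does (P? x)
... | true  = cong suc (length-filter-∑ P? xs)
... | false = length-filter-∑ P? xs

∑-++ : ∀ xs ys {f : A → ℕ} → ∑ (xs ++ ys) f ≡ ∑ xs f + ∑ ys f
∑-++ []       ys     = refl
∑-++ (x ∷ xs) ys {f} = trans (cong (f x +_) (∑-++ xs ys)) (sym (ℕ.+-assoc (f x) _ _))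

∑-product : ∀ {B : Set} xs (ys : List B) {f : A × B → ℕ} →
            ∑ (cartesianProduct xs ys) f ≡ ∑ xs (λ x → ∑ ys (λ y → f (x , y)))
∑-product []       ys     = refl
∑-product (x ∷ xs) ys {f} =
  trans (∑-++ (map (x ,_) ys) (cartesianProduct xs ys))
    (cong₂ _+_ (cong sum (sym (map-∘ ys))) (∑-product xs ys))

complete⇒↭ : ∀ {n} {xs : List (Fin n)} → Unique xs → (∀ x → x ∈ xs) → xs ↭ allFin n
complete⇒↭ {n} u co =
  ∼bag⇒↭ (unique∧set⇒bag u (allFin⁺ n) (mk⇔ (λ _ → ∈-allFin _) (λ _ → co _)))

-- A list without repetitions becomes a permutation of `allFin n` when the missing elements are
-- appended.
∑-≤ : ∀ {n} {xs : List (Fin n)} f → Irrefl xs → ∑ xs f ≤ ∑ (allFin n) f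
∑-≤ {n} {xs} f irr =
  ℕ.≤-trans (ℕ.m≤m+n _ (∑ missing f))
    (ℕ.≤-reflexive (trans (sym (∑-++ xs missing)) (sum-↭ (map⁺ f (complete⇒↭ unique′ complete′)))))
  where
  open DecMembership (Fin._≟_ {n}) using (_∈?_)
  missing : List (Fin n)
  missing = filter (λ x → ¬? (x ∈? xs)) (allFin n)
  unique′ : Unique (xs ++ missing)
  unique′ = UniqueP.++⁺ (irrefl⇒unique irr) (UniqueP.filter⁺ (λ x → ¬? (x ∈? xs)) (allFin⁺ n))
    λ (x∈ , x∈missing) → proj₂ (∈-filter⁻ (λ x → ¬? (x ∈? xs)) {xs = allFin n} x∈missing) x∈
  complete′ : ∀ x → x ∈ xs ++ missing
  complete′ x with x ∈? xs
  ... | yes x∈ = ∈-++⁺ˡ x∈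
  ... | no x∉  = ∈-++⁺ʳ xs (∈-filter⁺ (λ x → ¬? (x ∈? xs)) (∈-allFin x) x∉)

irrefl⇒length≤ : ∀ {n} {xs : List (Fin n)} → Irrefl xs → length xs ≤ n
irrefl⇒length≤ {n} {xs} irr =
  subst₂ _≤_ (∑-1 xs) (trans (∑-1 (allFin n)) (length-tabulate {n = n} id)) (∑-≤ (λ _ → 1) irr)

complete⇒length : ∀ {n} {xs : List (Fin n)} → Irrefl xs → (∀ x → x ∈ xs) → length xs ≡ n
complete⇒length {n} irr co =
  trans (↭-length (complete⇒↭ (irrefl⇒unique irr) co)) (length-tabulate {n = n} id)

module Weight (G : Graph) (L : AdjacencyLists G) where
  open Graph G using (V; adj; order; size; Adj; symmetric; irreflexive)
  open AdjacencyLists L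

  private
    all = allFin order

    up : V → V → ℕ
    up u v = indicator (does (u Fin.<? v) ∧ adj u v)

    size≡ : size ≡ ∑ all (λ u → ∑ all (up u))
    size≡ = trans (length-filter-∑ _ (cartesianProduct all all)) (∑-product all all)

    degree-∑ : ∀ u → length (neighbours u) ≡ ∑ all (λ v → indicator (adj u v))
    degree-∑ u = trans (↭-length (∼bag⇒↭ (unique∧set⇒bag (unique u) (UniqueP.filter⁺ (λ v → T? (adj u v)) (allFin⁺ order))
      (mk⇔ (λ v∈ → ∈-filter⁺ (λ v → T? (adj u v)) (∈-allFin _) (Equivalence.to (complete u _) v∈))
           (λ v∈ → Equivalence.from (complete u _) (proj₂ (∈-filter⁻ (λ v → T? (adj u v)) {xs = all} v∈)))))))
      (length-filter-∑ (λ v → T? (adj u v)) all)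

    oriented : ∀ u v → indicator (adj u v) ≤ up u v + up v u
    oriented u v with adj u v in uv
    ... | false = z≤n
    ... | true with Fin.<-cmp u v
    ...   | tri< u<v _ _ rewrite dec-true (u Fin.<? v) u<v = s≤s z≤n
    ...   | tri≈ _ refl _ = contradiction (subst T (sym uv) tt) irreflexive
    ...   | tri> _ _ v<u rewrite dec-true (v Fin.<? u) v<u =
      ℕ.≤-trans (reversed (adj v u) (symmetric {u} {v} (subst T (sym uv) tt))) (ℕ.m≤n+m _ _)
      where
      reversed : ∀ b → T b → 1 ≤ indicator b
      reversed true _ = ℕ.≤-refl

  -- The upper half of the handshake lemma: by `oriented`, each ordered adjacent pair is charged to
  -- its edge at the increasing orientation.
  degrees≤ : ∑ all (λ u → length (neighbours u)) ≤ size + size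
  degrees≤ = begin
    ∑ all (λ u → length (neighbours u))                  ≡⟨ ∑-cong all degree-∑ ⟩
    ∑ all (λ u → ∑ all (λ v → indicator (adj u v)))      ≤⟨ ∑-mono all (λ u → ∑-mono all (oriented u)) ⟩
    ∑ all (λ u → ∑ all (λ v → up u v + up v u))          ≡⟨ ∑-cong all (λ u → ∑-+ all) ⟩
    ∑ all (λ u → ∑ all (up u) + ∑ all (λ v → up v u))    ≡⟨ ∑-+ all ⟩
    ∑ all (λ u → ∑ all (up u)) + ∑ all (λ u → ∑ all (λ v → up v u))
      ≡⟨ cong₂ _+_ (sym size≡) (trans (∑-swap all all) (sym size≡)) ⟩
    size + size ∎
    where open ℕ.≤-Reasoning

  -- Degrees plus one, summed over all vertices; the running times below are multiples of its
  -- successor.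
  totalWeight : ℕ
  totalWeight = ∑ all (λ v → suc (length (neighbours v)))

  totalWeight≡ : totalWeight ≡ order + ∑ all (λ v → length (neighbours v))
  totalWeight≡ = trans (∑-+ all) (cong (_+ ∑ all (λ v → length (neighbours v))) (trans (∑-1 all) (length-tabulate {n = order} id)))

  totalWeight≤ : totalWeight ≤ 2 * (order + size)
  totalWeight≤ = begin
    totalWeight                                           ≡⟨ totalWeight≡ ⟩
    order + ∑ all (λ v → length (neighbours v))           ≤⟨ ℕ.+-monoʳ-≤ order degrees≤ ⟩
    order + (size + size)                                 ≤⟨ ℕ.m≤n+m _ order ⟩
    order + (order + (size + size))
      ≡⟨ solve 2 (λ n m → n :+ (n :+ (m :+ m)) := con 2 :* (n :+ m)) refl order size ⟩
    2 * (order + size)                                    ∎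
    where open ℕ.≤-Reasoning

  order≤ : order ≤ totalWeight
  order≤ = subst (order ≤_) (sym totalWeight≡) (ℕ.m≤m+n order _)

-- From an order to its 𝓛-tree

upd-below : ∀ {P : ℕ → ℕ → Set} {f c j x} → c ≡ j → P j x → (∀ {i} → i < j → P i (f i)) →
            ∀ {i} → i < suc j → P i (upd f c x i)
upd-below {P} {f} {c} {_} {x} refl Px below {i} i< with i ℕ.≟ c
... | yes refl = subst (P c) (sym (upd-same f c x)) Px
... | no i≢c   = subst (P i) (sym (upd-other f {c} x (i≢c ∘ sym))) (below (ℕ.≤∧≢⇒< (ℕ.≤-pred i<) i≢c))

upd-at : ∀ f {i x j} → i ≡ j → upd f i x j ≡ x
upd-at f {i} {x} refl = upd-same f i x

upd-≢ : ∀ {n} f {i x} {v u : Fin n} → i ≡ toℕ v → u ≢ v → upd f i x (toℕ u) ≡ f (toℕ u)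
upd-≢ f {i} {x} refl u≢v = upd-other f {i} x (u≢v ∘ sym ∘ Fin.toℕ-injective)

*-suc+1 : ∀ k d → k * suc d + 1 ≤ suc k * suc d
*-suc+1 k d = ℕ.≤-trans (ℕ.≤-reflexive (ℕ.+-comm (k * suc d) 1)) (ℕ.+-monoˡ-≤ (k * suc d) (s≤s z≤n))

cells-ʳ++ : ∀ {n k} (f : ℕ → ℕ) (xs : Vec (Fin n) k) acc → Cells f acc →
            (∀ i → f (length acc + toℕ i) ≡ toℕ (Vec.lookup xs i)) → Cells f (toList xs ʳ++ acc)
cells-ʳ++ f []       acc c eq = c
cells-ʳ++ f (x ∷ xs) acc c eq = cells-ʳ++ f xs (x ∷ acc)
  (trans (cong f (sym (ℕ.+-identityʳ (length acc)))) (eq Fin.zero) , c)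
  (λ i → trans (cong f (sym (ℕ.+-suc (length acc) (toℕ i)))) (eq (Fin.suc i)))

cells-≗ : ∀ {n} {f g : ℕ → ℕ} (xs : List (Fin n)) → (∀ {i} → i < length xs → g i ≡ f i) → Cells f xs → Cells g xs
cells-≗ []       eq c       = tt
cells-≗ (x ∷ xs) eq (p , c) = trans (eq ℕ.≤-refl) p , cells-≗ xs (eq ∘ ℕ.m≤n⇒m≤1+n) c

OUTPUT MARK : ℕ
OUTPUT = 0
MARK   = 9

-- The order is processed from its end; MARK is 0 for a vertex not yet
-- processed, 1 for a processed vertex whose parent is still unknown and
-- 2 for one whose parent is known.
treeProgram : Program
treeProgram =
  forVertices
    -- The order is moved out of `OUTPUT` because the parents are going to be written there.
    (QUEUE [ COUNTER [ lit 0 ] ]≔ OUTPUT [ COUNTER [ lit 0 ] ] ⨾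
     MARK [ COUNTER [ lit 0 ] ]≔ lit 0) ⨾
  TAIL [ lit 0 ]≔ #vertices ⨾
  popAll (forNeighbours visit ⨾ MARK [ VERTEX [ lit 0 ] ]≔ lit 1)
  module TreeProgram where
  visit : Program
  visit =
    if MARK [ NEIGHBOUR [ lit 0 ] ]
    -- Zero here means mark 1, so only a processed neighbour whose parent is unknown gets to the
    -- assignment.
    then (if MARK [ NEIGHBOUR [ lit 0 ] ] ⊖ lit 1
          then skip
          else′ (OUTPUT [ NEIGHBOUR [ lit 0 ] ]≔ VERTEX [ lit 0 ] ⨾
                 MARK [ NEIGHBOUR [ lit 0 ] ]≔ lit 2))
    else′ skip

module RunTree (G : Graph) (L : AdjacencyLists G) (s : Graph.V G) where
  open Graph G using (V; adj; order; size; Adj; symmetric; irreflexive)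
  open AdjacencyLists L using (neighbours)
  open LexDFS G s
  open Search G L s
  open Weight G L
  open TreeProgram

  private
    -- `Possible` bounds where the earlier neighbours of an open vertex may still lie: among the
    -- vertices yet to be scanned, including, during a scan, the current one. It shrinks until the
    -- parent is the only choice for the rightmost.
    Open : List V → (V → V → Set) → (ℕ → ℕ) → V → Set
    Open W Possible m u = m (toℕ u) ≡ 1 × (∀ {k} → Before W k u → Adj k u → Possible k u)

    Settled : List V → (ℕ → ℕ) → (ℕ → ℕ) → V → Set
    Settled W m o u = m (toℕ u) ≡ 2 × ∃[ p ] Rightmost W p u × o (toℕ u) ≡ toℕ p

    record Marks (W D : List V) (Possible : V → V → Set) (m o : ℕ → ℕ) : Set where
      field
        irr       : Irrefl W
        unmarked  : ∀ {u} → u ∉ D → m (toℕ u) ≡ 0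
        marked    : ∀ {u} → u ∈ D → Open W Possible m u ⊎ Settled W m o u
    open Marks

    Inv : List V → List V → Store → Set
    Inv R D μ = Marks (R ʳ++ D) D (λ k _ → k ∈ R) (μ MARK) (μ OUTPUT)

    -- In the middle of the scan of `v`: the vertex `v` is still a candidate for `u` as long as `u`
    -- has not shown up in its adjacency list.
    Waiting : V → List V → List V → V → V → Set
    Waiting v R N k u = k ∈ R ⊎ (k ≡ v × u ∉ N)

    marks-weaken : ∀ {W D m o} {P Q : V → V → Set} → (∀ {k u} → P k u → Adj k u → Q k u) →
                   Marks W D P m o → Marks W D Q m o
    marks-weaken f i .irr      = irr i
    marks-weaken f i .unmarked = unmarked i
    marks-weaken f i .marked u∈ with marked i u∈
    ... | inj₁ (m≡1 , poss) = inj₁ (m≡1 , λ ku adj-ku → f (poss ku adj-ku) adj-ku)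
    ... | inj₂ settled      = inj₂ settled

    marks-skip : ∀ {W v R D N w m o} → (w ∈ D → m (toℕ w) ≡ 1 → ⊥) →
                 Marks W D (Waiting v R N) m o → Marks W D (Waiting v R (w ∷ N)) m o
    marks-skip closed i .irr      = irr i
    marks-skip closed i .unmarked = unmarked i
    marks-skip closed i .marked {u} u∈ with marked i u∈
    ... | inj₂ settled      = inj₂ settled
    ... | inj₁ (m≡1 , poss) = inj₁ (m≡1 , λ ku adj-ku → case poss ku adj-ku of λ
      { (inj₁ k∈)         → inj₁ k∈
      ; (inj₂ (k≡v , u∉)) → inj₂ (k≡v , λ { (here refl) → closed u∈ m≡1 ; (there u∈N) → u∉ u∈N }) })

    -- The earlier neighbours of an open `w` are `v` or lie in `R`, and `R` precedes `v`; hence `v`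
    -- is the rightmost of them.
    marks-settle : ∀ {v R D N w m o c x} → Adj v w → c ≡ toℕ w → x ≡ toℕ v → m (toℕ w) ≡ 1 →
                   Marks (R ʳ++ v ∷ D) D (Waiting v R N) m o →
                   Marks (R ʳ++ v ∷ D) D (Waiting v R (w ∷ N)) (upd m c 2) (upd o c x)
    marks-settle {v} {R} {D} {N} {w} {m} {o} {c} {x} vw c≡w x≡v m≡1 i = record
      { irr      = irr i
      ; unmarked = λ {u} u∉ → trans (upd-≢ m c≡w (λ { refl → u∉ w∈ })) (unmarked i u∉)
      ; marked   = settle
      }
      where
      w∈ : w ∈ D
      w∈ with Any.any? (w Fin.≟_) D
      ... | yes w∈ = w∈
      ... | no w∉  = case trans (sym (unmarked i w∉)) m≡1 of λ ()
      settle : ∀ {u} → u ∈ D → Open (R ʳ++ v ∷ D) (Waiting v R (w ∷ N)) (upd m c 2) u ⊎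
                               Settled (R ʳ++ v ∷ D) (upd m c 2) (upd o c x) u
      settle {u} u∈ with u Fin.≟ w | marked i u∈
      ... | yes refl | inj₂ (m≡2 , _) = case trans (sym m≡1) m≡2 of λ ()
      ... | yes refl | inj₁ (_ , poss) = inj₂ (upd-at m c≡w , v , rm , trans (upd-at o c≡w) x≡v)
        where
        rm : Rightmost (R ʳ++ v ∷ D) v w
        rm = record
          { precedes  = before-ʳ++ʳ R (here w∈)
          ; adjacent  = vw
          ; rightmost = λ kw adj-kw → case poss kw adj-kw of λ
              { (inj₁ k∈)        → inj₂ (before-ʳ++ R k∈ (here refl))
              ; (inj₂ (k≡v , _)) → inj₁ k≡v }
          }
      ... | no u≢w | inj₂ (m≡2 , p , rm , o≡) =
        inj₂ (trans (upd-≢ m c≡w u≢w) m≡2 , p , rm , trans (upd-≢ o c≡w u≢w) o≡)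
      ... | no u≢w | inj₁ (m≡1′ , poss) = inj₁ (trans (upd-≢ m c≡w u≢w) m≡1′ , λ ku adj-ku →
        case poss ku adj-ku of λ
          { (inj₁ k∈)         → inj₁ k∈
          ; (inj₂ (k≡v , u∉)) → inj₂ (k≡v , λ { (here u≡w) → u≢w u≡w ; (there u∈N) → u∉ u∈N }) })

    marks-next : ∀ {v R D m o c} → c ≡ toℕ v →
                 Marks (R ʳ++ v ∷ D) D (λ k _ → k ∈ R) m o →
                 Marks (R ʳ++ v ∷ D) (v ∷ D) (λ k _ → k ∈ R) (upd m c 1) o
    marks-next {v} {R} {D} {m} {o} {c} c≡v i .irr = irr i
    marks-next {v} {R} {D} {m} {o} {c} c≡v i .unmarked u∉ =
      trans (upd-≢ m c≡v (u∉ ∘ here)) (unmarked i (u∉ ∘ there))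
    marks-next {v} {R} {D} {m} {o} {c} c≡v i .marked (here refl) =
      inj₁ (upd-at m c≡v , λ ku _ → before-cut R (irr i) ku)
    marks-next {v} {R} {D} {m} {o} {c} c≡v i .marked {u} (there u∈) with marked i u∈
    ... | inj₁ (m≡1 , poss) = inj₁ (trans (upd-≢ m c≡v u≢v) m≡1 , poss)
      where
      u≢v : u ≢ v
      u≢v refl = irr i (before-ʳ++ʳ R (here u∈))
    ... | inj₂ (m≡2 , r) = inj₂ (trans (upd-≢ m c≡v u≢v) m≡2 , r)
      where
      u≢v : u ≢ v
      u≢v refl = irr i (before-ʳ++ʳ R (here u∈))

    run-scan : ∀ {R v D μ} → μ VERTEX 0 ≡ toℕ v → Cells (μ QUEUE) R → μ TAIL 0 ≡ length R → Inv (v ∷ R) D μ →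
      Runs (forNeighbours visit ⨾ MARK [ VERTEX [ lit 0 ] ]≔ lit 1)
        ((4 + cost visit) * suc (length (neighbours v))) μ
        (λ μ′ → Cells (μ′ QUEUE) R × μ′ TAIL 0 ≡ length R × Inv R (v ∷ D) μ′)
    run-scan {R} {v} {D} {μ} at-v cells tl inv =
      runs-≤ (*-suc+1 (3 + cost visit) (length (neighbours v)))
      (runs-⨾ (runs-map
        (λ {μ′} (at-v′ , N , N⇔ , _ , cells′ , tl′ , i) → runs exec-≔ ℕ.≤-refl
          (cells′ , tl′ , marks-next {R = R} at-v′ (marks-weaken
            (λ { (inj₁ k∈) _ → k∈ ; {k} {u} (inj₂ (refl , u∉)) vu → contradiction (Equivalence.from (N⇔ u) vu) u∉ }) i)))
        (runs-forNeighbours visit v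
          (λ N μ′ → Cells (μ′ QUEUE) R × μ′ TAIL 0 ≡ length R ×
                    Marks (R ʳ++ v ∷ D) D (Waiting v R N) (μ′ MARK) (μ′ OUTPUT))
          at-v
          (λ {N} {w} {μ′} w∉ vw at-v′ at-w (cells′ , tl′ , i) →
            (λ m≢0 →
              (λ m>1 → at-v′ , refl , cells′ , tl′ ,
                marks-skip (λ _ m≡1 → m>1 (cong (_∸ 1) (trans (cong (μ′ MARK) at-w) m≡1))) i) ,
              (λ m≤1 → at-v′ , refl , cells′ , tl′ ,
                marks-settle {R = R} vw at-w at-v′
                  (trans (cong (μ′ MARK) (sym at-w)) (≡1 m≢0 m≤1)) i)) ,
            (λ m≡0 → at-v′ , refl , cells′ , tl′ ,
              marks-skip (λ _ m≡1 → case trans (sym m≡0) (trans (cong (μ′ MARK) at-w) m≡1) of λ ()) i))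
          (λ i → i)
          (cells , tl , marks-weaken (λ
            { (here refl) _ → inj₂ (refl , λ ()) ; (there k∈) _ → inj₁ k∈ }) inv))))
      where
      ≡1 : ∀ {m} → m ≢ 0 → m ∸ 1 ≡ 0 → m ≡ 1
      ≡1 {zero}        m≢0 _ = contradiction refl m≢0
      ≡1 {suc zero}    _   _ = refl

  runs-treeProgram : (σ : Vec V order) → SearchOrder (toList σ) → ∀ {μ} →
    (∀ i → μ OUTPUT (toℕ i) ≡ toℕ (Vec.lookup σ i)) →
    Runs treeProgram (20 * suc totalWeight) μ
      (λ μ′ → ∀ u → u ≢ s → ∃[ p ] Rightmost (toList σ) p u × μ′ OUTPUT (toℕ u) ≡ toℕ p)
  runs-treeProgram σ search {μ} out =
    runs-≤ arith
      (runs-⨾ (runs-map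
        (λ {μ₁} copied → runs-⨾ (runs exec-≔ ℕ.≤-refl (runs-map (λ {μ′} → result {μ′})
          (runs-popAll _ (4 + cost visit) Inv run-scan (λ i → i) R
            (cells-≗ R (λ {i} i< → proj₁ (copied i (subst (i <_) length-R i<)))
              (cells-ʳ++ (λ i → μ OUTPUT i) σ [] tt out))
            (trans #vertices≡ (sym length-R))
            (record
              { irr      = subst Irrefl (sym R-reverse) irrefl
              ; unmarked = λ {u} _ → proj₂ (copied (toℕ u) (Fin.toℕ<n u))
              ; marked   = λ () })))))
        (runs-for _ (λ j μ′ → (∀ i → μ′ OUTPUT i ≡ μ OUTPUT i) ×
                              (∀ i → i < j → μ′ QUEUE i ≡ μ OUTPUT i × μ′ MARK i ≡ 0))
          (λ {j} {μ′} j< at-j (o , below) → at-j , o , λ i i< →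
            upd-below {P = λ i x → x ≡ μ OUTPUT i} at-j (trans (cong (μ′ OUTPUT) at-j) (o j)) (λ {k} k< → proj₁ (below k k<)) i< ,
            upd-below {P = λ i x → x ≡ 0} at-j refl (λ {k} k< → proj₂ (below k k<)) i<)
          ((λ _ → refl) , λ _ ()) |> runs-map proj₂)))
    where
    open SearchOrder search
    -- `Cells` describes an array from its far end, so an array that holds `σ` is described by the
    -- reverse of `σ`.
    R : List V
    R = toList σ ʳ++ []
    R-reverse : R ʳ++ [] ≡ toList σ
    R-reverse = reverse-involutive (toList σ)
    length-R : length R ≡ order
    length-R = trans (length-ʳ++ (toList σ)) (trans (ℕ.+-identityʳ _) (length-toList σ))
    result : ∀ {μ′} → Inv [] (R ʳ++ []) μ′ →
             ∀ u → u ≢ s → ∃[ p ] Rightmost (toList σ) p u × μ′ OUTPUT (toℕ u) ≡ toℕ p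
    result {μ′} i u u≢s rewrite R-reverse with marked i (complete u)
    ... | inj₂ (_ , p , rm , o≡) = p , rm , o≡
    -- Nothing is left to scan, so a vertex that is still open has no earlier neighbour, which is
    -- impossible for `u ≢ s`.
    ... | inj₁ (_ , none) with earlier u≢s
    ...   | a , au , adj-au = case none au adj-au of λ ()
    -- Since `cost visit` is 6, each unit of weight takes `3 + (4 + 6) = 13` steps; together with
    -- the 5 per vertex for copying, 20 leaves slack.
    arith : (3 + 2) * suc order + (1 + (1 + (3 + (4 + cost visit)) * weight R)) ≤ 20 * suc totalWeight
    arith = begin
      5 * suc order + (1 + (1 + 13 * weight R))
        ≤⟨ ℕ.+-mono-≤ (ℕ.*-monoʳ-≤ 5 (s≤s order≤))
             (s≤s (s≤s (ℕ.*-monoʳ-≤ 13 (∑-≤ _ λ p → irrefl (subst (λ W → Before W _ _) R-reverse (before-ʳ++ˡ R p)))))) ⟩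
      5 * suc totalWeight + (2 + 13 * totalWeight)
        ≤⟨ ℕ.m≤m+n _ (13 + 2 * totalWeight) ⟩
      5 * suc totalWeight + (2 + 13 * totalWeight) + (13 + 2 * totalWeight)
        ≡⟨ solve 1 (λ w → con 5 :* (con 1 :+ w) :+ (con 2 :+ con 13 :* w) :+ (con 13 :+ con 2 :* w) := con 20 :* (con 1 :+ w)) refl totalWeight ⟩
      20 * suc totalWeight ∎
      where open ℕ.≤-Reasoning

-- From an 𝓛-tree to an order: breadth-first search

CLASS SPLIT NEXT FRESH BASE OLD SUCC : ℕ
CLASS = 10
SPLIT = 11
NEXT  = 12
FRESH = 13
BASE  = 14
OLD   = 15
SUCC  = 16

-- The machine only tests for being nonzero. This expression vanishes exactly if both values agree,
-- so equality is handled in the `else′` branch.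
∣_-_∣ : Expr → Expr → Expr
∣ e - f ∣ = (e ⊖ f) ⊕ (f ⊖ e)

distance-zero : ∀ {a b} → (a ∸ b) + (b ∸ a) ≡ 0 → a ≡ b
distance-zero {a} {b} eq = ℕ.≤-antisym (ℕ.m∸n≡0⇒m≤n (ℕ.m+n≡0⇒m≡0 (a ∸ b) eq))
                                       (ℕ.m∸n≡0⇒m≤n (ℕ.m+n≡0⇒n≡0 (a ∸ b) eq))

distance-refl : ∀ {a b} → a ≡ b → (a ∸ b) + (b ∸ a) ≡ 0
distance-refl {a} refl rewrite ℕ.n∸n≡0 a = refl

-- The tree is given by parents only. The children of a vertex are recovered as the neighbours whose
-- parent cell points back at it, in time proportional to its degree plus one.
breadthFirst : Program
breadthFirst =
  (QUEUE [ lit 0 ]≔ source ⨾ TAIL [ lit 0 ]≔ lit 1 ⨾ HEAD [ lit 0 ]≔ lit 0) ⨾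
  (while TAIL [ lit 0 ] ⊖ HEAD [ lit 0 ] loop
    (VERTEX [ lit 0 ]≔ QUEUE [ HEAD [ lit 0 ] ] ⨾
     (forNeighbours enqueueChild ⨾
      HEAD [ lit 0 ]≔ lit 1 ⊕ HEAD [ lit 0 ])))
  module BreadthFirst where
  enqueueChild : Program
  enqueueChild =
    if ∣ OUTPUT [ NEIGHBOUR [ lit 0 ] ] - VERTEX [ lit 0 ] ∣
    then skip
    else′ (QUEUE [ TAIL [ lit 0 ] ]≔ NEIGHBOUR [ lit 0 ] ⨾
           TAIL [ lit 0 ]≔ lit 1 ⊕ TAIL [ lit 0 ])

module RunBreadthFirst (G : Graph) (L : AdjacencyLists G) (s : Graph.V G) (t : RootedSpanningTree G s) where
  open Graph G using (V; adj; order; size; Adj; symmetric)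
  open AdjacencyLists L using (neighbours)
  open RootedSpanningTree t
  open Tree G s t
  open Search G L s
  open Weight G L
  open BreadthFirst

  -- The cell of the root holds a number that is not a vertex.
  ParentArray : (ℕ → ℕ) → Set
  ParentArray o = (∀ {p x} → Par p x → o (toℕ x) ≡ toℕ p) × o (toℕ s) ≡ order

  -- The purpose of the dummy entry of the root: an arbitrary number in that cell could make the
  -- root look like a child of one of its neighbours.
  parentArray⁻ : ∀ {o p x} → ParentArray o → o (toℕ x) ≡ toℕ p → Par p x
  parentArray⁻ {o} {p} {x} (cells , root) eq with x Fin.≟ s
  ... | yes refl = contradiction (trans (sym eq) root) (ℕ.<⇒≢ (Fin.toℕ<n p))
  ... | no x≢s with has-parent x≢s
  ...   | q , qx = subst (λ p → Par p x) (Fin.toℕ-injective (trans (sym (cells qx)) eq)) qx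

  Frame : Store → Store → Set
  Frame μ₀ μ = (∀ i → μ OUTPUT i ≡ μ₀ OUTPUT i) × (∀ i → μ MARK i ≡ μ₀ MARK i) ×
               (∀ i → μ CLASS i ≡ μ₀ CLASS i)

  Queued : Store → Store → Set
  Queued μ₀ μ = ∃[ R ] Topological (R ʳ++ []) × Cells (μ QUEUE) R × μ TAIL 0 ≡ length R × Frame μ₀ μ

  private
    -- `Seen p x` says that the search has tried `x` as a child of `p`; the queue holds the root and
    -- exactly the children seen. `R` is the queue from its end, so children come before parents.
    record Frontier (R : List V) (Seen : V → V → Set) : Set where
      field
        irr      : Irrefl R
        root     : s ∈ R
        parents  : ∀ {p x} → x ∈ R → Par p x → Seen p x
        children : ∀ {p x} → Seen p x → Par p x → x ∈ R
        ordered  : ∀ {p x} → x ∈ R → Par p x → Before R x p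
    open Frontier

    Done : List V → V → V → Set
    Done D p x = p ∈ D

    Partial : List V → V → List V → V → V → Set
    Partial D v N p x = p ∈ D ⊎ (p ≡ v × x ∈ N)

    frontier-map : ∀ {R} {P Q : V → V → Set} → (∀ {p x} → P p x → Q p x) →
                   (∀ {p x} → Par p x → Q p x → P p x) → Frontier R P → Frontier R Q
    frontier-map f g i = record
      { irr = irr i ; root = root i ; ordered = ordered i
      ; parents  = λ x∈ px → f (parents i x∈ px)
      ; children = λ q px → children i (g px q) px }

    -- A vertex enters the queue through its only parent: were `w` there already, the pair of `v`
    -- and `w` would have been seen before.
    frontier-enqueue : ∀ {R D v N w} → v ∈ R → v ∉ D → w ∉ N → Par v w →
                       Frontier R (Partial D v N) → Frontier (w ∷ R) (Partial D v (w ∷ N))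
    frontier-enqueue {R} {D} {v} {N} {w} v∈ v∉D w∉N vw i = record
      { irr      = λ { (here w∈) → w∉ w∈ ; (there p) → irr i p }
      ; root     = there (root i)
      ; parents  = λ
          { (here refl) px → inj₂ (par-functional px vw , here refl)
          ; (there x∈) px → case parents i x∈ px of λ
              { (inj₁ p∈)         → inj₁ p∈
              ; (inj₂ (p≡v , x∈N)) → inj₂ (p≡v , there x∈N) } }
      ; children = λ
          { (inj₁ p∈) px                 → there (children i (inj₁ p∈) px)
          ; (inj₂ (p≡v , here refl)) px  → here refl
          ; (inj₂ (p≡v , there x∈N)) px  → there (children i (inj₂ (p≡v , x∈N)) px) }
      ; ordered  = λ
          { (here refl) px → here (subst (_∈ R) (par-functional vw px) v∈)
          ; (there x∈) px → there (ordered i x∈ px) }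
      }
      where
      w∉ : w ∉ R
      w∉ w∈ with parents i w∈ vw
      ... | inj₁ v∈D       = v∉D v∈D
      ... | inj₂ (_ , w∈N) = w∉N w∈N

    frontier-complete : ∀ {R} → Frontier R (Done R) → ∀ x → Star (λ u p → Par p u) x s → x ∈ R
    frontier-complete i x ε           = root i
    frontier-complete i x (px ◅ path) = children i (frontier-complete i _ path) px

    State : Store → List V → List V → (V → V → Set) → Store → Set
    State μ₀ R D Seen μ = Cells (μ QUEUE) R × μ TAIL 0 ≡ length R × μ HEAD 0 ≡ length D ×
                          Frontier R Seen × Frame μ₀ μ

    Mid : Store → V → List V → List V → Store → Set
    Mid μ₀ v D N μ = ∃[ R ] ∃[ Pending ] R ≡ Pending ʳ++ v ∷ D × State μ₀ R D (Partial D v N) μ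

    step : ∀ {μ₀ v D N w μ} → ParentArray (μ₀ OUTPUT) → w ∉ N →
           μ VERTEX 0 ≡ toℕ v → μ NEIGHBOUR 0 ≡ toℕ w → Mid μ₀ v D N μ →
           wp enqueueChild (λ μ′ → μ′ VERTEX 0 ≡ toℕ v × μ′ INDEX 0 ≡ μ INDEX 0 ×
             Mid μ₀ v D (w ∷ N) (_[_,_↦_] I μ′ INDEX 0 (μ′ INDEX 0 + 1))) μ
    step {μ₀} {v} {D} {N} {w} {μ} pa w∉N at-v at-w (R , P , refl , cells , tl , hd , fr , frame@(fo , _)) =
      (λ ≢0 → at-v , refl , R , P , refl , cells , tl , hd ,
        frontier-map (λ { (inj₁ p∈) → inj₁ p∈ ; (inj₂ (p≡v , x∈)) → inj₂ (p≡v , there x∈) })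
          (λ { px (inj₁ p∈) → inj₁ p∈
             ; px (inj₂ (p≡v , there x∈)) → inj₂ (p≡v , x∈)
             ; px (inj₂ (refl , here refl)) → contradiction
                 (distance-refl (trans (cong (μ OUTPUT) at-w) (trans (fo _) (trans (proj₁ pa px) (sym at-v))))) ≢0 }) fr ,
        frame) ,
      (λ ≡0 → at-v , refl , w ∷ R , P ++ w ∷ [] , sym (++-ʳ++ P) ,
        (trans (upd-at (μ QUEUE) tl) at-w , cells-upd R (ℕ.≤-reflexive (sym tl)) cells) ,
        cong suc tl , hd ,
        frontier-enqueue (∈-ʳ++ʳ P (here refl)) (λ v∈ → irr fr (before-ʳ++ʳ P (here v∈))) w∉N
          (parentArray⁻ {μ₀ OUTPUT} pa (trans (sym (fo _)) (trans (cong (μ OUTPUT) (sym at-w)) (trans (distance-zero ≡0) at-v))))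
          fr ,
        frame)

  runs-breadthFirst : ∀ {μ₀} → ParentArray (μ₀ OUTPUT) →
                      Runs breadthFirst (14 * suc totalWeight) μ₀ (Queued μ₀)
  runs-breadthFirst {μ₀} pa = runs-≤ arith₀
    (runs-⨾ (runs-map
      (λ {μ} st → go totalWeight {totalWeight} ℕ.≤-refl (s ∷ []) refl st)
      (runs-wp (QUEUE [ lit 0 ]≔ source ⨾ TAIL [ lit 0 ]≔ lit 1 ⨾ HEAD [ lit 0 ]≔ lit 0)
        {μ₀} {State μ₀ (s ∷ []) [] (Done [])}
        ((refl , tt) , refl , refl , record
          { irr = λ { (here ()) ; (there ()) } ; root = here refl
          ; parents  = λ { (here refl) ps → contradiction ps s-orphan }
          ; children = λ ()
          ; ordered  = λ { (here refl) ps → contradiction ps s-orphan } } ,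
          (λ _ → refl) , (λ _ → refl) , (λ _ → refl)))))
    where
    arith₀ : 3 + (1 + 11 * totalWeight) ≤ 14 * suc totalWeight
    arith₀ = subst (3 + (1 + 11 * totalWeight) ≤_)
      (solve 1 (λ w → con 3 :+ (con 1 :+ con 11 :* w) :+ (con 10 :+ con 3 :* w) := con 14 :* (con 1 :+ w)) refl totalWeight)
      (ℕ.m≤m+n _ _)
    -- Dequeued vertices are distinct, so their weight never exceeds `totalWeight`; `budget` is what
    -- remains of it, and every round spends at least 1. `fuel` turns this into a structural
    -- recursion, while `budget` also measures the time still allowed.
    go : ∀ fuel {budget} → budget ≤ fuel → ∀ Pending {D μ} → weight D + budget ≡ totalWeight →
         State μ₀ (Pending ʳ++ D) D (Done D) μ →
         Runs (while TAIL [ lit 0 ] ⊖ HEAD [ lit 0 ] loop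
                (VERTEX [ lit 0 ]≔ QUEUE [ HEAD [ lit 0 ] ] ⨾
                (forNeighbours enqueueChild ⨾
                HEAD [ lit 0 ]≔ lit 1 ⊕ HEAD [ lit 0 ])))
              (1 + 11 * budget) μ (Queued μ₀)
    go fuel le [] {D} w≡ (cells , tl , hd , fr , frame) =
      runs-≤ (s≤s z≤n) (runs-exit (ℕ.m≤n⇒m∸n≡0 (ℕ.≤-reflexive (trans tl (sym hd))))
        (D , record
          { irreflexive = irr′
          ; covers      = λ x → ∈-ʳ++ˡ D (all x)
          ; par-before  = λ px → before-ʳ++ˡ D (ordered fr (all _) px) } ,
         cells , tl , frame))
      where
      all : ∀ x → x ∈ D
      all x = frontier-complete fr x (reaches-root x)
      irr′ : Irrefl (D ʳ++ [])
      irr′ p with before-ʳ++⁻ D p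
      ... | inj₁ q = irr fr q
      ... | inj₂ (inj₁ (_ , ()))
      ... | inj₂ (inj₂ ())
    go fuel {budget} le (v ∷ P) {D} {μ} w≡ (cells , tl , hd , fr , frame) = body fuel le
      where
      deg = suc (length (neighbours v))
      irr-vD : Irrefl (v ∷ D)
      irr-vD p = irr fr (before-ʳ++ʳ P p)
      deg≤ : deg ≤ budget
      deg≤ = ℕ.+-cancelʳ-≤ (weight D) deg budget
        (subst (deg + weight D ≤_) (trans (sym w≡) (ℕ.+-comm (weight D) budget))
          (∑-≤ (λ v → suc (length (neighbours v))) irr-vD))
      body : ∀ fuel → budget ≤ fuel → Runs _ (1 + 11 * budget) μ (Queued μ₀)
      body zero le = contradiction (ℕ.≤-trans deg≤ le) λ ()
      body (suc fuel) le = runs-≤ (s≤s arith)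
        (runs-iter (∸-nonzero (subst₂ _<_ (sym hd) (sym tl)
              (subst (length D <_) (sym (length-ʳ++ P)) (ℕ.≤-trans ℕ.≤-refl (ℕ.m≤n+m _ (length P))))))
          (runs-⨾ (runs exec-≔ ℕ.≤-refl (runs-⨾ (runs-map
            (λ { (_ , N , N⇔ , _ , _ , P′ , refl , cells′ , tl′ , hd′ , fr′ , frame′) → runs exec-≔ ℕ.≤-refl
              (go fuel fuel≤ P′ weight≡
                ((cells′ , tl′ , cong suc hd′ ,
                   frontier-map (λ { (inj₁ p∈) → there p∈ ; (inj₂ (p≡v , _)) → here p≡v })
                     (λ { px (there p∈) → inj₁ p∈
                        ; {p} {x} px (here refl) → inj₂ (refl , Equivalence.from (N⇔ x) (symmetric (parent-adj px))) }) fr′ ,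
                   frame′))) })
            (runs-forNeighbours enqueueChild v (Mid μ₀ v D)
              (trans (cong (μ QUEUE) hd) (cells-at P cells))
              (λ {μ = μ} w∉ _ → step {μ₀} {μ = μ} pa w∉)
              (λ i → i)
              (P ʳ++ v ∷ D , P , refl , cells , tl , hd ,
               frontier-map inj₁ (λ { px (inj₁ p∈) → p∈ ; px (inj₂ (_ , ())) }) fr , frame)))))))
        where
        fuel≤ : budget ∸ deg ≤ fuel
        fuel≤ = ℕ.≤-trans (ℕ.∸-monoˡ-≤ deg le) (ℕ.m∸n≤m fuel (length (neighbours v)))
        weight≡ : weight (v ∷ D) + (budget ∸ deg) ≡ totalWeight
        weight≡ = trans (cong (_+ (budget ∸ deg)) (ℕ.+-comm deg (weight D)))
          (trans (ℕ.+-assoc (weight D) deg (budget ∸ deg))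
            (trans (cong (weight D +_) (ℕ.m+[n∸m]≡n deg≤)) w≡))
        arith : 1 + ((3 + cost enqueueChild) * deg + 1) + (1 + 11 * (budget ∸ deg)) ≤ 11 * budget
        arith = begin
          1 + (7 * deg + 1) + (1 + 11 * (budget ∸ deg))
            ≤⟨ ℕ.+-monoˡ-≤ (1 + 11 * (budget ∸ deg)) (s≤s (*-suc+1 7 (length (neighbours v)))) ⟩
          1 + 8 * deg + (1 + 11 * (budget ∸ deg))
            ≤⟨ ℕ.m≤m+n _ (1 + 3 * length (neighbours v)) ⟩
          1 + 8 * deg + (1 + 11 * (budget ∸ deg)) + (1 + 3 * length (neighbours v))
            ≡⟨ solve 2 (λ d b → con 1 :+ con 8 :* (con 1 :+ d) :+ (con 1 :+ con 11 :* b) :+ (con 1 :+ con 3 :* d) :=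
                         con 11 :* ((con 1 :+ d) :+ b)) refl (length (neighbours v)) (budget ∸ deg) ⟩
          11 * (deg + (budget ∸ deg))
            ≡⟨ cong (11 *_) (ℕ.m+[n∸m]≡n deg≤) ⟩
          11 * budget ∎
          where open ℕ.≤-Reasoning

-- Partition refinement

open Insertion ℕ._≟_

upd-≢ˡ : ∀ {xs : List ℕ} {f i x c} → i ∉ xs → c ∈ xs → upd f i x c ≡ f c
upd-≢ˡ {f = f} {i} {x} i∉ c∈ = upd-other f {i} x (λ { refl → i∉ c∈ })

-- A linked list of classes, in increasing order of their keys kc; cls
-- maps a vertex to its class, the classes are numbered from n, and fresh
-- is the next free number.
record Classes (n : ℕ) (xs : List ℕ) (kc nxt spl cls : ℕ → ℕ) (fresh : ℕ) : Set where
  field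
    linked : Linked id nxt (suc n) xs
    sorted : ∀ {a b} → Before xs a b → kc a < kc b
    lower  : ∀ {c} → c ∈ xs → n ≤ c
    upper  : ∀ {c} → c ∈ xs → c < fresh
    -- Split pointers are never erased. They act as time stamps: a pointer below the `base` of the
    -- current pivot is stale, and this bound makes all of them stale when the next pivot sets its
    -- base to `fresh`.
    splits : ∀ {c} → c ∈ xs → spl c < fresh
    member : ∀ (u : Fin n) → cls (toℕ u) ∈ xs
    count  : length xs + n ≡ fresh

  fresh∉ : fresh ∉ xs
  fresh∉ fresh∈ = ℕ.<-irrefl refl (upper fresh∈)

  irr : Irrefl xs
  irr p = ℕ.<-irrefl refl (sorted p)

  key-injective : ∀ {a b} → a ∈ xs → b ∈ xs → kc a ≡ kc b → a ≡ b
  key-injective {a} {b} a∈ b∈ eq with a ℕ.≟ b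
  ... | yes a≡b = a≡b
  ... | no a≢b with before-total a∈ b∈ a≢b
  ...   | inj₁ p = contradiction eq (ℕ.<⇒≢ (sorted p))
  ...   | inj₂ p = contradiction (sym eq) (ℕ.<⇒≢ (sorted p))

-- While a pivot is processed, the classes numbered from base are those it
-- has split off; as all keys have been doubled beforehand, the key of
-- such a class is odd, all others are even.
record Splitting (xs : List ℕ) (kc spl : ℕ → ℕ) (fresh base : ℕ) : Set where
  field
    base>0 : 0 < base
    base≤  : base ≤ fresh
    origin : ∀ {e} → e ∈ xs → (∃[ h ] kc e ≡ h + h) ⊎
             (∃[ c ] c ∈ xs × base ≤ spl c × spl c ≡ e × kc e ≡ suc (kc c))
    target : ∀ {c} → c ∈ xs → base ≤ spl c → spl c ∈ xs × kc (spl c) ≡ suc (kc c)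

module _ {n : ℕ} {xs : List ℕ} {kc nxt spl cls : ℕ → ℕ} {fresh : ℕ} (C : Classes n xs kc nxt spl cls fresh) where
  open Classes C

  -- Doubling makes room for an odd key right above each even one. It takes no step of the machine,
  -- as the keys belong to the invariant and only the order of the classes is stored.
  classes-double : Classes n xs (λ c → kc c + kc c) nxt spl cls fresh
  classes-double = record
    { linked = linked ; lower = lower ; upper = upper ; splits = splits ; member = member ; count = count
    ; sorted = λ p → ℕ.+-mono-< (sorted p) (sorted p) }

  splitting-start : 0 < fresh → Splitting xs (λ c → kc c + kc c) spl fresh fresh
  splitting-start fresh>0 = record
    { base>0 = fresh>0 ; base≤ = ℕ.≤-refl
    ; origin = λ {e} _ → inj₁ (kc e , refl)
    ; target = λ c∈ le → contradiction (splits c∈) (ℕ.≤⇒≯ le) }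

  -- The class that `x` leaves may become empty but stays in the list, so a move is a single
  -- assignment; the length of the list is controlled by `count`.
  classes-move : ∀ {x y} → y ∈ xs → Classes n xs kc nxt spl (upd cls x y) fresh
  classes-move {x} {y} y∈ = record
    { linked = linked ; sorted = sorted ; lower = lower ; upper = upper ; splits = splits ; count = count
    ; member = member′ }
    where
    member′ : ∀ (u : Fin n) → upd cls x y (toℕ u) ∈ xs
    member′ u with x ℕ.≟ toℕ u
    ... | yes eq = subst (_∈ xs) (sym (upd-at cls eq)) y∈
    ... | no ne  = subst (_∈ xs) (sym (upd-other cls {x} y ne)) (member u)

  module Split {base c k : ℕ} (S : Splitting xs kc spl fresh base) (c∈ : c ∈ xs) (even : kc c ≡ k + k) (unsplit : spl c < base) where
    open Splitting S

    ys : List ℕ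
    ys = insertAfter c fresh xs

    kc′ nxt′ spl′ : ℕ → ℕ
    kc′  = upd kc fresh (suc (kc c))
    nxt′ = upd (upd nxt fresh (nxt c)) c (suc fresh)
    -- A new class starts with pointer 0, which is stale because of `base>0`.
    spl′ = upd (upd spl c fresh) fresh 0

    kc′-old : ∀ {e} → e ∈ xs → kc′ e ≡ kc e
    kc′-old = upd-≢ˡ {f = kc} fresh∉

    kc′-new : kc′ fresh ≡ suc (kc c)
    kc′-new = upd-same kc fresh _

    spl′-c : spl′ c ≡ fresh
    spl′-c = trans (upd-≢ˡ {f = upd spl c fresh} fresh∉ c∈) (upd-same spl c fresh)

    private
      spl′-old : ∀ {e} → e ∈ xs → e ≢ c → spl′ e ≡ spl e
      spl′-old e∈ e≢c = trans (upd-≢ˡ {f = upd spl c fresh} fresh∉ e∈) (upd-other spl {c} fresh (e≢c ∘ sym))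

      spl′-new : spl′ fresh ≡ 0
      spl′-new = upd-same (upd spl c fresh) fresh 0

      -- The key `suc (kc c)` is free: a later even key exceeds `kc c` by at least 2, and a later
      -- odd one belongs to a class split off from some `d`, which is not `c` because `c` is
      -- unsplit.
      above : ∀ {e} → Before xs c e → suc (kc c) < kc e
      above {e} ce with origin (before-∈ʳ ce)
      ... | inj₁ (h , eq) = subst₂ (λ a b → suc a < b) (sym even) (sym eq)
                              (double-< (half-< {k} {h} (subst₂ _<_ even eq (sorted ce))))
      ... | inj₂ (d , d∈ , base≤spl , _ , eq) =
        subst (suc (kc c) <_) (sym eq) (s≤s (ℕ.≤∧≢⇒< (ℕ.≤-pred (subst (kc c <_) eq (sorted ce))) c≢d))
        where
        c≢d : kc c ≢ kc d
        c≢d kc≡ with key-injective c∈ d∈ kc≡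
        ... | refl = ℕ.<⇒≱ unsplit base≤spl

      old : ∀ {e} → e ∈ ys → e ≢ fresh → e ∈ xs
      old e∈ e≢ with ∈-insert⁻ xs e∈
      ... | inj₁ e≡ = contradiction e≡ e≢
      ... | inj₂ e∈′ = e∈′

    fresh∈ : fresh ∈ ys
    fresh∈ = inserted-∈ xs c∈

    classes-split : Classes n ys kc′ nxt′ spl′ cls (suc fresh)
    classes-split = record
      { linked = linked-insert xs id c∈ fresh∉ irr linked
      ; sorted = sorted′
      ; lower  = λ e∈ → [ (λ { refl → ℕ.≤-trans (ℕ.m≤n+m n (length xs)) (ℕ.≤-reflexive count) }) , lower ]′ (∈-insert⁻ xs e∈)
      ; upper  = λ e∈ → [ (λ { refl → ℕ.≤-refl }) , ℕ.m≤n⇒m≤1+n ∘ upper ]′ (∈-insert⁻ xs e∈)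
      ; splits = splits′
      ; member = λ u → ∈-insert xs (member u)
      ; count  = trans (cong (_+ n) (length-insert xs c∈)) (cong suc count)
      }
      where
      sorted′ : ∀ {a b} → Before ys a b → kc′ a < kc′ b
      sorted′ p with before-insert⁻ xs c∈ p
      ... | inj₁ q                         =
        subst₂ _<_ (sym (kc′-old (before-∈ˡ q))) (sym (kc′-old (before-∈ʳ q))) (sorted q)
      ... | inj₂ (inj₁ (refl , cb))        =
        subst₂ _<_ (sym kc′-new) (sym (kc′-old (before-∈ʳ cb))) (above cb)
      ... | inj₂ (inj₂ (refl , inj₁ refl)) =
        subst₂ _<_ (sym (kc′-old c∈)) (sym kc′-new) ℕ.≤-refl
      ... | inj₂ (inj₂ (refl , inj₂ ac))   =
        subst₂ _<_ (sym (kc′-old (before-∈ˡ ac))) (sym kc′-new) (ℕ.m≤n⇒m≤1+n (sorted ac))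
      splits′ : ∀ {e} → e ∈ ys → spl′ e < suc fresh
      splits′ {e} e∈ with ∈-insert⁻ xs e∈ | e ℕ.≟ c
      ... | inj₁ refl | _        = subst (_< suc fresh) (sym spl′-new) (s≤s z≤n)
      ... | inj₂ _    | yes refl = subst (_< suc fresh) (sym spl′-c) ℕ.≤-refl
      ... | inj₂ e∈′  | no e≢c   = subst (_< suc fresh) (sym (spl′-old e∈′ e≢c)) (ℕ.m≤n⇒m≤1+n (splits e∈′))

    splitting-split : Splitting ys kc′ spl′ (suc fresh) base
    splitting-split = record
      { base>0 = base>0 ; base≤ = ℕ.m≤n⇒m≤1+n base≤ ; origin = origin′ ; target = target′ }
      where
      origin′ : ∀ {e} → e ∈ ys → (∃[ h ] kc′ e ≡ h + h) ⊎
                (∃[ d ] d ∈ ys × base ≤ spl′ d × spl′ d ≡ e × kc′ e ≡ suc (kc′ d))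
      origin′ e∈ with ∈-insert⁻ xs e∈
      ... | inj₁ refl = inj₂ (c , ∈-insert xs c∈ , subst (base ≤_) (sym spl′-c) base≤ , spl′-c ,
                              trans kc′-new (cong suc (sym (kc′-old c∈))))
      ... | inj₂ e∈′ with origin e∈′
      ...   | inj₁ (h , eq) = inj₁ (h , trans (kc′-old e∈′) eq)
      ...   | inj₂ (d , d∈ , le , eq , kc≡) =
        inj₂ (d , ∈-insert xs d∈ , subst (base ≤_) (sym spl≡) le , trans spl≡ eq ,
              trans (kc′-old e∈′) (trans kc≡ (cong suc (sym (kc′-old d∈)))))
        where
        spl≡ : spl′ d ≡ spl d
        spl≡ = spl′-old d∈ (λ { refl → ℕ.<⇒≱ unsplit le })
      target′ : ∀ {e} → e ∈ ys → base ≤ spl′ e → spl′ e ∈ ys × kc′ (spl′ e) ≡ suc (kc′ e)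
      target′ {e} e∈ le with ∈-insert⁻ xs e∈ | e ℕ.≟ c
      ... | inj₁ refl | _ = contradiction (ℕ.<-≤-trans base>0 (subst (base ≤_) spl′-new le)) λ ()
      ... | inj₂ _ | yes refl =
        subst (λ z → z ∈ ys × kc′ z ≡ suc (kc′ c)) (sym spl′-c)
          (fresh∈ , trans kc′-new (cong suc (sym (kc′-old c∈))))
      ... | inj₂ e∈′ | no e≢c with target e∈′ (subst (base ≤_) (spl′-old e∈′ e≢c) le)
      ...   | spl∈ , eq = subst (λ z → z ∈ ys × kc′ z ≡ suc (kc′ e)) (sym (spl′-old e∈′ e≢c))
        (∈-insert xs spl∈ , trans (kc′-old spl∈) (trans eq (cong suc (sym (kc′-old e∈′)))))

-- The middle of a pivot: `value` gives the keys before it, `N` the neighbours scanned so far and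
-- `D` the marked vertices. Exactly the vertices in both have received the new lowest digit 1. In
-- `fresh≤` each new class is charged to a scanned neighbour.
record Stage {n} (value : Fin n → ℕ) (N D : List (Fin n)) (nxt spl cls : ℕ → ℕ) (fresh base limit : ℕ) : Set where
  field
    {xs}      : List ℕ
    {kc}      : ℕ → ℕ
    classes   : Classes n xs kc nxt spl cls fresh
    splitting : Splitting xs kc spl fresh base
    moved     : ∀ {u} → u ∈ N → u ∈ D → kc (cls (toℕ u)) ≡ suc (value u + value u)
    unmoved   : ∀ {u} → ¬ (u ∈ N × u ∈ D) → kc (cls (toℕ u)) ≡ value u + value u
    fresh≤    : fresh ≤ length N + limit

module _ {n : ℕ} {value : Fin n → ℕ} {N D : List (Fin n)} {w : Fin n} {nxt spl cls : ℕ → ℕ} {fresh base limit : ℕ}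
         (S : Stage value N D nxt spl cls fresh base limit) where
  open Stage S
  open Classes classes using (member)

  stage-skip : w ∉ D → Stage value (w ∷ N) D nxt spl cls fresh base limit
  stage-skip w∉D = record
    { classes = classes ; splitting = splitting ; fresh≤ = ℕ.m≤n⇒m≤1+n fresh≤
    ; moved   = λ { (here refl) u∈D → contradiction u∈D w∉D ; (there u∈N) u∈D → moved u∈N u∈D }
    ; unmoved = λ no → unmoved (λ (u∈N , u∈D) → no (there u∈N , u∈D)) }

  module _ {x : ℕ} (x≡w : x ≡ toℕ w) (w∉N : w ∉ N) (w∈D : w ∈ D) where

    private
      even : kc (cls x) ≡ value w + value w
      even = trans (cong (kc ∘ cls) x≡w) (unmoved (w∉N ∘ proj₁))

      cls∈ : cls x ∈ xs
      cls∈ = subst (λ z → cls z ∈ xs) (sym x≡w) (member w)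

      move : ∀ {ys kc′ nxt′ spl′ fresh′ y} → Classes n ys kc′ nxt′ spl′ cls fresh′ →
             Splitting ys kc′ spl′ fresh′ base → y ∈ ys → kc′ y ≡ suc (kc (cls x)) →
             (∀ u → kc′ (cls (toℕ u)) ≡ kc (cls (toℕ u))) → fresh′ ≤ suc (length N + limit) →
             Stage value (w ∷ N) D nxt′ spl′ (upd cls x y) fresh′ base limit
      move {kc′ = kc′} {y = y} C′ S′ y∈ kc≡ old fresh′≤ = record
        { classes = classes-move C′ {x} y∈ ; splitting = S′ ; fresh≤ = fresh′≤
        ; moved   = moved′
        ; unmoved = λ {u} no → trans (at u (λ { refl → no (here refl , w∈D) }))
                                 (unmoved (λ (u∈N , u∈D) → no (there u∈N , u∈D))) }
        where
        at : ∀ u → u ≢ w → kc′ (upd cls x y (toℕ u)) ≡ kc (cls (toℕ u))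
        at u u≢w = trans (cong kc′ (upd-≢ cls x≡w u≢w)) (old u)
        moved′ : ∀ {u} → u ∈ w ∷ N → u ∈ D → kc′ (upd cls x y (toℕ u)) ≡ suc (value u + value u)
        moved′ {u} u∈ u∈D with u Fin.≟ w | u∈
        ... | yes refl | _ = trans (cong kc′ (upd-at cls x≡w)) (trans kc≡ (cong suc even))
        ... | no u≢w | here u≡w  = contradiction u≡w u≢w
        ... | no u≢w | there u∈N = trans (at u u≢w) (moved u∈N u∈D)

    stage-reuse : base ≤ spl (cls x) →
                  Stage value (w ∷ N) D nxt spl (upd cls x (spl (cls x))) fresh base limit
    stage-reuse le with Splitting.target splitting cls∈ le
    ... | spl∈ , eq = move classes splitting spl∈ eq (λ _ → refl) (ℕ.m≤n⇒m≤1+n fresh≤)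

    stage-split : spl (cls x) < base →
      let spl′ = upd (upd spl (cls x) fresh) fresh 0 in
      Stage value (w ∷ N) D (upd (upd nxt fresh (nxt (cls x))) (cls x) (suc fresh)) spl′
            (upd cls x (spl′ (cls x))) (suc fresh) base limit
    stage-split lt = move Sp.classes-split Sp.splitting-split
      (subst (_∈ Sp.ys) (sym Sp.spl′-c) Sp.fresh∈)
      (trans (cong Sp.kc′ Sp.spl′-c) Sp.kc′-new)
      (λ u → Sp.kc′-old (member u)) (s≤s fresh≤)
      where module Sp = Split classes {k = value w} splitting cls∈ even lt

after-cut : ∀ xs {ys} {v u : A} → Irrefl (xs ʳ++ v ∷ ys) → Before (xs ʳ++ v ∷ ys) v u → u ∈ ys
after-cut xs irr p with before-ʳ++⁻ xs p
... | inj₁ q                = ⊥-elim (irr (before-ʳ++ xs (before-∈ʳ q) (here refl)))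
... | inj₂ (inj₁ (v∈ , _))  = ⊥-elim (irr (before-ʳ++ xs v∈ (here refl)))
... | inj₂ (inj₂ (here u∈)) = u∈
... | inj₂ (inj₂ (there q)) = ⊥-elim (irr (before-ʳ++ʳ xs (here (before-∈ˡ q))))

-- The root gets a parent that is no vertex. Classes are numbered from `#vertices` on, so that
-- vertices and classes can later share one linked list in `NEXT`.
initialise : Program
initialise =
  OUTPUT [ source ]≔ #vertices ⨾
  forVertices
    (MARK [ COUNTER [ lit 0 ] ]≔ lit 0 ⨾
     CLASS [ COUNTER [ lit 0 ] ]≔ #vertices)

-- Partition refinement by the neighbourhoods of the vertices, children
-- before parents; a pivot moves its marked neighbours, which are its
-- descendants, to new classes right after their old ones.
refinement : Program
refinement =
  (SPLIT [ #vertices ]≔ lit 0 ⨾ NEXT [ #vertices ]≔ lit 0 ⨾ FRESH [ lit 0 ]≔ lit 1 ⊕ #vertices) ⨾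
  popAll (BASE [ lit 0 ]≔ FRESH [ lit 0 ] ⨾ (forNeighbours refine ⨾ MARK [ VERTEX [ lit 0 ] ]≔ lit 1))
  module Refinement where
  refine : Program
  refine =
    if MARK [ NEIGHBOUR [ lit 0 ] ]
    then (OLD [ lit 0 ]≔ CLASS [ NEIGHBOUR [ lit 0 ] ] ⨾
          (if BASE [ lit 0 ] ⊖ SPLIT [ OLD [ lit 0 ] ]
           then (NEXT [ FRESH [ lit 0 ] ]≔ NEXT [ OLD [ lit 0 ] ] ⨾
                 NEXT [ OLD [ lit 0 ] ]≔ lit 1 ⊕ FRESH [ lit 0 ] ⨾
                 SPLIT [ OLD [ lit 0 ] ]≔ FRESH [ lit 0 ] ⨾
                 SPLIT [ FRESH [ lit 0 ] ]≔ lit 0 ⨾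
                 FRESH [ lit 0 ]≔ lit 1 ⊕ FRESH [ lit 0 ])
           else′ skip) ⨾
          CLASS [ NEIGHBOUR [ lit 0 ] ]≔ SPLIT [ OLD [ lit 0 ] ])
    else′ skip

module RunRefinement (G : Graph) (L : AdjacencyLists G) (s : Graph.V G) (t : RootedSpanningTree G s) where
  open Graph G using (V; adj; order; size; Adj; symmetric)
  open AdjacencyLists L using (neighbours)
  open Tree G s t
  open Search G L s
  open Weight G L
  open RunBreadthFirst G L s t using (ParentArray; Frame; Queued)
  open Refinement
  open DecMembership (Fin._≟_ {order}) using (_∈?_)

  runs-initialise : ∀ {μ} → (∀ {p x} → Par p x → μ OUTPUT (toℕ x) ≡ toℕ p) →
    Runs initialise (6 * suc totalWeight) μ
      (λ μ′ → ParentArray (μ′ OUTPUT) × (∀ i → i < order → μ′ MARK i ≡ 0 × μ′ CLASS i ≡ order))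
  runs-initialise {μ} cells = runs-≤ arith
    (runs-⨾ (runs exec-≔ ℕ.≤-refl
      (runs-for _ (λ j μ′ → ParentArray (μ′ OUTPUT) × (∀ i → i < j → μ′ MARK i ≡ 0 × μ′ CLASS i ≡ order))
        (λ {j} {μ′} j< at-j (pa , below) → at-j , pa , λ i i< →
          upd-below {P = λ i x → x ≡ 0} at-j refl (λ {k} k< → proj₁ (below k k<)) i< ,
          upd-below {P = λ i x → x ≡ order} at-j #vertices≡ (λ {k} k< → proj₂ (below k k<)) i<)
        (((λ {p} {x} px → trans (upd-≢ (μ OUTPUT) {toℕ s} {_} {s} {x} refl (λ { refl → s-orphan px })) (cells px)) ,
          trans (upd-same (μ OUTPUT) (toℕ s) _) #vertices≡) , λ _ ()))))
    where
    arith : 1 + (3 + 2) * suc order ≤ 6 * suc totalWeight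
    arith = ℕ.+-mono-≤ (s≤s z≤n) (ℕ.*-monoʳ-≤ 5 (s≤s order≤))

  Ranked : (V → ℕ) → Store → Set
  Ranked rank μ = ∃[ xs ] ∃[ kc ] Classes order xs kc (μ NEXT) (μ SPLIT) (μ CLASS) (μ FRESH 0) ×
                  (∀ u → kc (μ CLASS (toℕ u)) ≡ rank u)

  Refined : Store → Set
  Refined μ = ParentArray (μ OUTPUT) × ∃[ Q ] Topological Q ×
              Ranked (Keys.key Q) μ × μ FRESH 0 ≤ suc order + totalWeight

  private
    Marked : List V → Store → Set
    Marked D μ = (∀ {u} → u ∉ D → μ MARK (toℕ u) ≡ 0) × (∀ {u} → u ∈ D → μ MARK (toℕ u) ≡ 1)

    -- The digits of the pivots processed so far. These form a suffix `D` of `W`, and the next pivot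
    -- is prepended to it as a new lowest digit.
    partialKey : List V → List V → V → ℕ
    partialKey W D u = val (Keys.bit W u) D

    Inv : List V → List V → Store → Set
    Inv R D μ = ParentArray (μ OUTPUT) × Irrefl (R ʳ++ D) × Marked D μ ×
                Ranked (partialKey (R ʳ++ D) D) μ × μ FRESH 0 ≤ suc order + weight D

    Mid : List V → V → List V → List V → Store → Set
    Mid R v D N μ = Cells (μ QUEUE) R × μ TAIL 0 ≡ length R × ParentArray (μ OUTPUT) × Marked D μ ×
      Stage (partialKey (R ʳ++ v ∷ D) D) N D (μ NEXT) (μ SPLIT) (μ CLASS) (μ FRESH 0) (μ BASE 0) (suc order + weight D)

    step : ∀ {R v D N w μ} → w ∉ N → μ VERTEX 0 ≡ toℕ v → μ NEIGHBOUR 0 ≡ toℕ w → Mid R v D N μ →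
           wp refine (λ μ′ → μ′ VERTEX 0 ≡ toℕ v × μ′ INDEX 0 ≡ μ INDEX 0 ×
             Mid R v D (w ∷ N) (_[_,_↦_] I μ′ INDEX 0 (μ′ INDEX 0 + 1))) μ
    step {D = D} {w = w} {μ} w∉N at-v at-w (cells , tl , pa , marked@(m0 , m1) , st) =
      (λ m≢0 → let w∈D = ∈D m≢0 in
        (λ lt → at-v , refl , cells , tl , pa , marked , stage-split st at-w w∉N w∈D (nonzero-∸ lt)) ,
        (λ le → at-v , refl , cells , tl , pa , marked , stage-reuse st at-w w∉N w∈D (ℕ.m∸n≡0⇒m≤n le))) ,
      (λ m≡0 → at-v , refl , cells , tl , pa , marked ,
        stage-skip st (λ w∈D → case trans (sym m≡0) (trans (cong (μ MARK) at-w) (m1 w∈D)) of λ ()))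
      where
      ∈D : μ MARK (μ NEIGHBOUR 0) ≢ 0 → w ∈ D
      ∈D m≢0 with w ∈? D
      ... | yes w∈ = w∈
      ... | no w∉  = contradiction (trans (cong (μ MARK) at-w) (m0 w∉)) m≢0

    marked-next : ∀ {v D μ c} → c ≡ toℕ v → Irrefl (v ∷ D) → Marked D μ → Marked (v ∷ D) (_[_,_↦_] I μ MARK c 1)
    marked-next {v} {D} {μ} {c} c≡v irr (m0 , m1) =
      (λ u∉ → trans (upd-≢ (μ MARK) c≡v (u∉ ∘ here)) (m0 (u∉ ∘ there))) ,
      λ { (here refl) → upd-at (μ MARK) c≡v
        ; (there u∈)  → trans (upd-≢ (μ MARK) c≡v (λ { refl → irr (here u∈) })) (m1 u∈) }

    -- The digit of `v` in the key of `u` is 1 exactly if `u` is a neighbour of `v` that comes later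
    -- in the order, and the later vertices are those in `D`, the marked ones. This is why `refine`
    -- tests the mark.
    key-next : ∀ {R v D N u k} → Irrefl (R ʳ++ v ∷ D) → (∀ u → u ∈ N ⇔ Adj v u) →
               let value = partialKey (R ʳ++ v ∷ D) D u in
               (u ∈ N → u ∈ D → k ≡ suc (value + value)) → (¬ (u ∈ N × u ∈ D) → k ≡ value + value) →
               k ≡ partialKey (R ʳ++ v ∷ D) (v ∷ D) u
    key-next {R} {v} {D} {N} {u} irr N⇔ moved unmoved with u ∈? N | u ∈? D
    ... | yes u∈N | yes u∈D
      rewrite Keys.restricted⁺ (R ʳ++ v ∷ D) {u} {u} {v} (Equivalence.to (N⇔ u) u∈N) (before-ʳ++ʳ R (here u∈D)) =
      moved u∈N u∈D
    ... | no u∉N | _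
      rewrite Keys.restricted⁺-false (R ʳ++ v ∷ D) {u} {u} {v} (λ (vu , _) → u∉N (Equivalence.from (N⇔ u) vu)) =
      unmoved (u∉N ∘ proj₁)
    ... | yes _ | no u∉D
      rewrite Keys.restricted⁺-false (R ʳ++ v ∷ D) {u} {u} {v} (λ (_ , vu) → u∉D (after-cut R irr vu)) =
      unmoved (u∉D ∘ proj₂)

    pivot : ∀ {R v D μ} → μ VERTEX 0 ≡ toℕ v → Cells (μ QUEUE) R → μ TAIL 0 ≡ length R → Inv (v ∷ R) D μ →
      Runs (BASE [ lit 0 ]≔ FRESH [ lit 0 ] ⨾ (forNeighbours refine ⨾ MARK [ VERTEX [ lit 0 ] ]≔ lit 1))
        (16 * suc (length (neighbours v))) μ
        (λ μ′ → Cells (μ′ QUEUE) R × μ′ TAIL 0 ≡ length R × Inv R (v ∷ D) μ′)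
    pivot {R} {v} {D} {μ} at-v cells tl (pa , irr , marked , (xs , kc , C , ranked) , fresh≤) =
      runs-≤ arith
      (runs-⨾ (runs exec-≔ ℕ.≤-refl
        (runs-⨾ (runs-map
          (λ {μ′} (at-v′ , N , N⇔ , deg , cells′ , tl′ , pa′ , marked′ , st) → runs exec-≔ ℕ.≤-refl
            (cells′ , tl′ , pa′ , irr , marked-next {v} {D} {μ′} at-v′ (irr ∘ before-ʳ++ʳ R) marked′ ,
             (_ , _ , Stage.classes st ,
              λ u → key-next {R} {v} {D} {N} {u} irr N⇔ (Stage.moved st) (Stage.unmoved st)) ,
             ℕ.≤-trans (Stage.fresh≤ st) (ℕ.≤-trans (ℕ.≤-reflexive (cong (_+ (suc order + weight D)) deg)) (grow (length (neighbours v)) (weight D)))))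
          (runs-forNeighbours refine v (Mid R v D) at-v
            (λ {N} {w} {μ} w∉N _ → step {R} {v} {D} {N} {w} {μ} w∉N)
            (λ i → i)
            (cells , tl , pa , marked , record
              { classes = classes-double C
              ; splitting = splitting-start C (subst (0 <_) (Classes.count C) (ℕ.m≤n⇒m≤n+o order (nonempty (Classes.member C v))))
              ; moved = λ ()
              ; unmoved = λ {u} _ → cong₂ _+_ (ranked u) (ranked u)
              ; fresh≤ = fresh≤ }))))))
      where
      nonempty : ∀ {A : Set} {x : A} {xs} → x ∈ xs → 0 < length xs
      nonempty (here _)  = s≤s z≤n
      nonempty (there _) = s≤s z≤n
      grow : ∀ d w → d + (suc order + w) ≤ suc order + (suc d + w)
      grow d w = subst (d + (suc order + w) ≤_)
        (solve 3 (λ d n w → con 1 :+ (d :+ (con 1 :+ n :+ w)) := con 1 :+ n :+ (con 1 :+ d :+ w)) refl d order w)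
        (ℕ.n≤1+n _)
      arith : 1 + (14 * suc (length (neighbours v)) + 1) ≤ 16 * suc (length (neighbours v))
      arith = ℕ.+-mono-≤ {1} (s≤s z≤n) (*-suc+1 14 (length (neighbours v)))

  runs-refinement : ∀ {μ₀ μ} → ParentArray (μ₀ OUTPUT) → (∀ i → i < order → μ₀ MARK i ≡ 0 × μ₀ CLASS i ≡ order) →
                    Queued μ₀ μ → Runs refinement (23 * suc totalWeight) μ Refined
  runs-refinement {μ₀} {μ} (pa , root) clean (R , topo , cells , tl , fo , fm , fc) = runs-≤ arith
    (runs-⨾ (runs-map
      (λ {μ′} (cells′ , tl′ , inv) → runs-map
        (λ {μ″} (pa′ , _ , _ , ranked , fresh≤) →
          pa′ , R ʳ++ [] , topo , ranked , ℕ.≤-trans fresh≤ (ℕ.+-monoʳ-≤ (suc order) (∑-≤ _ irr)))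
        (runs-popAll _ 16 Inv pivot (λ i → i) R cells′ tl′ inv))
      (runs-wp (SPLIT [ #vertices ]≔ lit 0 ⨾ NEXT [ #vertices ]≔ lit 0 ⨾ FRESH [ lit 0 ]≔ lit 1 ⊕ #vertices)
        {μ} {λ μ′ → Cells (μ′ QUEUE) R × μ′ TAIL 0 ≡ length R × Inv R [] μ′}
        (cells , tl , ((λ px → trans (fo _) (pa px)) , trans (fo _) root) , irr ,
         ((λ {u} _ → trans (fm _) (proj₁ (clean (toℕ u) (Fin.toℕ<n u)))) , λ ()) ,
         (order ∷ [] , (λ _ → 0) , record
           { linked = refl , upd-at (μ NEXT) #vertices≡
           ; sorted = λ { (here ()) ; (there ()) }
           ; lower  = λ { (here refl) → ℕ.≤-refl }
           ; upper  = λ { (here refl) → s≤s (ℕ.≤-reflexive (sym #vertices≡)) }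
           ; splits = λ { (here refl) → subst (_< suc (length (Input.adjacency I))) (sym (upd-at (μ SPLIT) #vertices≡)) (s≤s z≤n) }
           ; member = λ u → here (trans (fc _) (proj₂ (clean (toℕ u) (Fin.toℕ<n u))))
           ; count  = cong suc (sym #vertices≡) } , λ _ → refl) ,
         s≤s (ℕ.≤-reflexive (trans #vertices≡ (sym (ℕ.+-identityʳ order))))))))
    where
    irr : Irrefl (R ʳ++ [])
    irr = Topological.irreflexive topo
    arith : 3 + (1 + 19 * weight R) ≤ 23 * suc totalWeight
    arith = ℕ.≤-trans (ℕ.+-monoʳ-≤ 4 (ℕ.*-monoʳ-≤ 19 (∑-≤ _ λ p → irr (before-ʳ++ˡ R p))))
      (subst (4 + 19 * totalWeight ≤_)
        (solve 1 (λ w → con 4 :+ con 19 :* w :+ (con 19 :+ con 4 :* w) := con 23 :* (con 1 :+ w)) refl totalWeight)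
        (ℕ.m≤m+n _ _))

-- Building the order

first-element : ∀ {y} {ys : List A} → y ∈ ys → (∀ {x} → ¬ Before ys x y) → ∃[ zs ] ys ≡ y ∷ zs
first-element {ys = y ∷ ys} (here refl) _  = ys , refl
first-element {ys = x ∷ ys} (there y∈)  ¬before = contradiction (here y∈) ¬before

-- Instead of collecting the members of each class, every vertex is inserted right behind its class
-- node. The list stays sorted by keys, and the class nodes remain in it, to be skipped in the next
-- phase.
mergeVertices : Program
mergeVertices =
  forVertices
    (OLD [ lit 0 ]≔ CLASS [ COUNTER [ lit 0 ] ] ⨾
     NEXT [ COUNTER [ lit 0 ] ]≔ NEXT [ OLD [ lit 0 ] ] ⨾
     NEXT [ OLD [ lit 0 ] ]≔ lit 1 ⊕ COUNTER [ lit 0 ])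

record Merged {n} (rank : Fin n → ℕ) (j total : ℕ) (nxt cls : ℕ → ℕ) : Set where
  field
    {xs}   : List ℕ
    {kc}   : ℕ → ℕ
    linked : Linked id nxt (suc n) xs
    irr    : Irrefl xs
    sorted : ∀ {a b} → Before xs a b → kc a ≤ kc b
    range  : ∀ {c} → c ∈ xs → c < j ⊎ n ≤ c
    class  : ∀ (u : Fin n) → cls (toℕ u) ∈ xs × n ≤ cls (toℕ u) × kc (cls (toℕ u)) ≡ rank u
    vertex : ∀ (u : Fin n) → toℕ u < j → toℕ u ∈ xs × kc (toℕ u) ≡ rank u
    count  : length xs ≡ j + total

merged-start : ∀ {n xs kc nxt spl cls fresh} {rank : Fin n → ℕ} → Classes n xs kc nxt spl cls fresh →
               (∀ u → kc (cls (toℕ u)) ≡ rank u) → Merged rank 0 (length xs) nxt cls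
merged-start C ranked = record
  { linked = linked ; irr = irr ; sorted = ℕ.<⇒≤ ∘ sorted ; range = inj₂ ∘ lower
  ; class = λ u → member u , lower (member u) , ranked u ; vertex = λ u () ; count = refl }
  where open Classes C

merged-insert : ∀ {n} {rank : Fin n → ℕ} {j total nxt cls x} → j < n → x ≡ j → Merged rank j total nxt cls →
                Merged rank (suc j) total (upd (upd nxt x (nxt (cls x))) (cls x) (suc x)) cls
merged-insert {n} {rank} {j} {total} {nxt} {cls} j<n refl M = record
  { linked = linked-insert xs id c∈ j∉ irr linked
  ; irr    = irrefl-insert c∈ j∉ irr
  ; sorted = sorted′
  ; range  = λ e∈ → [ (λ { refl → inj₁ ℕ.≤-refl }) ,
                      (λ e∈ → Sum.map₁ ℕ.m≤n⇒m≤1+n (range e∈)) ]′ (∈-insert⁻ xs e∈)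
  ; class  = λ u → let cu∈ , n≤ , eq = class u in ∈-insert xs cu∈ , n≤ , trans (kc′-old cu∈) eq
  ; vertex = vertex′
  ; count  = trans (length-insert xs c∈) (cong suc count)
  }
  where
  open Merged M
  w : Fin n
  w = fromℕ< j<n
  w≡ : toℕ w ≡ j
  w≡ = Fin.toℕ-fromℕ< j<n
  kc′ : ℕ → ℕ
  kc′ = upd kc j (kc (cls j))
  c∈ : cls j ∈ xs
  c∈ = subst (λ z → cls z ∈ xs) w≡ (proj₁ (class w))
  j∉ : j ∉ xs
  j∉ j∈ with range j∈
  ... | inj₁ j<j = ℕ.<-irrefl refl j<j
  ... | inj₂ n≤j = ℕ.<⇒≱ j<n n≤j
  kc′-old : ∀ {e} → e ∈ xs → kc′ e ≡ kc e
  kc′-old = upd-≢ˡ {f = kc} j∉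
  kc′-new : kc′ j ≡ kc (cls j)
  kc′-new = upd-same kc j _
  sorted′ : ∀ {a b} → Before (insertAfter (cls j) j xs) a b → kc′ a ≤ kc′ b
  sorted′ p with before-insert⁻ xs c∈ p
  ... | inj₁ q                         =
    subst₂ _≤_ (sym (kc′-old (before-∈ˡ q))) (sym (kc′-old (before-∈ʳ q))) (sorted q)
  ... | inj₂ (inj₁ (refl , cb))        =
    subst₂ _≤_ (sym kc′-new) (sym (kc′-old (before-∈ʳ cb))) (sorted cb)
  ... | inj₂ (inj₂ (refl , inj₁ refl)) =
    subst₂ _≤_ (sym (kc′-old c∈)) (sym kc′-new) ℕ.≤-refl
  ... | inj₂ (inj₂ (refl , inj₂ ac))   =
    subst₂ _≤_ (sym (kc′-old (before-∈ˡ ac))) (sym kc′-new) (sorted ac)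
  vertex′ : ∀ u → toℕ u < suc j → toℕ u ∈ insertAfter (cls j) j xs × kc′ (toℕ u) ≡ rank u
  vertex′ u u< with toℕ u ℕ.≟ j
  ... | yes u≡j = subst (_∈ insertAfter (cls j) j xs) (sym u≡j) (inserted-∈ xs c∈) ,
    trans (cong kc′ u≡j) (trans kc′-new (trans (cong (kc ∘ cls) (sym u≡j)) (proj₂ (proj₂ (class u)))))
  ... | no u≢j with vertex u (ℕ.≤∧≢⇒< (ℕ.≤-pred u<) u≢j)
  ...   | u∈ , eq = ∈-insert xs u∈ , trans (kc′-old u∈) eq

-- The list is walked in increasing order of the keys; as the key of a
-- parent is smaller than those of its children, the parent is in place
-- when a child is inserted right after it.
insertVertices : Program
insertVertices =
  (SUCC [ source ]≔ lit 0 ⨾ CURSOR [ lit 0 ]≔ lit 1 ⊕ #vertices) ⨾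
  (while CURSOR [ lit 0 ] loop visitItem)
  module InsertVertices where
  visitItem : Program
  visitItem =
    OLD [ lit 0 ]≔ CURSOR [ lit 0 ] ⊖ lit 1 ⨾
    -- Tells vertices from class nodes, whose numbers start at `#vertices`; the next test excepts
    -- the root, which is in place from the beginning.
    (if #vertices ⊖ OLD [ lit 0 ]
     then (if ∣ OLD [ lit 0 ] - source ∣
           then (SUCC [ OLD [ lit 0 ] ]≔ SUCC [ OUTPUT [ OLD [ lit 0 ] ] ] ⨾
                 SUCC [ OUTPUT [ OLD [ lit 0 ] ] ]≔ lit 1 ⊕ OLD [ lit 0 ])
           else′ skip)
     else′ skip) ⨾
    CURSOR [ lit 0 ]≔ NEXT [ OLD [ lit 0 ] ]

writeOrder : Program
writeOrder =
  (CURSOR [ lit 0 ]≔ lit 1 ⊕ source ⨾ COUNTER [ lit 0 ]≔ lit 0) ⨾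
  (while CURSOR [ lit 0 ] loop writeVertex)
  module WriteOrder where
  writeVertex : Program
  writeVertex =
    OUTPUT [ COUNTER [ lit 0 ] ]≔ CURSOR [ lit 0 ] ⊖ lit 1 ⨾
    CURSOR [ lit 0 ]≔ SUCC [ CURSOR [ lit 0 ] ⊖ lit 1 ] ⨾
    COUNTER [ lit 0 ]≔ lit 1 ⊕ COUNTER [ lit 0 ]

orderProgram : Program
orderProgram =
  initialise ⨾ breadthFirst ⨾ refinement ⨾ mergeVertices ⨾ insertVertices ⨾ writeOrder

module RunOrder (G : Graph) (L : AdjacencyLists G) (s : Graph.V G) (t : RootedSpanningTree G s)
                {W : List (Graph.V G)} (search : LexDFS.SearchOrder G s W)
                (par-rightmost : ∀ {p x} → Tree.Par G s t p x → LexDFS.Rightmost G s W p x) where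
  open Graph G using (V; adj; order; size; Adj; symmetric)
  open AdjacencyLists L using (neighbours)
  open RootedSpanningTree t
  open LexDFS G s
  open Tree G s t
  open Keys using (key)
  open Search G L s
  open Weight G L
  open RunBreadthFirst G L s t
  open RunRefinement G L s t
  open InsertVertices
  open WriteOrder
  private
    module VertexInsertion = Insertion (Fin._≟_ {order})

  MergedVertices : Store → Set
  MergedVertices μ = ParentArray (μ OUTPUT) × ∃[ Q ] Topological Q × ∃[ total ] total ≤ suc totalWeight ×
                     Merged (key Q) order total (μ NEXT) (μ CLASS)

  runs-mergeVertices : ∀ {μ} → Refined μ → Runs mergeVertices (6 * suc totalWeight) μ MergedVertices
  runs-mergeVertices (pa , Q , topo , (xs , kc , C , ranked) , fresh≤) =
    runs-≤ (ℕ.*-monoʳ-≤ 6 (s≤s order≤))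
      (runs-map (λ (pa , M) → pa , Q , topo , length xs , length≤ , M)
        (runs-for _ (λ j μ → ParentArray (μ OUTPUT) × Merged (key Q) j (length xs) (μ NEXT) (μ CLASS))
          (λ j< at-j (pa , M) → at-j , pa , merged-insert j< at-j M)
          (pa , merged-start C ranked)))
    where
    length≤ : length xs ≤ suc totalWeight
    length≤ = ℕ.+-cancelʳ-≤ order (length xs) (suc totalWeight)
      (subst₂ _≤_ (sym (Classes.count C)) (cong suc (ℕ.+-comm order totalWeight)) fresh≤)

  Ordered : List V → Store → Set
  Ordered O μ = Linked toℕ (μ SUCC) (suc (toℕ s)) O × Irrefl O × (∀ x → x ∈ O) × FourPoint O ×
                (∃[ rest ] O ≡ s ∷ rest)

  private
    module _ {Q : List V} {xs : List ℕ} {kc nxt : ℕ → ℕ} (topoQ : Topological Q) (irr : Irrefl xs) (linked : Linked id nxt (suc order) xs)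
             (sorted : ∀ {a b} → Before xs a b → kc a ≤ kc b)
             (vertex : ∀ (u : V) → toℕ u ∈ xs × kc (toℕ u) ≡ key Q u) where

      -- `O` is the order built so far and `D` the list items already walked; besides the root, `O`
      -- consists of exactly the vertices among them.
      record Inserted (O : List V) (D : List ℕ) : Set where
        field
          contig  : Contiguous O
          closed  : ParentClosed O
          ranked  : SiblingsSorted (key Q) O
          root    : s ∈ O
          origin  : ∀ {u} → u ∈ O → u ≡ s ⊎ toℕ u ∈ D
          arrived : ∀ {u} → toℕ u ∈ D → u ∈ O

      inserted-skip : ∀ {O D x} → (∀ {u : V} → toℕ u ≡ x → u ≡ s) → Inserted O D → Inserted O (x ∷ D)
      inserted-skip only-s i = record
        { contig = contig ; closed = closed ; ranked = ranked ; root = root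
        ; origin  = λ u∈ → Sum.map₂ there (origin u∈)
        ; arrived = λ { (here u≡x) → subst (_∈ _) (sym (only-s u≡x)) root ; (there u∈) → arrived u∈ } }
        where open Inserted i

      module Insert {O : List V} {D R : List ℕ} {p u : V} (split : D ʳ++ toℕ u ∷ R ≡ xs) (pu : Par p u) (i : Inserted O D) where
        open Inserted i
        before-u : ∀ {a} → a ∈ D → Before xs a (toℕ u)
        before-u a∈ = subst (λ xs → Before xs _ (toℕ u)) split (before-ʳ++ D a∈ (here refl))
        u≢s : u ≢ s
        u≢s refl = s-orphan pu
        u∉ : u ∉ O
        u∉ u∈ with origin u∈
        ... | inj₁ u≡s = u≢s u≡s
        ... | inj₂ u∈D = irr (before-u u∈D)
        -- In the sorted list a strictly smaller key comes earlier, whereas equal keys may come in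
        -- any order; so the strictness in `key-parent` guarantees that the parent is in place.
        key<⇒∈D : ∀ {y} → key Q y < key Q u → toℕ y ∈ D
        key<⇒∈D {y} lt with before-total (proj₁ (vertex y)) (proj₁ (vertex u))
                              (λ eq → ℕ.<-irrefl (cong (key Q) (Fin.toℕ-injective eq)) lt)
        ... | inj₁ yu = before-cut D (subst Irrefl (sym split) irr) (subst (λ xs → Before xs (toℕ y) (toℕ u)) (sym split) yu)
        ... | inj₂ uy = contradiction (subst₂ _≤_ (proj₂ (vertex u)) (proj₂ (vertex y)) (sorted uy)) (ℕ.<⇒≱ lt)
        p∈ : p ∈ O
        p∈ = arrived (key<⇒∈D (key-parent search par-rightmost topoQ pu))
        top : ∀ {y} → y ∈ O → key Q y ≤ key Q u
        top {y} y∈ with origin y∈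
        -- The root is in `O` even before it is met in the list, so its key is bounded through the
        -- tree.
        ... | inj₁ refl = key-anc search par-rightmost topoQ (reaches-root u)
        ... | inj₂ y∈D  = subst₂ _≤_ (proj₂ (vertex y)) (proj₂ (vertex u)) (sorted (before-u y∈D))
        inserted : Inserted (VertexInsertion.insertAfter p u O) (toℕ u ∷ D)
        inserted = record
          { contig  = contiguous-insert p∈ u∉ pu closed contig
          ; closed  = λ x∈ qx → case VertexInsertion.∈-insert⁻ O x∈ of λ
              { (inj₁ refl) → VertexInsertion.∈-insert O (subst (_∈ O) (par-functional pu qx) p∈)
              ; (inj₂ x∈O)  → VertexInsertion.∈-insert O (closed x∈O qx) }
          ; ranked  = siblingsSorted-insert p∈ u∉ pu {key Q} contig top ranked
          ; root    = VertexInsertion.∈-insert O root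
          ; origin  = λ x∈ → case VertexInsertion.∈-insert⁻ O x∈ of λ
              { (inj₁ refl) → inj₂ (here refl)
              ; (inj₂ x∈O)  → Sum.map₂ there (origin x∈O) }
          ; arrived = λ
              { (here x≡u) → subst (_∈ VertexInsertion.insertAfter p u O) (sym (Fin.toℕ-injective x≡u))
                               (VertexInsertion.inserted-∈ O p∈)
              ; (there x∈) → VertexInsertion.∈-insert O (arrived x∈) }
          }

      Inv : List ℕ → List ℕ → Store → Set
      Inv R D μ = D ʳ++ R ≡ xs × ParentArray (μ OUTPUT) × (∀ i → μ NEXT i ≡ nxt i) ×
                  ∃[ O ] Linked toℕ (μ SUCC) (suc (toℕ s)) O × Inserted O D

      step : ∀ {R x D μ} → μ CURSOR 0 ≡ suc x → Inv (x ∷ R) D μ →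
             wp visitItem (λ μ′ → μ′ CURSOR 0 ≡ nxt x × Inv R (x ∷ D) μ′) μ
      step {R} {x} {D} {μ} cur (split , pa , fn , O , l , i) =
        (λ in-range →
          (λ ≢s → insert (nonzero-∸ in-range) ≢s) ,
          (λ ≡s → advance , split , pa , fn , O , l , inserted-skip
            (λ u≡x → Fin.toℕ-injective (trans u≡x (trans (sym c≡x) (distance-zero ≡s)))) i)) ,
        (λ out → advance , split , pa , fn , O , l , inserted-skip
          (λ {u} u≡x → contradiction (Fin.toℕ<n u)
            (ℕ.≤⇒≯ (subst₂ _≤_ #vertices≡ (trans c≡x (sym u≡x)) (ℕ.m∸n≡0⇒m≤n out)))) i)
        where
        c : ℕ
        c = μ CURSOR 0 ∸ 1
        c≡x : c ≡ x
        c≡x = cong (_∸ 1) cur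
        advance : μ NEXT c ≡ nxt x
        advance = trans (fn c) (cong nxt c≡x)
        insert : c < length (Input.adjacency I) → (c ∸ toℕ s) + (toℕ s ∸ c) ≢ 0 → _
        insert c< ≢s = advance , split , pa , fn , VertexInsertion.insertAfter p u O ,
          subst₂ (λ a b → Linked toℕ (upd (upd (μ SUCC) a (μ SUCC b)) b (suc a)) (suc (toℕ s)) (VertexInsertion.insertAfter p u O))
            u≡c (trans (sym (proj₁ pa pu)) (cong (μ OUTPUT) u≡c))
            (VertexInsertion.linked-insert O Fin.toℕ-injective Ins.p∈ Ins.u∉ (λ q → Contiguous.ordered (Inserted.contig i) q ε) l) ,
          subst (λ z → Inserted (VertexInsertion.insertAfter p u O) (z ∷ D)) (trans u≡c c≡x) Ins.inserted
          where
          u : V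
          u = fromℕ< (subst (c <_) #vertices≡ c<)
          u≡c : toℕ u ≡ c
          u≡c = Fin.toℕ-fromℕ< _
          u≢s : u ≢ s
          u≢s u≡s = ≢s (distance-refl (trans (sym u≡c) (cong toℕ u≡s)))
          p : V
          p = proj₁ (has-parent u≢s)
          pu : Par p u
          pu = proj₂ (has-parent u≢s)
          module Ins = Insert {O} {D} {R} {p} {u} (subst (λ z → D ʳ++ z ∷ R ≡ xs) (sym (trans u≡c c≡x)) split) pu i

      finish : ∀ {μ} → Inv [] (xs ʳ++ []) μ → ∃[ O ] Ordered O μ
      finish (_ , _ , _ , O , l , i) = O , l , irrO , covers , fourPoint-O search par-rightmost topoQ contig covers ranked , first
        where
        open Inserted i
        irrO : Irrefl O
        irrO p = Contiguous.ordered contig p ε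
        covers : ∀ x → x ∈ O
        covers x = arrived (∈-ʳ++ˡ xs (proj₁ (vertex x)))
        first : ∃[ rest ] O ≡ s ∷ rest
        first = first-element root (λ {x} xs → Contiguous.ordered contig xs (reaches-root x))

  runs-insertVertices : ∀ {μ} → MergedVertices μ →
    Runs insertVertices (40 * suc totalWeight) μ (λ μ′ → ∃[ O ] Ordered O μ′)
  runs-insertVertices {μ} (pa , Q , topoQ , total , total≤ , M) = runs-≤ arith
    (runs-⨾ (runs-map
      (λ {μ₁} (cur , inv) → runs-map (λ {μ₂} → finish topoQ irr linked sorted vertex′ {μ₂})
        (runs-walk visitItem (Inv topoQ irr linked sorted vertex′)
          (λ {R} {x} {D} {μ} → step topoQ irr linked sorted vertex′ {R} {x} {D} {μ}) xs linked cur inv))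
      (runs-wp (SUCC [ source ]≔ lit 0 ⨾ CURSOR [ lit 0 ]≔ lit 1 ⊕ #vertices)
        {μ} {λ μ₁ → μ₁ CURSOR 0 ≡ suc order × Inv topoQ irr linked sorted vertex′ xs [] μ₁}
        (cong suc #vertices≡ , refl , pa , (λ _ → refl) , s ∷ [] , (refl , upd-same (μ SUCC) (toℕ s) 0) , record
          { contig  = record
              { ordered = λ { (here ()) ; (there ()) } ; contiguous = λ { (here ()) ; (there ()) } }
          ; closed  = λ { (here refl) ps → contradiction ps s-orphan }
          ; ranked  = λ { (here ()) ; (there ()) }
          ; root    = here refl
          ; origin  = λ { (here u≡s) → inj₁ u≡s }
          ; arrived = λ () }))))
    where
    open Merged M
    vertex′ : ∀ u → toℕ u ∈ xs × kc (toℕ u) ≡ key Q u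
    vertex′ u = vertex u (Fin.toℕ<n u)
    -- The merged list consists of `order` vertices and at most `suc totalWeight` classes.
    length≤ : length xs ≤ totalWeight + suc totalWeight
    length≤ = subst (_≤ totalWeight + suc totalWeight) (sym count) (ℕ.+-mono-≤ order≤ total≤)
    arith : 2 + (1 + (1 + cost visitItem) * length xs) ≤ 40 * suc totalWeight
    arith = ℕ.≤-trans (ℕ.+-monoʳ-≤ 3 (ℕ.*-monoʳ-≤ (1 + cost visitItem) length≤))
      (subst (3 + (1 + cost visitItem) * (totalWeight + suc totalWeight) ≤_)
        (solve 1 (λ w → con 3 :+ con 9 :* (w :+ (con 1 :+ w)) :+ (con 28 :+ con 22 :* w) := con 40 :* (con 1 :+ w)) refl totalWeight)
        (ℕ.m≤m+n _ (28 + 22 * totalWeight)))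

  Written : Store → Set
  Written μ = ∃[ O ] Cells (μ OUTPUT) (O ʳ++ []) × Irrefl O × (∀ x → x ∈ O) × FourPoint O × (∃[ rest ] O ≡ s ∷ rest)

  runs-writeOrder : ∀ {O μ} → Ordered O μ → Runs writeOrder (7 * suc totalWeight) μ Written
  runs-writeOrder {O} {μ} (linked , irr , covers , fp , first) = runs-≤ arith
    (runs-⨾ (runs-map
      (λ {μ₁} (cur , inv) → runs-map (λ {μ₂} (_ , cells , _) → O , cells , irr , covers , fp , first)
        (runs-walk writeVertex Written-Inv
          (λ {R} {x} {D} {μ} cur (at , cells , fs) →
            trans (fs _) (cong (λ c → μ₀ SUCC (c ∸ 1)) cur) , cong suc at ,
            (trans (upd-at (μ OUTPUT) at) (cong (_∸ 1) cur) , cells-upd D (ℕ.≤-reflexive (sym at)) cells) , fs)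
          O linked cur inv))
      (runs-wp (CURSOR [ lit 0 ]≔ lit 1 ⊕ source ⨾ COUNTER [ lit 0 ]≔ lit 0)
        {μ} {λ μ₁ → μ₁ CURSOR 0 ≡ suc (toℕ s) × Written-Inv O [] μ₁}
        (refl , refl , tt , λ _ → refl))))
    where
    μ₀ = μ
    Written-Inv : List V → List V → Store → Set
    Written-Inv R D μ = μ COUNTER 0 ≡ length D × Cells (μ OUTPUT) D × (∀ i → μ SUCC i ≡ μ₀ SUCC i)
    length≤ : length O ≤ totalWeight
    length≤ = ℕ.≤-trans (irrefl⇒length≤ irr) order≤
    arith : 2 + (1 + 4 * length O) ≤ 7 * suc totalWeight
    arith = ℕ.≤-trans (ℕ.+-monoʳ-≤ 3 (ℕ.*-monoʳ-≤ 4 length≤))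
      (subst (3 + 4 * totalWeight ≤_)
        (solve 1 (λ w → con 3 :+ con 4 :* w :+ (con 4 :+ con 3 :* w) := con 7 :* (con 1 :+ w)) refl totalWeight)
        (ℕ.m≤m+n _ _))

  runs-orderProgram : ∀ {μ} → (∀ {p x} → Par p x → μ OUTPUT (toℕ x) ≡ toℕ p) →
                      Runs orderProgram (96 * suc totalWeight) μ Written
  runs-orderProgram cells = runs-≤ (ℕ.≤-reflexive arith)
    (runs-⨾ (runs-map (λ {μ₀} (pa , clean) → runs-⨾ (runs-map (λ queued → runs-⨾ (runs-map (λ refined →
      runs-⨾ (runs-map (λ merged → runs-⨾ (runs-map (λ (O , ordered) → runs-writeOrder ordered)
        (runs-insertVertices merged)))
        (runs-mergeVertices refined)))
      (runs-refinement {μ₀} pa clean queued)))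
      (runs-breadthFirst pa)))
      (runs-initialise cells)))
    where
    N = suc totalWeight
    arith : 6 * N + (14 * N + (23 * N + (6 * N + (40 * N + 7 * N)))) ≡ 96 * N
    arith = solve 1 (λ n → con 6 :* n :+ (con 14 :* n :+ (con 23 :* n :+ (con 6 :* n :+ (con 40 :* n :+ con 7 :* n)))) := con 96 :* n) refl N

-- The two reductions

cells-lookup : ∀ {n k} (f : ℕ → ℕ) (xs : Vec (Fin n) k) acc → Cells f (toList xs ʳ++ acc) →
               ∀ i → f (length acc + toℕ i) ≡ toℕ (Vec.lookup xs i)
cells-lookup f (x ∷ xs) acc c Fin.zero    =
  trans (cong f (ℕ.+-identityʳ (length acc))) (cells-at (toList xs) c)
cells-lookup f (x ∷ xs) acc c (Fin.suc i) =
  trans (cong f (ℕ.+-suc (length acc) (toℕ i))) (cells-lookup f xs (x ∷ acc) c i)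

fromList-length : ∀ {n} (xs : List A) → length xs ≡ n → ∃[ v ] toList {n = n} v ≡ xs
fromList-length xs refl = Vec.fromList xs , toList∘fromList xs

∈-toList : ∀ {k} {x : A} (xs : Vec A k) → x ∈ toList xs → ∃[ i ] Vec.lookup xs i ≡ x
∈-toList (x ∷ xs) (here refl) = Fin.zero , refl
∈-toList (x ∷ xs) (there x∈) with ∈-toList xs x∈
... | i , eq = Fin.suc i , eq

lookup-∈ : ∀ {k} (xs : Vec A k) i → Vec.lookup xs i ∈ toList xs
lookup-∈ (x ∷ xs) Fin.zero    = here refl
lookup-∈ (x ∷ xs) (Fin.suc i) = there (lookup-∈ xs i)

lookup-before : ∀ {k} (xs : Vec A k) {i j} → toℕ i < toℕ j →
                Before (toList xs) (Vec.lookup xs i) (Vec.lookup xs j)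
lookup-before (x ∷ xs) {Fin.zero}  {Fin.suc j} _         = here (lookup-∈ xs j)
lookup-before (x ∷ xs) {Fin.suc i} {Fin.suc j} (s≤s i<j) = there (lookup-before xs i<j)

lookup-first : ∀ {k} {x : A} {rest} (xs : Vec A k) i → toList xs ≡ x ∷ rest → toℕ i ≡ 0 → Vec.lookup xs i ≡ x
lookup-first (x ∷ xs) Fin.zero refl _ = refl

module _ {A : Set} {k : ℕ} (xs : Vec A k) (irr : Irrefl (toList xs)) where

  lookup-injective : ∀ {i j} → Vec.lookup xs i ≡ Vec.lookup xs j → i ≡ j
  lookup-injective {i} {j} eq with Fin.<-cmp i j
  ... | tri< i<j _ _ = contradiction eq (before-≢ irr (lookup-before xs i<j))
  ... | tri≈ _ i≡j _ = i≡j
  ... | tri> _ _ j<i = contradiction (sym eq) (before-≢ irr (lookup-before xs j<i))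

  lookup-before⁻ : ∀ {i j} → Before (toList xs) (Vec.lookup xs i) (Vec.lookup xs j) → toℕ i < toℕ j
  lookup-before⁻ {i} {j} p with Fin.<-cmp i j
  ... | tri< i<j _ _  = i<j
  ... | tri≈ _ refl _ = ⊥-elim (irr p)
  ... | tri> _ _ j<i  = contradiction (lookup-before xs j<i) (before-asym irr p)

-- 𝓛-trees in terms of positions and of vertices

module LTree (G : Graph) (s : Graph.V G) (σ : Vec (Graph.V G) (Graph.order G))
             (search : LexDFS.SearchOrder G s (toList σ)) where
  open Graph G using (V; adj; order; Adj; symmetric)
  open LexDFS G s
  open SearchOrder search
  open Rightmost

  private
    W = toList σ

  rightmost-unique : ∀ {p q x} → Rightmost W p x → Rightmost W q x → p ≡ q
  rightmost-unique pr qr with rightmost pr (precedes qr) (adjacent qr)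
  ... | inj₁ q≡p = sym q≡p
  ... | inj₂ qp with rightmost qr (precedes pr) (adjacent pr)
  ...   | inj₁ p≡q = p≡q
  ...   | inj₂ pq  = contradiction pq (before-asym irrefl qp)

  rightmost⇒ : ∀ {i j} → Rightmost W (Vec.lookup σ j) (Vec.lookup σ i) → RightmostEarlierNeighbour G σ i j
  rightmost⇒ {i} {j} r = record
    { earlier   = lookup-before⁻ σ irrefl (precedes r)
    ; neighbour = symmetric (adjacent r)
    ; rightmost = λ k k<i ik → case rightmost r (lookup-before σ k<i) (symmetric ik) of λ
        { (inj₁ eq) → ℕ.≤-reflexive (cong toℕ (lookup-injective σ irrefl eq))
        ; (inj₂ kj) → ℕ.<⇒≤ (lookup-before⁻ σ irrefl kj) } }

  rightmost⇐ : ∀ {i j} → RightmostEarlierNeighbour G σ i j → Rightmost W (Vec.lookup σ j) (Vec.lookup σ i)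
  rightmost⇐ {i} {j} r = record
    { precedes  = lookup-before σ (REN.earlier r)
    ; adjacent  = symmetric (REN.neighbour r)
    ; rightmost = last }
    where
    module REN = RightmostEarlierNeighbour
    last : ∀ {k} → Before W k (Vec.lookup σ i) → Adj k (Vec.lookup σ i) → k ≡ Vec.lookup σ j ⊎ Before W k (Vec.lookup σ j)
    last ki adj-ki with ∈-toList σ (before-∈ˡ ki)
    ... | k , refl with ℕ.m≤n⇒m<n∨m≡n (REN.rightmost r k (lookup-before⁻ σ irrefl ki) (symmetric adj-ki))
    ...   | inj₁ k<j = inj₂ (lookup-before σ k<j)
    ...   | inj₂ k≡j = inj₁ (cong (Vec.lookup σ) (Fin.toℕ-injective k≡j))

  module _ (parents : ∀ u → u ≢ s → ∃[ p ] Rightmost W p u) where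

    private
      parentOf : V → Maybe V
      parentOf u with u Fin.≟ s
      ... | yes _  = nothing
      ... | no u≢s = just (proj₁ (parents u u≢s))

      parentOf-s : parentOf s ≡ nothing
      parentOf-s with s Fin.≟ s
      ... | yes _  = refl
      ... | no s≢s = contradiction refl s≢s

      parentOf-rightmost : ∀ {u p} → parentOf u ≡ just p → Rightmost W p u
      parentOf-rightmost {u} eq with u Fin.≟ s
      ... | no u≢s with refl ← eq = proj₂ (parents u u≢s)

      parentOf-defined : ∀ {u} → u ≢ s → ∃[ p ] parentOf u ≡ just p
      parentOf-defined {u} u≢s with u Fin.≟ s
      ... | yes u≡s = contradiction u≡s u≢s
      ... | no _    = _ , refl

      -- Induction along the order: the parent of the vertex at the cut comes earlier, so its path
      -- to the root is known already.
      reach : ∀ D vs → Irrefl (D ʳ++ vs) → (∀ {p u} → parentOf u ≡ just p → Before (D ʳ++ vs) p u) →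
              (∀ {u} → u ∈ D → Star (λ u p → parentOf u ≡ just p) u s) →
              ∀ {u} → u ∈ D ʳ++ vs → Star (λ u p → parentOf u ≡ just p) u s
      reach D []       irr before done u∈ with ∈-ʳ++⁻ D u∈
      ... | inj₁ u∈D = done u∈D
      reach D (v ∷ vs) irr before done = reach (v ∷ D) vs irr before λ
        { (here refl) → reach-v ; (there u∈) → done u∈ }
        where
        reach-v : Star (λ u p → parentOf u ≡ just p) v s
        reach-v with v Fin.≟ s
        ... | yes refl = ε
        ... | no v≢s   = let p , pv = parentOf-defined v≢s in pv ◅ done (before-cut D irr (before pv))

    lTree : RootedSpanningTree G s
    lTree = record
      { parent       = parentOf
      ; root-parent  = parentOf-s
      ; parent-adj   = symmetric ∘ adjacent ∘ parentOf-rightmost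
      ; reaches-root = λ u → reach [] W irrefl (precedes ∘ parentOf-rightmost) (λ ()) (complete u)
      }

    lTree-rightmost : ∀ {u p} → RootedSpanningTree.parent lTree u ≡ just p → u ≢ s × Rightmost W p u
    lTree-rightmost eq = (λ { refl → case trans (sym eq) parentOf-s of λ () }) , parentOf-rightmost eq

    isLTree : IsLTree G σ lTree
    isLTree = record
      { root-first = λ i → lookup-first σ i s-first
      ; edges      = λ i j → mk⇔ (rightmost⇒ ∘ parentOf-rightmost) (edge ∘ rightmost⇐) }
      where
      edge : ∀ {i j} → Rightmost W (Vec.lookup σ j) (Vec.lookup σ i) → parentOf (Vec.lookup σ i) ≡ just (Vec.lookup σ j)
      edge {i} r with parentOf-defined {Vec.lookup σ i} (λ eq → not-first (subst (Before W _) eq (precedes r)))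
        where
        not-first : ∀ {a} → ¬ Before W a s
        not-first p with before-cut [] (subst Irrefl s-first irrefl) (subst (λ W → Before W _ s) s-first p)
        ... | ()
      ... | p , eq = trans eq (cong just (rightmost-unique (parentOf-rightmost eq) r))

  par-rightmost : ∀ {t : RootedSpanningTree G s} → IsLTree G σ t →
                  ∀ {p x} → RootedSpanningTree.parent t x ≡ just p → Rightmost W p x
  par-rightmost lt {p} {x} eq with ∈-toList σ (complete x) | ∈-toList σ (complete p)
  ... | i , refl | j , refl = rightmost⇐ (Equivalence.to (IsLTree.edges lt i j) eq)

treeProgram-correct : ∀ G L s {μ} → ComputeLexDFSOrder G s (μ 0) →
  Machine.Runs (encode G L s) treeProgram (20 * suc (Weight.totalWeight G L)) μ (λ μ′ → ComputeLTreeOfLexDFS G s (μ′ 0))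
treeProgram-correct G L s (σ , run , out) =
  Machine.runs-map (encode G L s) (λ {μ} → result {μ}) (RunTree.runs-treeProgram G L s σ search out)
  where
  search = LexDFS.order⇒search G s σ run
  open LTree G s σ search
  result : ∀ {μ : Store} →
    (∀ u → u ≢ s → ∃[ p ] LexDFS.Rightmost G s (toList σ) p u × μ 0 (toℕ u) ≡ toℕ p) →
    ComputeLTreeOfLexDFS G s (μ 0)
  result {μ} found = lTree parents , (σ , run , isLTree parents) , output
    where
    parents : ∀ u → u ≢ s → ∃[ p ] LexDFS.Rightmost G s (toList σ) p u
    parents u u≢s = proj₁ (found u u≢s) , proj₁ (proj₂ (found u u≢s))
    output : ∀ u p → RootedSpanningTree.parent (lTree parents) u ≡ just p → μ 0 (toℕ u) ≡ toℕ p
    output u p eq with lTree-rightmost parents eq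
    ... | u≢s , r = trans (proj₂ (proj₂ (found u u≢s)))
                      (cong toℕ (rightmost-unique (proj₂ (parents u u≢s)) r))

-- The order `σ` behind the tree serves the proof alone. The program sees only the parents, and the
-- order it writes may differ from `σ`.
orderProgram-correct : ∀ G L s {μ} → ComputeLTreeOfLexDFS G s (μ 0) →
  Machine.Runs (encode G L s) orderProgram (96 * suc (Weight.totalWeight G L)) μ (λ μ′ → ComputeLexDFSOrder G s (μ′ 0))
orderProgram-correct G L s (t , (σ , run , lt) , out) =
  Machine.runs-map (encode G L s) (λ {μ} → result {μ})
    (RunOrder.runs-orderProgram G L s t search (par-rightmost {t} lt) (λ {p} {x} → out x p))
  where
  search = LexDFS.order⇒search G s σ run
  open LTree G s σ search
  result : ∀ {μ} → RunOrder.Written G L s t search (par-rightmost {t} lt) μ → ComputeLexDFSOrder G s (μ 0)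
  result {μ} (O , cells , irr , covers , fp , rest , refl)
    with fromList-length O (complete⇒length irr covers)
  ... | σ′ , eq = σ′ , LexDFS.fourPoint⇒order G s σ′ eq irr fp covers ,
    cells-lookup (μ 0) σ′ [] (subst (λ O → Cells (μ 0) (O ʳ++ [])) (sym eq) cells)

-- The factor 3 is 2 from `totalWeight≤` and 1 for the successor, which the vertex `s` pays for.
totalWeight-linear : ∀ G L → Graph.V G → suc (Weight.totalWeight G L) ≤ 3 * (Graph.order G + Graph.size G)
totalWeight-linear G L s = ℕ.+-mono-≤ 1≤ (Weight.totalWeight≤ G L)
  where
  1≤ : 1 ≤ Graph.order G + Graph.size G
  1≤ = ℕ.≤-trans (ℕ.≤-trans (s≤s z≤n) (Fin.toℕ<n s)) (ℕ.m≤m+n (Graph.order G) (Graph.size G))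

O-+ : ∀ {ℓ} (𝒢 : Pred Graph ℓ) M f g → O 𝒢 M f → O 𝒢 M g → O 𝒢 M (λ n m → f n m + g n m)
O-+ 𝒢 M f g (c , k , f≤) (d , l , g≤) = c + d , k + l , λ G G∈ le →
  subst (f (Graph.order G) (Graph.size G) + g (Graph.order G) (Graph.size G) ≤_) (sym (ℕ.*-distribʳ-+ (M (Graph.order G) (Graph.size G)) c d))
    (ℕ.+-mono-≤ (f≤ G G∈ (ℕ.≤-trans (ℕ.m≤m+n k l) le)) (g≤ G G∈ (ℕ.≤-trans (ℕ.m≤n+m l k) le)))

-- `Q` is run after the given program and takes its input from array 0, where it also leaves its
-- result. Its linear number of extra steps is within O(M) by the assumption on `M`, and O(M) is
-- closed under addition.
solvable-⨾ : ∀ {ℓ} (𝒢 : Pred Graph ℓ) M → O 𝒢 _+_ ⊆ O 𝒢 M → ∀ {task task′ : Task} Q K →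
  (∀ G L s {μ} → task G s (μ 0) →
    Machine.Runs (encode G L s) Q (K * suc (Weight.totalWeight G L)) μ (λ μ′ → task′ G s (μ′ 0))) →
  SolvableIn 𝒢 M task → SolvableIn 𝒢 M task′
solvable-⨾ 𝒢 M linear Q K correct (P , τ , τ∈ , solves) =
  P ⨾ Q , (λ n m → τ n m + extra n m) ,
  O-+ 𝒢 M τ extra τ∈ (linear {extra} (K * 3 , 0 , λ G _ _ → ℕ.≤-reflexive (sym (ℕ.*-assoc K 3 _)))) ,
  λ G G∈ L s → case solves G G∈ L s of λ
    { (t , μ , exec , t≤ , done) → case correct G L s done of λ
      { (Machine.runs exec′ u≤ done′) →
          _ , _ , exec-⨾ exec exec′ ,
          ℕ.+-mono-≤ t≤ (ℕ.≤-trans u≤ (ℕ.*-monoʳ-≤ K (totalWeight-linear G L s))) , done′ } }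
  where
  extra : ℕ → ℕ → ℕ
  extra n m = K * (3 * (n + m))

theorem9 : ∀ {ℓ : Level} (𝒢 : Pred Graph ℓ) (M : ℕ → ℕ → ℕ) →
    O 𝒢 _+_ ⊆ O 𝒢 M →
    SolvableIn 𝒢 M ComputeLexDFSOrder ⇔ SolvableIn 𝒢 M ComputeLTreeOfLexDFS
theorem9 𝒢 M linear = mk⇔
  (solvable-⨾ 𝒢 M (λ {f} → linear {f}) {ComputeLexDFSOrder} {ComputeLTreeOfLexDFS} treeProgram 20 treeProgram-correct)
  (solvable-⨾ 𝒢 M (λ {f} → linear {f}) {ComputeLTreeOfLexDFS} {ComputeLexDFSOrder} orderProgram 96 orderProgram-correct)
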